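{- Instances $(G,k)$ of Vertex Cover (VC) have a kernelization with a data reduction chain of length $O(k)$ to a kernel with at most $k^2$ vertices. The soundness of each step in this data reduction can be witnessed by Frege proofs of size polynomial in $|\Phi(G,k)|$. Hence, for every fixed $k$, negative instances $\Phi(G,k)$ of VC (i.e. those where $G$ has no vertex cover of size $k$, $k<vc(G)$) have Frege proofs (of unsatisfiability) of size polynomial in $|\Phi(G,k)|$.
   Context: A vertex cover of a graph $G$ is a set $S\subseteq V(G)$ meeting every edge; $vc(G)$ is the minimum size of a vertex cover. $(G,k)$ is a negative instance of VC iff $k<vc(G)$. Propositional translation $\Phi(G,k)$: variables $Y_{v,w}$ for $v\ne w\in V$ and $X_{v,i}$ for $v\in V$, $1\le i\le k$ ("$v$ is the $i$-th vertex of the cover"). Clauses: unit clause $Y_{v,w}$ for edges, $\overline{Y_{v,w}}$ for non-edges; $\overline{X_{v,i}}\vee\bigvee_{w\neq v}Y_{v,w}$ for all $v,i$; $\bigvee_{v\in V}X_{v,i}$ for each $i$; $\overline{X_{v,i}}\vee\overline{X_{w,i}}$ for $v\ne w$ and each $i$; $\overline{X_{v,i}}\vee\overline{X_{v,j}}$ for each $v$ and $i<j$; $\overline{Y_{v,w}}\vee X_{v,1}\vee\cdots\vee X_{v,k}\vee X_{w,1}\vee\cdots\vee X_{w,k}$ for $v\ne w$. Proof systems. A Frege system is a sound and complete propositional proof system with finitely many axiom schemes and rules (all are polynomially equivalent; fix one whose only rule is modus ponens). The length (size) of a proof is measured by the number of clauses in it. A proof for an unsatisfiable formula means a refutation. Witnessing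 $\Phi_1\vdash\Phi_2$ by Frege proofs means: with disjoint variables $X,Y$ for $\Phi_1,\Phi_2$, there are substitutions $Y_i=\Xi_i[X]$ such that the clauses of $\Phi_2[Y]$, with the substitutions expanded, have a derivation from the clauses of $\Phi_1[X]$. Kernelization. A data reduction rule for a parameterized problem $L$ is an algorithm, polynomial time in $|x|+k$, mapping $(x,k)$ to $(x',k')$ with $(x,k)\in L\iff(x',k')\in L$ and $|x'|\le|x|$. A kernelization is a polynomial-time map to an equivalent instance (the kernel) of size bounded by a computable function of $k$; here it is obtained by applying finitely many data reduction rules as long as possible. A data reduction chain is the sequence of instances so obtained, its length being the number of steps. The soundness of the reduction steps is witnessed by Frege proofs of polynomial size if there are an integer $R\ge 1$ and a polynomial $h$ such that for every negative instance $(x,k)$ and each step $(x_i,k_i)\to(x_{i+1},k_{i+1})$ of its chain there are a tautology $\bigvee_{t=1}^{r}\Xi_{i,t}$ with $r\le R$ and formulas $\eta_{i,t}$ isomorphic (up to renaming) to $\Phi(x_{i+1},k_{i+1})$ such that this tautology and all implications $\Phi(x_i,k_i)\wedge\Xi_{i,t}\vdash\eta_{i,t}$ have Frege proofs of total size at most $h(|\Phi(x,k)|)$.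
   Formalization: The bound of k^2 kernel vertices is claimed only for k ≥ 2 or instances that have a cover of size k; for negative instances with k ≤ 1, e.g. (K_2,0), it is false, since a graph on at most one vertex has no edges, so it cannot be an equivalent negative instance. -}

module Defs where

open import Data.Bool.Base using (Bool; true; false; T; not; _∧_; _∨_; if_then_else_)
open import Data.Fin.Base using (Fin)
open import Data.Fin.Properties using (_≟_; _<?_)
open import Data.Fin.Subset using (Subset; ∣_∣; _∈_)
open import Data.List.Base using (List; []; _∷_; [_]; _++_; map; foldr; filter; length; tabulate; allFin; cartesianProduct)
open import Data.List.Membership.Propositional using () renaming (_∈_ to _∈ˡ_)
open import Data.List.Relation.Unary.All using (All)
open import Data.Nat.Base using (ℕ; zero; suc; _+_; _*_; _^_; _≤_; _<_; _≡ᵇ_)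
open import Data.Nat.ListAction using (sum)
open import Data.Product.Base using (Σ; Σ-syntax; ∃-syntax; _×_; _,_; proj₁; proj₂; uncurry)
open import Data.Sum.Base using (_⊎_)
open import Data.Vec.Base using (Vec; lookup; toList)
open import Function.Base using (_∘_)
open import Function.Bundles using (_↔_; _⇔_; Inverse)
open import Relation.Binary.Construct.Closure.ReflexiveTransitive using (Star; ε; _◅_)
open import Relation.Binary.PropositionalEquality using (_≡_; _≢_)
open import Relation.Nullary.Decidable using (¬?)

------------------------------------------------------------------------
-- Polynomials

-- Coefficients in increasing degree.
Polynomial : Set
Polynomial = List ℕ

evalPoly : Polynomial → ℕ → ℕ
evalPoly p x = foldr (λ a acc → a + x * acc) 0 p

------------------------------------------------------------------------
-- Vertex covers

-- Finite simple graphs.  The two laws are irrelevant, so that equality of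
-- graphs is equality of adjacency matrices.
record Graph : Set where
  field
    order       : ℕ
    matrix      : Vec (Vec Bool order) order

  adj : Fin order → Fin order → Bool
  adj v w = lookup (lookup matrix v) w

  field
    .symmetric   : ∀ v w → adj v w ≡ adj w v
    .irreflexive : ∀ v → adj v v ≡ false

open Graph public using (order; matrix; adj)

IsCover : (G : Graph) → Subset (order G) → Set
IsCover G S = ∀ v w → T (adj G v w) → v ∈ S ⊎ w ∈ S

-- IsVC G c : c = vc(G).
IsVC : Graph → ℕ → Set
IsVC G c = (∃[ S ] IsCover G S × ∣ S ∣ ≡ c) × (∀ S → IsCover G S → c ≤ ∣ S ∣)

Instance : Set
Instance = Graph × ℕ

-- (G , k) ∈ VC, i.e. vc(G) ≤ k.
Positive : Instance → Set
Positive (G , k) = ∃[ c ] IsVC G c × c ≤ k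

Negative : Instance → Set
Negative (G , k) = ∃[ c ] IsVC G c × k < c

-- The length |x| of the graph part, written as an adjacency matrix.
size : Instance → ℕ
size (G , _) = order G * order G

------------------------------------------------------------------------
-- Polynomial time, for Jones' WHILE language over binary trees.  Its
-- polynomial-time functions are those of Turing machines.

data Tree : Set where
  nil  : Tree
  cons : Tree → Tree → Tree

data Expr : Set where
  var   : ℕ → Expr
  nil   : Expr
  cons  : Expr → Expr → Expr
  hd tl : Expr → Expr

infixr 5 _⨟_
infix  6 _≔_

data Command : Set where
  _≔_   : ℕ → Expr → Command
  _⨟_   : Command → Command → Command
  while : Expr → Command → Command

Store : Set
Store = ℕ → Tree

_[_↦_] : Store → ℕ → Tree → Store
(s [ x ↦ d ]) y = if x ≡ᵇ y then d else s y

head tail : Tree → Tree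
head nil        = nil
head (cons d _) = d
tail nil        = nil
tail (cons _ d) = d

evalExpr : Expr → Store → Tree
evalExpr (var x)    s = s x
evalExpr nil        s = nil
evalExpr (cons e f) s = cons (evalExpr e s) (evalExpr f s)
evalExpr (hd e)     s = head (evalExpr e s)
evalExpr (tl e)     s = tail (evalExpr e s)

cost : Expr → ℕ
cost (var _)    = 1
cost nil        = 1
cost (cons e f) = suc (cost e + cost f)
cost (hd e)     = suc (cost e)
cost (tl e)     = suc (cost e)

-- Run c s s′ t : from store s, the command c halts in store s′ after time t.
data Run : Command → Store → Store → ℕ → Set where
  assign : ∀ {x e s} → Run (x ≔ e) s (s [ x ↦ evalExpr e s ]) (suc (cost e))
  seq    : ∀ {c d s s′ s″ t u} → Run c s s′ t → Run d s′ s″ u →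
           Run (c ⨟ d) s s″ (t + u)
  stop   : ∀ {e c s} → evalExpr e s ≡ nil → Run (while e c) s s (suc (cost e))
  loop   : ∀ {e c s s′ s″ t u} → evalExpr e s ≢ nil →
           Run c s s′ t → Run (while e c) s′ s″ u →
           Run (while e c) s s″ (suc (cost e) + t + u)

-- Input and output are held in variable 0.
Outputs : Command → Tree → Tree → ℕ → Set
Outputs c input output t =
  ∃[ s ] Run c ((λ _ → nil) [ 0 ↦ input ]) s t × s 0 ≡ output

encodeList : ∀ {A : Set} → (A → Tree) → List A → Tree
encodeList f = foldr (cons ∘ f) nil

encodeBool : Bool → Tree
encodeBool false = nil
encodeBool true  = cons nil nil

unary : ℕ → Tree
unary zero    = nil
unary (suc k) = cons nil (unary k)

encode : Instance → Tree
encode (G , k) =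
  cons (encodeList (encodeList encodeBool ∘ toList) (toList (matrix G))) (unary k)

PolyTime : (Instance → Instance) → Set
PolyTime f = Σ[ c ∈ Command ] Σ[ p ∈ Polynomial ] ∀ x →
  ∃[ t ] t ≤ evalPoly p (size x + proj₂ x) × Outputs c (encode x) (encode (f x)) t

Computable : (ℕ → ℕ) → Set
Computable f = Σ[ c ∈ Command ] ∀ k → ∃[ t ] Outputs c (unary k) (unary (f k)) t

------------------------------------------------------------------------
-- Kernelization

record Rule : Set where
  field
    apply      : Instance → Instance
    polyTime   : PolyTime apply
    equivalent : ∀ x → Positive x ⇔ Positive (apply x)
    shrinking  : ∀ x → size (apply x) ≤ size x

open Rule public using (apply)

-- One step applies the first rule that changes the instance; hence every
-- instance has a unique data reduction chain.
data Step : List Rule → Instance → Instance → Set where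
  here  : ∀ {r rs x y} → apply r x ≡ y → x ≢ y → Step (r ∷ rs) x y
  there : ∀ {r rs x y} → apply r x ≡ x → Step rs x y → Step (r ∷ rs) x y

Irreducible : List Rule → Instance → Set
Irreducible rs x = All (λ r → apply r x ≡ x) rs

Chain : List Rule → Instance → Instance → Set
Chain rs = Star (Step rs)

chainLength : ∀ {rs x y} → Chain rs x y → ℕ
chainLength ε       = 0
chainLength (_ ◅ c) = suc (chainLength c)

record Kernelization : Set where
  field
    rules           : List Rule
    kernel          : Instance → Instance
    chain           : ∀ x → Chain rules x (kernel x)
    exhausted       : ∀ x → Irreducible rules (kernel x)
    polyTime        : PolyTime kernel
    equivalent      : ∀ x → Positive x ⇔ Positive (kernel x)
    bound           : ℕ → ℕ
    boundComputable : Computable bound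
    bounded         : ∀ x → size (kernel x) + proj₂ (kernel x) ≤ bound (proj₂ x)

open Kernelization public using (rules; kernel; chain)

-- The bound is C (k + 1) rather than C k so as to make sense at k = 0, where a
-- non-empty graph may still have to be reduced.
LinearChains : Kernelization → Set
LinearChains K = ∃[ C ] ∀ G k → chainLength (chain K (G , k)) ≤ C * suc k

-- For k ≤ 1 a negative instance has no equivalent instance on at most k²
-- vertices: a simple graph with at most one vertex is edgeless.
QuadraticKernel : Kernelization → Set
QuadraticKernel K = ∀ G k → 2 ≤ k ⊎ Positive (G , k) →
  order (proj₁ (kernel K (G , k))) ≤ k ^ 2

------------------------------------------------------------------------
-- Formulas

infix  8 `¬_
infixr 7 _`∧_
infixr 6 _`∨_
infixr 5 _`⇒_

data Formula (V : Set) : Set where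
  `_             : V → Formula V
  `⊥             : Formula V
  `¬_            : Formula V → Formula V
  _`∧_ _`∨_ _`⇒_ : Formula V → Formula V → Formula V

⋁ : ∀ {V : Set} → List (Formula V) → Formula V
⋁ = foldr _`∨_ `⊥

substitute : ∀ {V W : Set} → (V → Formula W) → Formula V → Formula W
substitute σ (` x)    = σ x
substitute σ `⊥       = `⊥
substitute σ (`¬ A)   = `¬ substitute σ A
substitute σ (A `∧ B) = substitute σ A `∧ substitute σ B
substitute σ (A `∨ B) = substitute σ A `∨ substitute σ B
substitute σ (A `⇒ B) = substitute σ A `⇒ substitute σ B

⟦_⟧ : ∀ {V : Set} → Formula V → (V → Bool) → Bool
⟦ ` x    ⟧ α = α x
⟦ `⊥     ⟧ α = false
⟦ `¬ A   ⟧ α = not (⟦ A ⟧ α)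
⟦ A `∧ B ⟧ α = ⟦ A ⟧ α ∧ ⟦ B ⟧ α
⟦ A `∨ B ⟧ α = ⟦ A ⟧ α ∨ ⟦ B ⟧ α
⟦ A `⇒ B ⟧ α = not (⟦ A ⟧ α) ∨ ⟦ B ⟧ α

Tautology : ∀ {V : Set} → Formula V → Set
Tautology A = ∀ α → ⟦ A ⟧ α ≡ true

data Literal (V : Set) : Set where
  pos neg : V → Literal V

Clause CNF : Set → Set
Clause V = List (Literal V)
CNF    V = List (Clause V)

literal : ∀ {V : Set} → Literal V → Formula V
literal (pos x) = ` x
literal (neg x) = `¬ (` x)

clauses : ∀ {V : Set} → CNF V → List (Formula V)
clauses = map (⋁ ∘ map literal)

renameLiteral : ∀ {V W : Set} → (V → W) → Literal V → Literal W
renameLiteral ρ (pos x) = pos (ρ x)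
renameLiteral ρ (neg x) = neg (ρ x)

rename : ∀ {V W : Set} → (V → W) → CNF V → CNF W
rename ρ = map (map (renameLiteral ρ))

-- Isomorphism up to renaming of the variables.
_≅_ : ∀ {V W : Set} → CNF V → CNF W → Set
_≅_ {V} {W} F F′ = Σ[ ρ ∈ V ↔ W ] rename (Inverse.to ρ) F ≡ F′

------------------------------------------------------------------------
-- Frege proofs

-- Kleene's axiom schemes for classical propositional logic, with ex falso
-- added for the constant ⊥.
data Axiom {V : Set} : Formula V → Set where
  ⇒K  : ∀ A B → Axiom (A `⇒ B `⇒ A)
  ⇒S  : ∀ A B C → Axiom ((A `⇒ B) `⇒ (A `⇒ B `⇒ C) `⇒ A `⇒ C)
  ∧I  : ∀ A B → Axiom (A `⇒ B `⇒ A `∧ B)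
  ∧E₁ : ∀ A B → Axiom (A `∧ B `⇒ A)
  ∧E₂ : ∀ A B → Axiom (A `∧ B `⇒ B)
  ∨I₁ : ∀ A B → Axiom (A `⇒ A `∨ B)
  ∨I₂ : ∀ A B → Axiom (B `⇒ A `∨ B)
  ∨E  : ∀ A B C → Axiom ((A `⇒ C) `⇒ (B `⇒ C) `⇒ A `∨ B `⇒ C)
  ¬I  : ∀ A B → Axiom ((A `⇒ B) `⇒ (A `⇒ `¬ B) `⇒ `¬ A)
  ¬E  : ∀ A → Axiom (`¬ `¬ A `⇒ A)
  ⊥E  : ∀ A → Axiom (`⊥ `⇒ A)

-- Derivation Γ L : the lines of L, last line first, are a Frege derivation
-- from the hypotheses Γ.
data Derivation {V : Set} (Γ : List (Formula V)) : List (Formula V) → Set where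
  []   : Derivation Γ []
  ax   : ∀ {L A} → Axiom A → Derivation Γ L → Derivation Γ (A ∷ L)
  hyp  : ∀ {L A} → A ∈ˡ Γ → Derivation Γ L → Derivation Γ (A ∷ L)
  mp   : ∀ {L A B} → (A `⇒ B) ∈ˡ L → A ∈ˡ L → Derivation Γ L → Derivation Γ (B ∷ L)

-- A derivation of all formulas of Δ from Γ, with exactly s lines.
_⊢[_]_ : ∀ {V : Set} → List (Formula V) → ℕ → List (Formula V) → Set
Γ ⊢[ s ] Δ = ∃[ L ] Derivation Γ L × All (_∈ˡ L) Δ × length L ≡ s

-- Γ ⊢ F up to a substitution for the (disjoint) variables of F.
Witnessed : ∀ {V W : Set} → List (Formula V) → CNF W → ℕ → Set
Witnessed {V} {W} Γ F s =
  Σ[ σ ∈ (W → Formula V) ] Γ ⊢[ s ] map (substitute σ) (clauses F)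

------------------------------------------------------------------------
-- The propositional translation

-- Y v v does not occur in the translation.
data Var (n k : ℕ) : Set where
  Y : Fin n → Fin n → Var n k
  X : Fin n → Fin k → Var n k

distinctPairs : ∀ n → List (Fin n × Fin n)
distinctPairs n = filter (λ (v , w) → ¬? (v ≟ w)) (cartesianProduct (allFin n) (allFin n))

increasingPairs : ∀ k → List (Fin k × Fin k)
increasingPairs k = filter (λ (i , j) → i <? j) (cartesianProduct (allFin k) (allFin k))

VarOf : Instance → Set
VarOf (G , k) = Var (order G) k

Φ : (x : Instance) → CNF (VarOf x)
Φ (G , k) =
     map (λ (v , w) → [ if adj G v w then pos (Y v w) else neg (Y v w) ]) (distinctPairs n)
  ++ map (λ (v , i) → neg (X v i) ∷ map (λ w → pos (Y v w)) (filter (λ w → ¬? (w ≟ v)) (allFin n)))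
         (cartesianProduct (allFin n) (allFin k))
  ++ map (λ i → map (λ v → pos (X v i)) (allFin n)) (allFin k)
  ++ map (λ ((v , w) , i) → neg (X v i) ∷ neg (X w i) ∷ [])
         (cartesianProduct (distinctPairs n) (allFin k))
  ++ map (λ (v , i , j) → neg (X v i) ∷ neg (X v j) ∷ [])
         (cartesianProduct (allFin n) (increasingPairs k))
  ++ map (λ (v , w) → neg (Y v w) ∷ map (λ i → pos (X v i)) (allFin k)
                                  ++ map (λ i → pos (X w i)) (allFin k))
         (distinctPairs n)
  where n = order G

-- |Φ(G,k)|; like proofs, formulas are measured by their number of clauses.
Φsize : Instance → ℕ
Φsize x = length (Φ x)

------------------------------------------------------------------------
-- Polynomial-size Frege proofs for vertex cover

-- Soundness of the step x → y, with at most R cases and total proof size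
-- at most m.
record StepWitness (R m : ℕ) (x y : Instance) : Set₁ where
  field
    r            : ℕ
    r≤R          : r ≤ R
    Ξ            : Fin r → Formula (VarOf x)
    tautology    : Tautology (⋁ (tabulate Ξ))
    s₀           : ℕ
    proof        : [] ⊢[ s₀ ] [ ⋁ (tabulate Ξ) ]
    W            : Fin r → Set
    η            : ∀ t → CNF (W t)
    η-iso        : ∀ t → Φ y ≅ η t
    s            : Fin r → ℕ
    implications : ∀ t → Witnessed (Ξ t ∷ clauses (Φ x)) (η t) (s t)
    total        : s₀ + sum (tabulate s) ≤ m

-- Since chains are unique, the steps of the chain of x are those that start at
-- an instance reachable from x.
FregeSound : Kernelization → Set₁
FregeSound K = Σ[ R ∈ ℕ ] Σ[ h ∈ Polynomial ] 1 ≤ R × (∀ x → Negative x →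
  ∀ {y z} → Chain (rules K) x y → Step (rules K) y z → StepWitness R (evalPoly h (Φsize x)) y z)

-- Polynomial-size refutations of the negative instances with parameter k.
PolyRefutable : ℕ → Set
PolyRefutable k = Σ[ p ∈ Polynomial ] ∀ G → Negative (G , k) →
  ∃[ s ] s ≤ evalPoly p (Φsize (G , k)) × clauses (Φ (G , k)) ⊢[ s ] [ `⊥ ]

{-# OPTIONS --safe #-}
-- The kernelization is one idempotent rule.  Let H be the set of vertices of
-- degree at least k.  If some neighbourhood, or H itself, is a cover of size at
-- most k, the instance is positive; otherwise H lies in every cover of size at
-- most k.  The vertices outside H whose neighbours all lie in H can only waste a
-- place of the cover, so all but k - 1 of them (all of them if H is empty) are
-- deleted, and the remaining ones are joined to all of H, so that k need not
-- change.  If more than k² vertices remain, the instance is negative.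
--
-- Every refutation needed is a charging argument: each of the k cover vertices
-- pays for at most k pigeons, which is too few.  Its Frege version is Cook's
-- extended-resolution proof of the pigeonhole principle: as proofs are measured
-- by their number of lines, the extension variables can be substituted away.
--
-- Positions of the cover occupied by deleted vertices are filled by the k - 1
-- remaining wasteful ones, together with the place freed by a vertex of H.
module Submission where

open import Defs
open import Data.Bool.Base using (Bool; true; T; _∧_; false; not; _∨_; if_then_else_)
open import Data.Bool.ListAction using (all; and)
open import Data.Bool.Properties
  using (T-∧; T?; T-irrelevant; ∧-assoc; ∧-identityʳ; if-float) renaming (_≟_ to _≟ᵇ_)
open import Data.Empty using (⊥-elim; ⊥)
open import Data.Fin.Base using (suc; Fin; zero; toℕ; fromℕ<; inject≤; combine; remQuot)
import Data.Fin.Properties as Fin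
open import Data.Fin.Subset using (Subset; ∣_∣; _∈_) renaming (⊥ to ∅)
open import Data.Fin.Subset.Properties using (anySubset?; ∣⊥∣≡0)
open import Data.List.Base as List
  using ([]; _∷_; [_]; map; List; _++_; length; tabulate; allFin; cartesianProduct; replicate;
    concatMap; filter; foldl; reverse; reverseAcc; drop; null)
import Data.List.Membership.DecPropositional as DecMembership
open import Data.List.Membership.Propositional using () renaming (_∈_ to _∈ˡ_)
open import Data.List.Membership.Propositional.Properties
open import Data.List.Properties
  using (length-map; length-++; length-tabulate; length-filter; map-++; reverse-involutive; drop-drop;
    length-replicate; map-cong; map-∘; map-id)
open import Data.List.Relation.Unary.All as All using (All; []; _∷_)
import Data.List.Relation.Unary.All.Properties as AllP
open import Data.List.Relation.Unary.Any using (here; there; index)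
open import Data.List.Relation.Unary.Any.Properties using (lookup-index)
open import Data.Nat.Base
  using (ℕ; _+_; _*_; _≤_; _≤ᵇ_; z≤n; suc; s≤s; zero; _^_; _<_; pred; >-nonZero; _≡ᵇ_; NonZero)
open import Data.Nat.Properties
open import Data.Nat.Solver using (module +-*-Solver)
open import Data.Product.Base using (_×_; proj₁; proj₂; ∃-syntax; _,_; Σ-syntax; uncurry)
open import Data.Sum.Base as Sum using (_⊎_; inj₁; inj₂; [_,_]′)
open import Data.Unit.Base using (tt; ⊤)
open import Data.Vec.Base as Vec using (Vec; []; _∷_; lookup; zipWith; _[_]≔_; toList)
open import Data.Vec.Properties as Vec
  using (lookup-zipWith; lookup∘update; lookup∘update′; lookup-map; lookup-zip; lookup∘tabulate;
    []=⇒lookup; lookup⇒[]=; toList-map; length-toList)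
open import Function.Base using (_∘_; id)
open import Function.Bundles using (Equivalence; _⇔_; mk⇔)
open import Function.Construct.Identity using (↔-id)
open import Relation.Binary.Construct.Closure.ReflexiveTransitive using (ε; _◅_)
open import Relation.Binary.Definitions using (tri<; tri≈; tri>)
open import Relation.Binary.PropositionalEquality hiding ([_])
open import Relation.Nullary using (¬_; yes; no; contradiction; Dec; does)
open import Relation.Nullary.Decidable using (¬?; recompute; _×-dec_)
open +-*-Solver using (solve; con; _:+_; _:*_; _:=_)

T∧⁻ : ∀ {a b} → T (a ∧ b) → T a × T b
T∧⁻ = Equivalence.to T-∧

infixl 6 _⊕_
infixl 7 _⊗_

_⊕_ : Polynomial → Polynomial → Polynomial
[]      ⊕ q       = q
(a ∷ p) ⊕ []      = a ∷ p
(a ∷ p) ⊕ (b ∷ q) = a + b ∷ p ⊕ q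

scale : ℕ → Polynomial → Polynomial
scale c = map (c *_)

infix 4 _≤ᵖ_

_≤ᵖ_ : Polynomial → Polynomial → Bool
[]      ≤ᵖ q       = true
(a ∷ p) ≤ᵖ []      = (a ≤ᵇ 0) ∧ (p ≤ᵖ [])
(a ∷ p) ≤ᵖ (b ∷ q) = (a ≤ᵇ b) ∧ (p ≤ᵖ q)

opaque
  -- Opaque because coefficients are large and unfolded products lose sharing.
  _⊗_ : Polynomial → Polynomial → Polynomial
  []      ⊗ q = []
  (a ∷ p) ⊗ q = scale a q ⊕ (0 ∷ p ⊗ q)

  _⊚_ : Polynomial → Polynomial → Polynomial
  []      ⊚ q = []
  (a ∷ p) ⊚ q = [ a ] ⊕ q ⊗ (p ⊚ q)

  ev : Polynomial → ℕ → ℕ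
  ev = evalPoly

  ev-evalPoly : ∀ p x → ev p x ≡ evalPoly p x
  ev-evalPoly p x = refl

  ⊕-eval : ∀ p q x → ev (p ⊕ q) x ≡ ev p x + ev q x
  ⊕-eval []      q       x = refl
  ⊕-eval (a ∷ p) []      x = sym (+-identityʳ _)
  ⊕-eval (a ∷ p) (b ∷ q) x rewrite ⊕-eval p q x =
    solve 5 (λ a b x P Q → a :+ b :+ x :* (P :+ Q) := (a :+ x :* P) :+ (b :+ x :* Q)) refl
      a b x (ev p x) (ev q x)

  scale-eval : ∀ c p x → ev (scale c p) x ≡ c * ev p x
  scale-eval c []      x = sym (*-zeroʳ c)
  scale-eval c (a ∷ p) x rewrite scale-eval c p x =
    solve 4 (λ c a x P → c :* a :+ x :* (c :* P) := c :* (a :+ x :* P)) refl c a x (ev p x)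

  ⊗-eval : ∀ p q x → ev (p ⊗ q) x ≡ ev p x * ev q x
  ⊗-eval []      q x = refl
  ⊗-eval (a ∷ p) q x
    rewrite ⊕-eval (scale a q) (0 ∷ p ⊗ q) x | scale-eval a q x | ⊗-eval p q x =
    solve 4 (λ a x P Q → a :* Q :+ x :* (P :* Q) := (a :+ x :* P) :* Q) refl
      a x (ev p x) (ev q x)

  const-eval : ∀ a x → ev [ a ] x ≡ a
  const-eval a x rewrite *-zeroʳ x = +-identityʳ a

  shift-eval : ∀ p x → ev (0 ∷ p) x ≡ x * ev p x
  shift-eval p x = refl

  ⊚-eval : ∀ p q x → ev (p ⊚ q) x ≡ ev p (ev q x)
  ⊚-eval []      q x = refl
  ⊚-eval (a ∷ p) q x
    rewrite ⊕-eval [ a ] (q ⊗ (p ⊚ q)) x | const-eval a x | ⊗-eval q (p ⊚ q) x | ⊚-eval p q x = refl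

  ev-mono : ∀ p {x y} → x ≤ y → ev p x ≤ ev p y
  ev-mono []      x≤y = z≤n
  ev-mono (a ∷ p) x≤y = +-monoʳ-≤ a (*-mono-≤ x≤y (ev-mono p x≤y))

  ≤ᵖ-sound : ∀ p q → T (p ≤ᵖ q) → ∀ x → ev p x ≤ ev q x
  ≤ᵖ-sound []      q       _ x = z≤n
  ≤ᵖ-sound (a ∷ p) []      t x =
    +-mono-≤ (≤ᵇ⇒≤ a 0 (proj₁ (T∧⁻ t)))
      (≤-trans (*-monoʳ-≤ x (≤ᵖ-sound p [] (proj₂ (T∧⁻ t)) x)) (≤-reflexive (*-zeroʳ x)))
  ≤ᵖ-sound (a ∷ p) (b ∷ q) t x =
    +-mono-≤ (≤ᵇ⇒≤ a b (proj₁ (T∧⁻ t))) (*-monoʳ-≤ x (≤ᵖ-sound p q (proj₂ (T∧⁻ t)) x))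

shift : Polynomial → Polynomial
shift p = 0 ∷ p

mpᶜ : Polynomial → Polynomial → Polynomial
mpᶜ p q = [ 1 ] ⊕ (p ⊕ q)

module Frege {V : Set} (N : ℕ) where

  infix 3 _⊩⟨_⟩_ _⊢⟨_⟩_

  record _⊩⟨_⟩_ (Γ : List (Formula V)) (p : Polynomial) (Δ : List (Formula V)) : Set where
    constructor derived
    field
      {lines}     : List (Formula V)
      derivation  : Derivation Γ lines
      conclusions : All (_∈ˡ lines) Δ
      short       : length lines ≤ ev p N

  open _⊩⟨_⟩_ public

  _⊢⟨_⟩_ : List (Formula V) → Polynomial → Formula V → Set
  Γ ⊢⟨ p ⟩ A = Γ ⊩⟨ p ⟩ [ A ]

  private variable
    Γ Γ′ Δ Δ′ L L′ : List (Formula V)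
    A B C : Formula V
    p q r : Polynomial

  relax : ev p N ≤ ev q N → Γ ⊩⟨ p ⟩ Δ → Γ ⊩⟨ q ⟩ Δ
  relax p≤q (derived d c s) = derived d c (≤-trans s p≤q)

  weaken : {t : T (p ≤ᵖ q)} → Γ ⊩⟨ p ⟩ Δ → Γ ⊩⟨ q ⟩ Δ
  weaken {p = p} {q = q} {t = t} = relax (≤ᵖ-sound p q t N)

  replay : Derivation Γ L → (∀ {A} → A ∈ˡ Γ′ → A ∈ˡ Γ ⊎ A ∈ˡ L) → Derivation Γ′ L′ →
    ∃[ K ] Derivation Γ K × (∀ {A} → A ∈ˡ L → A ∈ˡ K) × (∀ {A} → A ∈ˡ L′ → A ∈ˡ K) ×
      length K ≤ length L + length L′
  replay {L = L} d f [] = L , d , id , (λ ()) , m≤m+n _ 0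
  replay {L = L} d f (ax {L′} a e) with replay d f e
  ... | K , k , l , l′ , s = _ , ax a k , there ∘ l ,
    (λ { (here eq) → here eq ; (there i) → there (l′ i) }) ,
    ≤-trans (s≤s s) (≤-reflexive (sym (+-suc (length L) (length L′))))
  replay {L = L} d f (mp {L′} i j e) with replay d f e
  ... | K , k , l , l′ , s = _ , mp (l′ i) (l′ j) k , there ∘ l ,
    (λ { (here eq) → here eq ; (there i) → there (l′ i) }) ,
    ≤-trans (s≤s s) (≤-reflexive (sym (+-suc (length L) (length L′))))
  replay {L = L} d f (hyp {L′} h e) with replay d f e | f h
  ... | K , k , l , l′ , s | inj₁ h′ = _ , hyp h′ k , there ∘ l ,
    (λ { (here eq) → here eq ; (there i) → there (l′ i) }) ,
    ≤-trans (s≤s s) (≤-reflexive (sym (+-suc (length L) (length L′))))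
  ... | K , k , l , l′ , s | inj₂ h′ = K , k , l ,
    (λ { (here refl) → l h′ ; (there i) → l′ i }) ,
    ≤-trans s (+-monoʳ-≤ (length L) (n≤1+n _))

  cut : Γ ⊩⟨ p ⟩ Δ → Δ ++ Γ ⊩⟨ q ⟩ Δ′ → Γ ⊩⟨ p ⊕ q ⟩ Δ′
  cut {p = p} {Δ = Δ} {q = q} (derived {L} d c s) (derived e c′ s′)
    with replay d ([ inj₂ ∘ All.lookup c , inj₁ ]′ ∘ ∈-++⁻ Δ) e
  ... | K , k , l , l′ , s″ = derived k (All.map l′ c′)
    (≤-trans s″ (≤-trans (+-mono-≤ s s′) (≤-reflexive (sym (⊕-eval p q N)))))

  weakenʰ : (∀ {A} → A ∈ˡ Γ → A ∈ˡ Γ′) → Γ ⊩⟨ p ⟩ Δ → Γ′ ⊩⟨ p ⟩ Δ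
  weakenʰ f (derived d c s) with replay [] (inj₁ ∘ f) d
  ... | K , k , _ , l′ , s′ = derived k (All.map l′ c) (≤-trans s′ s)

  wk : Γ ⊩⟨ p ⟩ Δ → B ∷ Γ ⊩⟨ p ⟩ Δ
  wk = weakenʰ there

  join : Γ ⊩⟨ p ⟩ Δ → Γ ⊩⟨ q ⟩ Δ′ → Γ ⊩⟨ p ⊕ q ⟩ Δ ++ Δ′
  join {p = p} {q = q} (derived {L} d c s) (derived e c′ s′) with replay d inj₁ e
  ... | K , k , l , l′ , s″ = derived k (AllP.++⁺ (All.map l c) (All.map l′ c′))
    (≤-trans s″ (≤-trans (+-mono-≤ s s′) (≤-reflexive (sym (⊕-eval p q N)))))

  assume : A ∈ˡ Γ → Γ ⊢⟨ [ 1 ] ⟩ A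
  assume i = derived (hyp i []) (here refl ∷ []) (≤-reflexive (sym (const-eval 1 N)))

  axiom : Axiom A → Γ ⊢⟨ [ 1 ] ⟩ A
  axiom a = derived (ax a []) (here refl ∷ []) (≤-reflexive (sym (const-eval 1 N)))

  infixl 5 _$ᶠ_
  _$ᶠ_ : Γ ⊢⟨ p ⟩ A `⇒ B → Γ ⊢⟨ q ⟩ A → Γ ⊢⟨ [ 1 ] ⊕ (p ⊕ q) ⟩ B
  _$ᶠ_ {p = p} {q = q} f a with join f a
  ... | derived d (i ∷ j ∷ []) s = derived (mp i j d) (here refl ∷ [])
    (≤-trans (s≤s s) (≤-reflexive
      (sym (trans (⊕-eval [ 1 ] (p ⊕ q) N) (cong (_+ ev (p ⊕ q) N) (const-eval 1 N))))))

  deduce : Derivation (A ∷ Γ) L →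
    ∃[ K ] Derivation Γ K × (∀ {B} → B ∈ˡ L → (A `⇒ B) ∈ˡ K) × length K ≤ length L * 5
  deduce [] = [] , [] , (λ ()) , z≤n
  deduce {A = A} (ax {A = B} a d) with deduce d
  ... | K , k , f , s = _ ,
    mp (there (here refl)) (here refl) (ax a (ax (⇒K B A) k)) ,
    (λ { (here refl) → here refl ; (there i) → there (there (there (f i))) }) ,
    +-monoʳ-≤ 3 (≤-trans s (m≤n+m _ 2))
  deduce {A = A} (hyp {A = B} (there h) d) with deduce d
  ... | K , k , f , s = _ ,
    mp (there (here refl)) (here refl) (hyp h (ax (⇒K B A) k)) ,
    (λ { (here refl) → here refl ; (there i) → there (there (there (f i))) }) ,
    +-monoʳ-≤ 3 (≤-trans s (m≤n+m _ 2))
  deduce {A = A} (hyp (here refl) d) with deduce d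
  ... | K , k , f , s = _ ,
    mp (here refl) (there (there (here refl)))
      (mp (here refl) (there (there (here refl)))
        (ax (⇒S A (A `⇒ A) A) (ax (⇒K A (A `⇒ A)) (ax (⇒K A A) k)))) ,
    (λ { (here refl) → here refl ; (there i) → there (there (there (there (there (f i))))) }) ,
    +-monoʳ-≤ 5 s
  deduce {A = A} (mp {A = B} {B = C} i j d) with deduce d
  ... | K , k , f , s = _ ,
    mp (here refl) (there (there (f i))) (mp (here refl) (there (f j)) (ax (⇒S A B C) k)) ,
    (λ { (here refl) → here refl ; (there i) → there (there (there (f i))) }) ,
    +-monoʳ-≤ 3 (≤-trans s (m≤n+m _ 2))

  ded : A ∷ Γ ⊢⟨ p ⟩ B → Γ ⊢⟨ scale 5 p ⟩ A `⇒ B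
  ded {p = p} (derived {L} d (i ∷ []) s) with deduce d
  ... | K , k , f , s′ = derived k (f i ∷ []) (≤-trans s′ (≤-trans (≤-reflexive (*-comm (length L) 5))
    (≤-trans (*-monoʳ-≤ 5 s) (≤-reflexive (sym (scale-eval 5 p N))))))

  collect : ∀ l → (∀ {A} → A ∈ˡ l → Γ ⊢⟨ p ⟩ A) → Γ ⊩⟨ scale (length l) p ⟩ l
  collect []      f = derived [] [] z≤n
  collect {p = p} (A ∷ l) f = relax
    (≤-reflexive (trans (⊕-eval p (scale (length l) p) N)
      (trans (cong (ev p N +_) (scale-eval (length l) p N)) (sym (scale-eval (suc (length l)) p N)))))
    (join (f (here refl)) (collect l (f ∘ there)))

  scale≤shift : ∀ {c} p → c ≤ N → ev (scale c p) N ≤ ev (shift p) N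
  scale≤shift {c} p c≤N = ≤-trans (≤-reflexive (scale-eval c p N))
      (≤-trans (*-monoˡ-≤ (ev p N) c≤N) (≤-reflexive (sym (shift-eval p N))))

  collect-≤ : ∀ l → length l ≤ N → (∀ {A} → A ∈ˡ l → Γ ⊢⟨ p ⟩ A) → Γ ⊩⟨ shift p ⟩ l
  collect-≤ {p = p} l l≤N f = relax (scale≤shift p l≤N) (collect l f)

  private
    v₀ : B ∷ Γ ⊢⟨ [ 1 ] ⟩ B
    v₀ = assume (here refl)

    v₁ : A ∷ B ∷ Γ ⊢⟨ [ 1 ] ⟩ B
    v₁ = assume (there (here refl))

    v₂ : A ∷ B ∷ C ∷ Γ ⊢⟨ [ 1 ] ⟩ C
    v₂ = assume (there (there (here refl)))

  compose : Γ ⊢⟨ [ 200 ] ⟩ (A `⇒ B) `⇒ (B `⇒ C) `⇒ A `⇒ C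
  compose {A = A} = weaken (ded (ded (axiom (⇒S A _ _) $ᶠ v₁ $ᶠ (axiom (⇒K _ _) $ᶠ v₀))))

  infixr 4 _⟫_
  _⟫_ : Γ ⊢⟨ p ⟩ A `⇒ B → Γ ⊢⟨ q ⟩ B `⇒ C → Γ ⊢⟨ mpᶜ (mpᶜ [ 200 ] p) q ⟩ A `⇒ C
  f ⟫ g = compose $ᶠ f $ᶠ g

  absurd : Γ ⊢⟨ [ 300 ] ⟩ A `⇒ `¬ A `⇒ `⊥
  absurd {A = A} = weaken (ded (ded
    (axiom (¬E `⊥) $ᶠ (axiom (¬I (`¬ `⊥) A) $ᶠ (axiom (⇒K _ _) $ᶠ v₁) $ᶠ (axiom (⇒K _ _) $ᶠ v₀)))))

  negate : Γ ⊢⟨ [ 200 ] ⟩ (A `⇒ `⊥) `⇒ `¬ A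
  negate {A = A} = weaken (ded (axiom (¬I A `⊥) $ᶠ v₀ $ᶠ ded (axiom (⊥E _) $ᶠ (v₁ $ᶠ v₀))))

  ⊤ᶠ : Γ ⊢⟨ [ 202 ] ⟩ `¬ `⊥
  ⊤ᶠ = weaken (negate $ᶠ axiom (⊥E `⊥))

  by-contradiction : Γ ⊢⟨ [ 1100 ] ⟩ (`¬ A `⇒ `⊥) `⇒ A
  by-contradiction = weaken (ded (axiom (¬E _) $ᶠ (negate $ᶠ v₀)))

  ⇒-to-∨ : Γ ⊢⟨ [ 200000 ] ⟩ (A `⇒ B) `⇒ `¬ A `∨ B
  ⇒-to-∨ {A = A} {B = B} = weaken (ded (by-contradiction $ᶠ ded
    (absurd {A = `¬ A `∨ B}
      $ᶠ (axiom (∨I₁ _ _) $ᶠ (negate $ᶠ ded (absurd $ᶠ (axiom (∨I₂ _ _) $ᶠ (v₂ $ᶠ v₀)) $ᶠ v₁)))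
      $ᶠ v₀)))

  ∨-to-⇒ : Γ ⊢⟨ [ 9000 ] ⟩ `¬ A `∨ B `⇒ A `⇒ B
  ∨-to-⇒ = weaken (axiom (∨E _ _ _)
    $ᶠ ded (ded (axiom (⊥E _) $ᶠ (absurd $ᶠ v₀ $ᶠ v₁)))
    $ᶠ axiom (⇒K _ _))

  ∨-elim : Γ ⊢⟨ p ⟩ A `⇒ C → Γ ⊢⟨ q ⟩ B `⇒ C → Γ ⊢⟨ mpᶜ (mpᶜ [ 1 ] p) q ⟩ A `∨ B `⇒ C
  ∨-elim f g = axiom (∨E _ _ _) $ᶠ f $ᶠ g

  private
    mp-eval : ∀ p q → ev (mpᶜ p q) N ≡ suc (ev p N + ev q N)
    mp-eval p q = trans (⊕-eval [ 1 ] (p ⊕ q) N) (cong₂ _+_ (const-eval 1 N) (⊕-eval p q N))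

    scale-const : ∀ c a → ev (scale c [ a ]) N ≡ c * a
    scale-const c a = trans (scale-eval c [ a ] N) (cong (c *_) (const-eval a N))

  ⋁-intro′ : ∀ {l} → A ∈ˡ l → Γ ⊢⟨ scale (length l) [ 210 ] ⟩ A `⇒ ⋁ l
  ⋁-intro′ {l = A ∷ l} (here refl) = relax
    (≤-trans (≤-reflexive (const-eval 1 N)) (≤-trans (s≤s z≤n) (≤-reflexive (sym (scale-const (suc (length l)) 210)))))
    (axiom (∨I₁ _ _))
  ⋁-intro′ {l = B ∷ l} (there i) = relax
    (≤-trans (≤-reflexive (trans (mp-eval (mpᶜ [ 200 ] (scale (length l) [ 210 ])) [ 1 ])
        (cong₂ (λ x y → suc (x + y)) (trans (mp-eval [ 200 ] (scale (length l) [ 210 ]))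
          (cong₂ (λ x y → suc (x + y)) (const-eval 200 N) (scale-const (length l) 210))) (const-eval 1 N))))
      (≤-trans (≤-trans (≤-reflexive (cong (202 +_) (+-comm (length l * 210) 1))) (+-monoˡ-≤ (length l * 210) (m≤m+n 203 7)))
        (≤-reflexive (sym (scale-const (suc (length l)) 210)))))
    (⋁-intro′ i ⟫ axiom (∨I₂ _ _))

  ⋁-intro : ∀ {l} → length l ≤ N → A ∈ˡ l → Γ ⊢⟨ 0 ∷ [ 210 ] ⟩ A `⇒ ⋁ l
  ⋁-intro {l = l} l≤N i = relax (scale≤shift [ 210 ] l≤N) (⋁-intro′ i)

  ⋁-elim′ : ∀ l → (∀ {A} → A ∈ˡ l → Γ ⊢⟨ p ⟩ A `⇒ C) → Γ ⊢⟨ [ 1 ] ⊕ scale (length l) ([ 3 ] ⊕ p) ⟩ ⋁ l `⇒ C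
  ⋁-elim′ {p = p} [] f = relax
    (≤-trans (m≤m+n (ev [ 1 ] N) _) (≤-reflexive (sym (⊕-eval [ 1 ] (scale 0 ([ 3 ] ⊕ p)) N)))) (axiom (⊥E _))
  ⋁-elim′ {p = p} (A ∷ l) f = relax (≤-reflexive eq) (∨-elim (f (here refl)) (⋁-elim′ l (f ∘ there)))
    where
    body : Polynomial
    body = [ 3 ] ⊕ p
    eq : ev (mpᶜ (mpᶜ [ 1 ] p) ([ 1 ] ⊕ scale (length l) body)) N ≡ ev ([ 1 ] ⊕ scale (suc (length l)) body) N
    eq = begin
      e (mpᶜ (mpᶜ [ 1 ] p) ([ 1 ] ⊕ scale n body))
        ≡⟨ mp-eval (mpᶜ [ 1 ] p) ([ 1 ] ⊕ scale n body) ⟩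
      suc (e (mpᶜ [ 1 ] p) + e ([ 1 ] ⊕ scale n body))
        ≡⟨ cong₂ (λ x y → suc (x + y)) (trans (mp-eval [ 1 ] p) (cong (λ x → suc (x + e p)) (const-eval 1 N)))
             (trans (⊕-eval [ 1 ] (scale n body) N) (cong₂ _+_ (const-eval 1 N) (scale-eval n body N))) ⟩
      3 + (e p + suc (n * e body))
        ≡⟨ cong (3 +_) (+-suc (e p) (n * e body)) ⟩
      suc ((3 + e p) + n * e body)
        ≡⟨ cong (λ x → suc (x + n * e body)) (trans (⊕-eval [ 3 ] p N) (cong (_+ e p) (const-eval 3 N))) ⟨
      suc (suc n * e body)
        ≡⟨ trans (⊕-eval [ 1 ] (scale (suc n) body) N) (cong₂ _+_ (const-eval 1 N) (scale-eval (suc n) body N)) ⟨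
      e ([ 1 ] ⊕ scale (suc n) body) ∎
      where
      open ≡-Reasoning
      e : Polynomial → ℕ
      e r = ev r N
      n : ℕ
      n = length l

  ⋁-elim : ∀ l → length l ≤ N → (∀ {A} → A ∈ˡ l → Γ ⊢⟨ p ⟩ A `⇒ C) → Γ ⊢⟨ [ 1 ] ⊕ shift ([ 3 ] ⊕ p) ⟩ ⋁ l `⇒ C
  ⋁-elim {p = p} l l≤N f = relax le (⋁-elim′ l f)
    where
    body : Polynomial
    body = [ 3 ] ⊕ p
    le : ev ([ 1 ] ⊕ scale (length l) body) N ≤ ev ([ 1 ] ⊕ shift body) N
    le = ≤-trans (≤-reflexive (⊕-eval [ 1 ] (scale (length l) body) N))
      (≤-trans (+-monoʳ-≤ (ev [ 1 ] N) (scale≤shift body l≤N))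
        (≤-reflexive (sym (⊕-eval [ 1 ] (shift body) N))))

length-product : ∀ {A B : Set} (xs : List A) (ys : List B) →
  length (cartesianProduct xs ys) ≡ length xs * length ys
length-product []       ys = refl
length-product (x ∷ xs) ys = trans (length-++ (map (x ,_) ys))
  (cong₂ _+_ (length-map (x ,_) ys) (length-product xs ys))

length-allFin : ∀ n → length (allFin n) ≡ n
length-allFin n = length-tabulate id

∈-distinctPairs⁺ : ∀ {n} {v w : Fin n} → v ≢ w → (v , w) ∈ˡ distinctPairs n
∈-distinctPairs⁺ v≢w = ∈-filter⁺ _ (∈-cartesianProduct⁺ (∈-allFin _) (∈-allFin _)) v≢w

∈-distinctPairs⁻ : ∀ {n} {v w : Fin n} → (v , w) ∈ˡ distinctPairs n → v ≢ w
∈-distinctPairs⁻ {n} i =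
  proj₂ (∈-filter⁻ (λ (v , w) → ¬? (v Fin.≟ w)) {xs = cartesianProduct (allFin n) (allFin n)} i)

length-distinctPairs : ∀ n → length (distinctPairs n) ≤ n * n
length-distinctPairs n = ≤-trans (length-filter _ (cartesianProduct (allFin n) (allFin n)))
  (≤-reflexive (trans (length-product (allFin n) (allFin n)) (cong₂ _*_ (length-allFin n) (length-allFin n))))

uniform : ℕ → ℕ → Polynomial
uniform d c = replicate d (10 ^ c)

module PHP {V : Set} (N : ℕ) where

  open Frege {V} N

  -- P a j says that pigeon a sits in hole j.
  pigeonAxioms : ∀ M → (Fin (suc M) → Fin M → Formula V) → List (Formula V)
  pigeonAxioms M P =
       map (λ a → ⋁ (tabulate (P a))) (allFin (suc M))
    ++ map (λ ((a , b) , j) → P a j `⇒ P b j `⇒ `⊥) (cartesianProduct (distinctPairs (suc M)) (allFin M))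

  module _ {M : ℕ} {P : Fin (suc M) → Fin M → Formula V} where

    ∈-total : ∀ a → ⋁ (tabulate (P a)) ∈ˡ pigeonAxioms M P
    ∈-total a = ∈-++⁺ˡ (∈-map⁺ _ (∈-allFin a))

    ∈-exclusive : ∀ {a b} → a ≢ b → ∀ j → (P a j `⇒ P b j `⇒ `⊥) ∈ˡ pigeonAxioms M P
    ∈-exclusive a≢b j = ∈-++⁺ʳ (map _ (allFin (suc M)))
      (∈-map⁺ _ (∈-cartesianProduct⁺ (∈-distinctPairs⁺ a≢b) (∈-allFin j)))

  derive-pigeonAxioms : ∀ {Γ p M} {P : Fin (suc M) → Fin M → Formula V} → suc M ≤ N →
    (∀ a → Γ ⊢⟨ p ⟩ ⋁ (tabulate (P a))) →
    (∀ a b j → a ≢ b → Γ ⊢⟨ p ⟩ P a j `⇒ P b j `⇒ `⊥) →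
    Γ ⊩⟨ shift p ⊕ shift (shift (shift p)) ⟩ pigeonAxioms M P
  derive-pigeonAxioms {Γ} {p} {M} {P} M<N total exclusive =
    join
      (relax (scale≤shift p (≤-trans (≤-reflexive (trans (length-map _ (allFin (suc M))) (length-allFin (suc M)))) M<N))
        (collect (map _ (allFin (suc M))) λ i → totalᵢ (∈-map⁻ _ i)))
      (relax (≤-trans (≤-reflexive (scale-eval (length (map excludes pairs)) p N))
          (≤-trans (*-monoˡ-≤ (ev p N) count) (≤-reflexive shifts)))
        (collect (map excludes pairs) λ i → exclusiveᵢ (∈-map⁻ _ i)))
    where
    pairs : List ((Fin (suc M) × Fin (suc M)) × Fin M)
    pairs = cartesianProduct (distinctPairs (suc M)) (allFin M)

    excludes : (Fin (suc M) × Fin (suc M)) × Fin M → Formula V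
    excludes ((a , b) , j) = P a j `⇒ P b j `⇒ `⊥

    count : length (map excludes pairs) ≤ N * N * N
    count = ≤-trans (≤-reflexive (trans (length-map excludes pairs) (length-product (distinctPairs (suc M)) (allFin M))))
      (*-mono-≤ (≤-trans (length-distinctPairs (suc M)) (*-mono-≤ M<N M<N))
        (≤-trans (≤-reflexive (length-allFin M)) (≤-trans (n≤1+n M) M<N)))

    shifts : N * N * N * ev p N ≡ ev (shift (shift (shift p))) N
    shifts = trans (trans (cong (_* ev p N) (*-assoc N N N))
        (trans (*-assoc N (N * N) (ev p N)) (cong (N *_) (*-assoc N N (ev p N)))))
      (sym (trans (shift-eval _ N) (cong (N *_) (trans (shift-eval _ N) (cong (N *_) (shift-eval p N))))))

    totalᵢ : ∀ {A} → ∃[ a ] a ∈ˡ allFin (suc M) × A ≡ ⋁ (tabulate (P a)) → Γ ⊢⟨ p ⟩ A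
    totalᵢ (a , _ , refl) = total a

    exclusiveᵢ : ∀ {A} → ∃[ x ] x ∈ˡ pairs × A ≡ excludes x →
      Γ ⊢⟨ p ⟩ A
    exclusiveᵢ (((a , b) , j) , i , refl) =
      exclusive a b j (∈-distinctPairs⁻ (proj₁ (∈-cartesianProduct⁻ (distinctPairs (suc M)) (allFin M) i)))

  module _ {M : ℕ} (P : Fin (suc (suc M)) → Fin (suc M) → Formula V) where

    -- Cook's substitution removing pigeon 0 and hole 0: the pigeon of hole 0
    -- moves to the hole of pigeon 0.
    evict : Fin (suc M) → Fin M → Formula V
    evict a j = P (suc a) (suc j) `∨ (P (suc a) zero `∧ P zero (suc j))

    module _ (M<N : suc M ≤ N) where
      private
        Γ : List (Formula V)
        Γ = pigeonAxioms (suc M) P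

        tab≤ : ∀ {K} (f : Fin K → Formula V) → K ≤ suc M → length (tabulate f) ≤ N
        tab≤ f K≤ = ≤-trans (≤-reflexive (length-tabulate f)) (≤-trans K≤ M<N)

        totalStep : ∀ {a A} → ∃[ j ] A ≡ P (suc a) j → Γ ⊢⟨ uniform 4 6 ⟩ A `⇒ ⋁ (tabulate (evict a))
        totalStep (suc j , refl) = weaken (axiom (∨I₁ _ _) ⟫ ⋁-intro (tab≤ (evict _) (n≤1+n M)) (∈-tabulate⁺ j))
        totalStep {a} (zero , refl) = weaken (ded (⋁-elim (tabulate (P zero)) (tab≤ (P zero) ≤-refl)
            (λ i → relocate (∈-tabulate⁻ i))
            $ᶠ assume (there (∈-total zero))))
          where
          relocate : ∀ {A} → ∃[ j ] A ≡ P zero j → P (suc a) zero ∷ Γ ⊢⟨ uniform 3 4 ⟩ A `⇒ ⋁ (tabulate (evict a))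
          relocate (zero , refl) = weaken ((assume (there (∈-exclusive (λ ()) zero)) $ᶠ assume (here refl)) ⟫ axiom (⊥E _))
          relocate (suc j , refl) = weaken (((axiom (∧I _ _) $ᶠ assume (here refl)) ⟫ axiom (∨I₂ _ _))
            ⟫ ⋁-intro (tab≤ (evict a) (n≤1+n M)) (∈-tabulate⁺ j))

        exclusiveStep : ∀ {a b} j → a ≢ b → Γ ⊢⟨ uniform 3 6 ⟩ evict a j `⇒ evict b j `⇒ `⊥
        exclusiveStep {a} {b} j a≢b = weaken (ded (ded (
          ∨-elim
            (ded (∨-elim
              (assume (there (there (there (∈-exclusive (a≢b ∘ Fin.suc-injective) (suc j))))) $ᶠ assume (here refl))
              (axiom (∧E₂ _ _) ⟫ (assume (there (there (there (∈-exclusive (λ ()) (suc j))))) $ᶠ assume (here refl)))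
              $ᶠ assume (there (here refl))))
            (ded (∨-elim
              (assume (there (there (there (∈-exclusive (λ ()) (suc j))))) $ᶠ (axiom (∧E₂ _ _) $ᶠ assume (here refl)))
              (axiom (∧E₁ _ _) ⟫ (assume (there (there (there (∈-exclusive (a≢b ∘ Fin.suc-injective) zero))))
                $ᶠ (axiom (∧E₁ _ _) $ᶠ assume (here refl))))
              $ᶠ assume (there (here refl))))
          $ᶠ assume (there (here refl)))))

      evict-axioms : Γ ⊩⟨ uniform 8 8 ⟩ pigeonAxioms M evict
      evict-axioms = weaken (derive-pigeonAxioms {p = uniform 5 7} M<N
        (λ a → weaken (⋁-elim (tabulate (P (suc a))) (tab≤ (P (suc a)) ≤-refl) (λ i → totalStep (∈-tabulate⁻ i)) $ᶠ
            assume (∈-total (suc a))))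
        (λ a b j a≢b → weaken (exclusiveStep j a≢b)))

  pigeonhole′ : ∀ M P → M ≤ N → pigeonAxioms M P ⊢⟨ [ 1 ] ⊕ scale M (uniform 8 8) ⟩ `⊥
  pigeonhole′ zero P _ = weaken (assume (∈-total {P = P} zero))
  pigeonhole′ (suc M) P M<N = relax (≤-reflexive eq) (cut (evict-axioms P M<N)
      (weakenʰ ∈-++⁺ˡ (pigeonhole′ M (evict P) (≤-trans (n≤1+n M) M<N))))
    where
    q : Polynomial
    q = uniform 8 8
    eq : ev (q ⊕ ([ 1 ] ⊕ scale M q)) N ≡ ev ([ 1 ] ⊕ scale (suc M) q) N
    eq = begin
      ev (q ⊕ ([ 1 ] ⊕ scale M q)) N      ≡⟨ ⊕-eval q ([ 1 ] ⊕ scale M q) N ⟩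
      ev q N + ev ([ 1 ] ⊕ scale M q) N   ≡⟨ cong (ev q N +_)
          (trans (⊕-eval [ 1 ] (scale M q) N) (cong₂ _+_ (const-eval 1 N) (scale-eval M q N))) ⟩
      ev q N + suc (M * ev q N)           ≡⟨ +-suc (ev q N) (M * ev q N) ⟩
      suc (suc M * ev q N)                ≡⟨ trans (⊕-eval [ 1 ] (scale (suc M) q) N)
          (cong₂ _+_ (const-eval 1 N) (scale-eval (suc M) q N)) ⟨
      ev ([ 1 ] ⊕ scale (suc M) q) N      ∎
      where open ≡-Reasoning

  pigeonhole : ∀ {M P} → M ≤ N → pigeonAxioms M P ⊢⟨ uniform 9 9 ⟩ `⊥
  pigeonhole {M} {P} M≤N = weaken (relax le (pigeonhole′ M P M≤N))
    where
    q : Polynomial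
    q = uniform 8 8
    le : ev ([ 1 ] ⊕ scale M q) N ≤ ev ([ 1 ] ⊕ shift q) N
    le = ≤-trans (≤-reflexive (⊕-eval [ 1 ] (scale M q) N))
      (≤-trans (+-monoʳ-≤ (ev [ 1 ] N) (scale≤shift q M≤N)) (≤-reflexive (sym (⊕-eval [ 1 ] (shift q) N))))

module _ where

  private variable
    n : ℕ
    A : Set

  On : Subset n → Fin n → Set
  On p v = T (lookup p v)

  embed : (p : Subset n) → Fin ∣ p ∣ → Fin n
  embed (true  ∷ p) zero    = zero
  embed (true  ∷ p) (suc i) = suc (embed p i)
  embed (false ∷ p) i       = suc (embed p i)

  embed-on : ∀ (p : Subset n) i → On p (embed p i)
  embed-on (true  ∷ p) zero    = tt
  embed-on (true  ∷ p) (suc i) = embed-on p i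
  embed-on (false ∷ p) i       = embed-on p i

  embed-injective : ∀ (p : Subset n) {i j} → embed p i ≡ embed p j → i ≡ j
  embed-injective (true  ∷ p) {zero}  {zero}  _  = refl
  embed-injective (true  ∷ p) {suc i} {suc j} eq = cong suc (embed-injective p (Fin.suc-injective eq))
  embed-injective (false ∷ p)                 eq = embed-injective p (Fin.suc-injective eq)

  embed-onto : ∀ (p : Subset n) {v} → On p v → ∃[ i ] embed p i ≡ v
  embed-onto (true  ∷ p) {zero}  _ = zero , refl
  embed-onto (true  ∷ p) {suc v} o with embed-onto p o
  ... | i , refl = suc i , refl
  embed-onto (false ∷ p) {suc v} o with embed-onto p o
  ... | i , refl = i , refl

  select : (p : Subset n) → Vec A n → Vec A ∣ p ∣
  select []          []       = []
  select (true  ∷ p) (x ∷ xs) = x ∷ select p xs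
  select (false ∷ p) (x ∷ xs) = select p xs

  lookup-select : ∀ (p : Subset n) (xs : Vec A n) i → lookup (select p xs) i ≡ lookup xs (embed p i)
  lookup-select (true  ∷ p) (x ∷ xs) zero    = refl
  lookup-select (true  ∷ p) (x ∷ xs) (suc i) = lookup-select p xs i
  lookup-select (false ∷ p) (x ∷ xs) i       = lookup-select p xs i

  padded : (p : Subset n) (d : Fin n) {m : ℕ} → Fin m → Fin n
  padded p d j with toℕ j <? ∣ p ∣
  ... | yes j<p = embed p (fromℕ< j<p)
  ... | no  _   = d

  padded-onto : ∀ (p : Subset n) {m v} → ∣ p ∣ ≤ m → On p v → ∃[ j ] ∀ d → padded p d {m} j ≡ v
  padded-onto p {m} p≤m o with embed-onto p o
  ... | i , refl = j , eq
    where
    i<m : toℕ i < m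
    i<m = <-≤-trans (Fin.toℕ<n i) p≤m
    j : Fin m
    j = fromℕ< i<m
    eq : ∀ d → padded p d j ≡ embed p i
    eq d with toℕ j <? ∣ p ∣
    ... | yes j<p = cong (embed p) (trans (Fin.fromℕ<-cong _ _ (Fin.toℕ-fromℕ< i<m) j<p (Fin.toℕ<n i)) (Fin.fromℕ<-toℕ i _))
    ... | no  j≮p = contradiction (subst (_< ∣ p ∣) (sym (Fin.toℕ-fromℕ< i<m)) (Fin.toℕ<n i)) j≮p

  ∣insert∣ : ∀ (p : Subset n) {v} → ¬ On p v → ∣ p [ v ]≔ true ∣ ≡ suc ∣ p ∣
  ∣insert∣ (true  ∷ p) {zero}  ¬o = contradiction tt ¬o
  ∣insert∣ (false ∷ p) {zero}  ¬o = refl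
  ∣insert∣ (true  ∷ p) {suc v} ¬o = cong suc (∣insert∣ p ¬o)
  ∣insert∣ (false ∷ p) {suc v} ¬o = ∣insert∣ p ¬o

  insert⁻ : ∀ (p : Subset n) {v w} → On (p [ v ]≔ true) w → w ≡ v ⊎ On p w
  insert⁻ p {v} {w} o with w Fin.≟ v
  ... | yes eq = inj₁ eq
  ... | no w≢v = inj₂ (subst T (lookup∘update′ w≢v p true) o)

  insert⁺ : ∀ (p : Subset n) {v w} → On p w → On (p [ v ]≔ true) w
  insert⁺ p {v} {w} o with w Fin.≟ v
  ... | yes refl = subst T (sym (lookup∘update v p true)) tt
  ... | no w≢v   = subst T (sym (lookup∘update′ w≢v p true)) o

  first : ℕ → Subset n → Subset n
  first m       []          = []
  first m       (false ∷ p) = false ∷ first m p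
  first zero    (true  ∷ p) = false ∷ first zero p
  first (suc m) (true  ∷ p) = true ∷ first m p

  first-on : ∀ m (p : Subset n) {v} → On (first m p) v → On p v
  first-on m       (false ∷ p) {suc v} o = first-on m p o
  first-on zero    (true  ∷ p) {zero}  o = tt
  first-on zero    (true  ∷ p) {suc v} o = first-on zero p o
  first-on (suc m) (true  ∷ p) {zero}  o = tt
  first-on (suc m) (true  ∷ p) {suc v} o = first-on m p o

  ∣first∣≤ : ∀ m (p : Subset n) → ∣ first m p ∣ ≤ m
  ∣first∣≤ m       []          = z≤n
  ∣first∣≤ m       (false ∷ p) = ∣first∣≤ m p
  ∣first∣≤ zero    (true  ∷ p) = ∣first∣≤ zero p
  ∣first∣≤ (suc m) (true  ∷ p) = s≤s (∣first∣≤ m p)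

  first-full : ∀ m (p : Subset n) → ∣ first m p ∣ ≡ m ⊎ first m p ≡ p
  first-full m       []          = inj₂ refl
  first-full m       (false ∷ p) with first-full m p
  ... | inj₁ eq = inj₁ eq
  ... | inj₂ eq = inj₂ (cong (false ∷_) eq)
  first-full zero    (true  ∷ p) = inj₁ (n≤0⇒n≡0 (∣first∣≤ zero p))
  first-full (suc m) (true  ∷ p) with first-full m p
  ... | inj₁ eq = inj₁ (cong suc eq)
  ... | inj₂ eq = inj₂ (cong (true ∷_) eq)

  all-on : ∀ (p : Subset n) → (∀ v → On p v) → ∣ p ∣ ≡ n
  all-on []          o = refl
  all-on (true  ∷ p) o = cong suc (all-on p (o ∘ suc))
  all-on (false ∷ p) o = ⊥-elim (o zero)

  nonempty : ∀ (p : Subset n) {v} → On p v → ∣ p ∣ ≢ 0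
  nonempty p o eq with embed-onto p o
  ... | i , _ with subst Fin eq i
  ... | ()

  every : Vec Bool n → Bool
  every []       = true
  every (b ∷ bs) = b ∧ every bs

  every⁻ : ∀ (bs : Vec Bool n) → T (every bs) → ∀ i → T (lookup bs i)
  every⁻ (true ∷ bs) t zero    = tt
  every⁻ (true ∷ bs) t (suc i) = every⁻ bs t i

  ¬every⁻ : ∀ (bs : Vec Bool n) → ¬ T (every bs) → ∃[ i ] ¬ T (lookup bs i)
  ¬every⁻ []           ¬t = contradiction tt ¬t
  ¬every⁻ (false ∷ bs) ¬t = zero , id
  ¬every⁻ (true  ∷ bs) ¬t with ¬every⁻ bs ¬t
  ... | i , ¬o = suc i , ¬o

  _⊆ᵇ_ : Subset n → Subset n → Bool
  p ⊆ᵇ q = every (zipWith (λ a b → not a ∨ b) p q)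

  ⊆ᵇ⁻ : ∀ (p q : Subset n) → T (p ⊆ᵇ q) → ∀ {v} → On p v → On q v
  ⊆ᵇ⁻ p q t {v} o with every⁻ (zipWith (λ a b → not a ∨ b) p q) t v
  ... | i rewrite lookup-zipWith (λ a b → not a ∨ b) v p q with lookup p v
  ... | true = i

  ¬⊆ᵇ⁻ : ∀ (p q : Subset n) → ¬ T (p ⊆ᵇ q) → ∃[ v ] On p v × ¬ On q v
  ¬⊆ᵇ⁻ p q ¬t with ¬every⁻ (zipWith (λ a b → not a ∨ b) p q) ¬t
  ... | v , ¬o rewrite lookup-zipWith (λ a b → not a ∨ b) v p q with lookup p v in eq
  ... | true  = v , subst T (sym eq) tt , ¬o
  ... | false = contradiction tt ¬o

  covers : Vec (Subset n) n → Subset n → Bool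
  covers M C = every (zipWith (λ c r → c ∨ (r ⊆ᵇ C)) C M)

  covers⁻ : ∀ (M : Vec (Subset n) n) C → T (covers M C) → ∀ v w → On (lookup M v) w → On C v ⊎ On C w
  covers⁻ M C t v w a with every⁻ (zipWith (λ c r → c ∨ (r ⊆ᵇ C)) C M) t v
  ... | i rewrite lookup-zipWith (λ c r → c ∨ (r ⊆ᵇ C)) v C M with lookup C v
  ... | true  = inj₁ tt
  ... | false = inj₂ (⊆ᵇ⁻ (lookup M v) C i a)

  ¬covers⁻ : ∀ (M : Vec (Subset n) n) C → ¬ T (covers M C) →
    ∃[ v ] ∃[ w ] On (lookup M v) w × ¬ On C v × ¬ On C w
  ¬covers⁻ M C ¬t with ¬every⁻ (zipWith (λ c r → c ∨ (r ⊆ᵇ C)) C M) ¬t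
  ... | v , ¬o rewrite lookup-zipWith (λ c r → c ∨ (r ⊆ᵇ C)) v C M with lookup C v in eq
  ... | true  = contradiction tt ¬o
  ... | false with ¬⊆ᵇ⁻ (lookup M v) C ¬o
  ... | w , a , ¬c = v , w , a , (λ o → subst T eq o) , ¬c

adj-sym : ∀ G v w → adj G v w ≡ adj G w v
adj-sym G@(record { symmetric = s }) v w = recompute (adj G v w ≟ᵇ adj G w v) (s v w)

adj-irrefl : ∀ G v → adj G v v ≡ false
adj-irrefl G@(record { irreflexive = i }) v = recompute (adj G v v ≟ᵇ false) (i v)

quota : ℕ → ℕ → ℕ
quota zero    k = 0
quota (suc h) k = pred k

quota≤pred : ∀ h k → quota h k ≤ pred k
quota≤pred zero    k = z≤n
quota≤pred (suc h) k = ≤-refl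

module Reduction (G : Graph) (k : ℕ) where

  nbrs : Fin (order G) → Subset (order G)
  nbrs = lookup (matrix G)

  high : Subset (order G)
  high = Vec.map (λ r → k ≤ᵇ ∣ r ∣) (matrix G)

  low : Subset (order G)
  low = zipWith (λ h r → not h ∧ (r ⊆ᵇ high)) high (matrix G)

  -- The low vertices that remain, joined to all high vertices.
  fillers : Subset (order G)
  fillers = first (quota ∣ high ∣ k) low

  kept : Subset (order G)
  kept = zipWith (λ l f → not l ∨ f) low fillers

  newRow : Bool × Bool → Subset (order G) → Subset (order G)
  newRow (h , f) r = if f then high else (if h then zipWith _∨_ r fillers else r)

  newMatrix : Vec (Subset (order G)) (order G)
  newMatrix = zipWith newRow (Vec.zip high fillers) (matrix G)

  newAdj : Fin (order G) → Fin (order G) → Bool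
  newAdj v w = lookup (lookup newMatrix v) w

  lookup-high : ∀ v → lookup high v ≡ (k ≤ᵇ ∣ nbrs v ∣)
  lookup-high v = lookup-map v _ (matrix G)

  lookup-low : ∀ v → lookup low v ≡ not (lookup high v) ∧ (nbrs v ⊆ᵇ high)
  lookup-low v = lookup-zipWith _ v high (matrix G)

  lookup-kept : ∀ v → lookup kept v ≡ not (lookup low v) ∨ lookup fillers v
  lookup-kept v = lookup-zipWith _ v low fillers

  newAdj-eq : ∀ v w → newAdj v w ≡
    (if lookup fillers v then lookup high w else (if lookup high v then adj G v w ∨ lookup fillers w else adj G v w))
  newAdj-eq v w rewrite lookup-zipWith newRow v (Vec.zip high fillers) (matrix G) | lookup-zip v high fillers
    with lookup fillers v
  ... | true = refl
  ... | false with lookup high v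
  ...   | true  = lookup-zipWith _∨_ w (nbrs v) fillers
  ...   | false = refl

  high-degree : ∀ {v} → On high v → k ≤ ∣ nbrs v ∣
  high-degree {v} h = ≤ᵇ⇒≤ k _ (subst T (lookup-high v) h)

  ¬high-degree : ∀ {v} → ¬ On high v → ∣ nbrs v ∣ < k
  ¬high-degree {v} ¬h = ≰⇒> (λ k≤ → ¬h (subst T (sym (lookup-high v)) (≤⇒≤ᵇ k≤)))

  low-¬high : ∀ {v} → On low v → ¬ On high v
  low-¬high {v} l h with subst T (lookup-low v) l
  ... | l′ with lookup high v
  ... | false = h

  low-nbrs : ∀ {v w} → On low v → T (adj G v w) → On high w
  low-nbrs {v} l a with subst T (lookup-low v) l
  ... | l′ with lookup high v
  ... | false = ⊆ᵇ⁻ (nbrs v) high l′ a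

  low-nbrs′ : ∀ {v w} → On low v → T (adj G w v) → On high w
  low-nbrs′ {v} {w} l a = low-nbrs l (subst T (adj-sym G w v) a)

  middle : ∀ {v} → ¬ On high v → ¬ On low v → ∃[ w ] T (adj G v w) × ¬ On high w × ¬ On low w
  middle {v} ¬h ¬l with ¬⊆ᵇ⁻ (nbrs v) high (¬l′ ∘ λ s → s)
    where
    ¬l′ : ¬ T (nbrs v ⊆ᵇ high)
    ¬l′ s with lookup high v in eq
    ... | true  = ¬h tt
    ... | false = ¬l (subst T (sym (trans (lookup-low v) (cong (λ b → not b ∧ (nbrs v ⊆ᵇ high)) eq))) s)
  ... | w , a , ¬hw = w , a , ¬hw , λ lw → ¬h (low-nbrs′ lw a)

  filler-low : ∀ {v} → On fillers v → On low v
  filler-low = first-on _ low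

  filler-high : ∀ {v} → On fillers v → ∃[ w ] On high w
  filler-high {v} f with ∣ high ∣ in eq
  ... | zero  = contradiction (n≤0⇒n≡0 (∣first∣≤ 0 low)) (nonempty (first 0 low) f)
  ... | suc h = embed high i , embed-on high i
    where
    i : Fin ∣ high ∣
    i = subst Fin (sym eq) zero

  kept⁻ : ∀ {v} → On kept v → On fillers v ⊎ ¬ On low v
  kept⁻ {v} o with subst T (lookup-kept v) o
  ... | o′ with lookup low v
  ... | true  = inj₁ o′
  ... | false = inj₂ id

  ¬low-kept : ∀ {v} → ¬ On low v → On kept v
  ¬low-kept {v} ¬l with lookup low v in eq
  ... | true  = contradiction tt ¬l
  ... | false = subst T (sym (trans (lookup-kept v) (cong (λ b → not b ∨ lookup fillers v) eq))) tt

  filler-kept : ∀ {v} → On fillers v → On kept v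
  filler-kept {v} f = subst T (sym (lookup-kept v)) (aux (lookup low v) f)
    where
    aux : ∀ l {f} → T f → T (not l ∨ f)
    aux true  t = t
    aux false _ = tt

  newAdj⁻ : ∀ {v w} → T (newAdj v w) → On high v ⊎ On high w ⊎ (T (adj G v w) × ¬ On fillers v)
  newAdj⁻ {v} {w} a with subst T (newAdj-eq v w) a
  ... | a′ with lookup fillers v
  ... | true  = inj₂ (inj₁ a′)
  ... | false with lookup high v
  ...   | true  = inj₁ tt
  ...   | false = inj₂ (inj₂ (a′ , id))

  newAdj-old : ∀ {v w} → ¬ On fillers v → T (adj G v w) → T (newAdj v w)
  newAdj-old {v} {w} ¬f a rewrite newAdj-eq v w with lookup fillers v
  ... | true  = contradiction tt ¬f
  ... | false with lookup high v
  ...   | false = a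
  ...   | true with adj G v w
  ...     | true = tt

  newAdj-filler : ∀ {v w} → On fillers v → On high w → T (newAdj v w)
  newAdj-filler {v} {w} f h rewrite newAdj-eq v w with lookup fillers v
  ... | true = h

  newAdj-filler′ : ∀ {v w} → On fillers v → On high w → T (newAdj w v)
  newAdj-filler′ {v} {w} f h rewrite newAdj-eq w v with lookup fillers w in eq
  ... | true  = contradiction h (low-¬high (filler-low (subst T (sym eq) tt)))
  ... | false with lookup high w
  ...   | true with adj G w v
  ...     | true  = tt
  ...     | false = f

  newAdj-sym′ : ∀ {v w} → On kept v → On kept w → T (newAdj v w) → T (newAdj w v)
  newAdj-sym′ {v} {w} kv kw a with T? (lookup fillers v) | T? (lookup fillers w)
  ... | yes fv | yes fw = contradiction (subst T eq a) (low-¬high (filler-low fw))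
    where
    eq : newAdj v w ≡ lookup high w
    eq rewrite newAdj-eq v w with lookup fillers v
    ... | true = refl
  ... | yes fv | no ¬fw = newAdj-filler′ fv (hw (newAdj⁻ a))
    where
    hw : On high v ⊎ On high w ⊎ (T (adj G v w) × ¬ On fillers v) → On high w
    hw (inj₁ h) = contradiction h (low-¬high (filler-low fv))
    hw (inj₂ (inj₁ h)) = h
    hw (inj₂ (inj₂ (_ , ¬f))) = contradiction fv ¬f
  ... | no ¬fv | yes fw = newAdj-filler fw (hv (newAdj⁻ a))
    where
    hv : On high v ⊎ On high w ⊎ (T (adj G v w) × ¬ On fillers v) → On high v
    hv (inj₁ h) = h
    hv (inj₂ (inj₁ h)) = contradiction h (low-¬high (filler-low fw))
    hv (inj₂ (inj₂ (e , _))) = low-nbrs′ (filler-low fw) e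
  ... | no ¬fv | no ¬fw = newAdj-old ¬fw (subst T (trans eq (adj-sym G v w)) a)
    where
    eq : newAdj v w ≡ adj G v w
    eq rewrite newAdj-eq v w with lookup fillers v | lookup fillers w
    ... | true  | _     = contradiction tt ¬fv
    ... | false | true  = contradiction tt ¬fw
    ... | false | false with lookup high v | adj G v w
    ...   | false | _     = refl
    ...   | true  | true  = refl
    ...   | true  | false = refl

  newAdj-sym : ∀ {v w} → On kept v → On kept w → newAdj v w ≡ newAdj w v
  newAdj-sym {v} {w} kv kw with newAdj v w in eq | newAdj w v in eq′
  ... | true  | true  = refl
  ... | false | false = refl
  ... | true  | false = ⊥-elim (subst T eq′ (newAdj-sym′ kv kw (subst T (sym eq) tt)))
  ... | false | true  = ⊥-elim (subst T eq (newAdj-sym′ kw kv (subst T (sym eq′) tt)))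

  newAdj-irrefl : ∀ v → newAdj v v ≡ false
  newAdj-irrefl v rewrite newAdj-eq v v | adj-irrefl G v with lookup fillers v in fv | lookup high v in hv
  ... | true  | true  = ⊥-elim (low-¬high (filler-low (subst T (sym fv) tt)) (subst T (sym hv) tt))
  ... | true  | false = refl
  ... | false | true  = refl
  ... | false | false = refl

  reducedMatrix : Vec (Vec Bool ∣ kept ∣) ∣ kept ∣
  reducedMatrix = Vec.map (select kept) (select kept newMatrix)

  reducedAdj : ∀ i j → lookup (lookup reducedMatrix i) j ≡ newAdj (embed kept i) (embed kept j)
  reducedAdj i j
    rewrite lookup-map i (select kept) (select kept newMatrix)
          | lookup-select kept (lookup (select kept newMatrix) i) j
          | lookup-select kept newMatrix i = refl

  reduced : Graph
  reduced = record
    { order       = ∣ kept ∣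
    ; matrix      = reducedMatrix
    ; symmetric   = λ i j → trans (reducedAdj i j)
        (trans (newAdj-sym (embed-on kept i) (embed-on kept j)) (sym (reducedAdj j i)))
    ; irreflexive = λ i → trans (reducedAdj i i) (newAdj-irrefl (embed kept i))
    }

  small : Subset (order G) → Bool
  small C = (∣ C ∣ ≤ᵇ k) ∧ covers (matrix G) C

  someNbrs : Bool
  someNbrs = not (every (Vec.map (λ r → not (small r)) (matrix G)))

  NoSmall : Set
  NoSmall = ¬ T (small high) × (∀ v → ¬ T (small (nbrs v)))

K₀ K₂ : Graph
K₀ = record { order = 0 ; matrix = [] ; symmetric = λ () ; irreflexive = λ () }
K₂ = record { order = 2 ; matrix = (false ∷ true ∷ []) ∷ (true ∷ false ∷ []) ∷ []
  ; symmetric = λ { zero zero → refl ; zero (suc zero) → refl ; (suc zero) zero → refl ; (suc zero) (suc zero) → refl }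
  ; irreflexive = λ { zero → refl ; (suc zero) → refl } }

reduce : Instance → Instance
reduce (G , k) =
  if order G ≤ᵇ k * k then (G , k) else
  if small high ∨ someNbrs then (K₀ , 0) else
  if (k ≤ᵇ ∣ high ∣) ∨ not (∣ kept ∣ ≤ᵇ k * k) then (K₂ , 0) else
  (reduced , k)
  where open Reduction G k

data Outcome (G : Graph) (k : ℕ) : Instance → Set where
  unchanged : order G ≤ k * k → Outcome G k (G , k)
  accepted  : ∀ C → k * k < order G → ∣ C ∣ ≤ k → T (covers (matrix G) C) → Outcome G k (K₀ , 0)
  rejected  : k * k < order G → Reduction.NoSmall G k →
    k ≤ ∣ Reduction.high G k ∣ ⊎ (∣ Reduction.high G k ∣ < k × k * k < ∣ Reduction.kept G k ∣) → Outcome G k (K₂ , 0)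
  shrunk    : k * k < order G → Reduction.NoSmall G k → ∣ Reduction.high G k ∣ < k →
    ∣ Reduction.kept G k ∣ ≤ k * k → Outcome G k (Reduction.reduced G k , k)

≰ᵇ⇒> : ∀ {m n} → ¬ T (m ≤ᵇ n) → n < m
≰ᵇ⇒> ¬t = ≰⇒> (¬t ∘ ≤⇒≤ᵇ)

T-≡true : ∀ {b} → b ≡ true → T b
T-≡true refl = tt

¬T-≡false : ∀ {b} → b ≡ false → ¬ T b
¬T-≡false refl ()

outcome : ∀ G k → Outcome G k (reduce (G , k))
outcome G k with order G ≤ᵇ k * k in small?
... | true  = unchanged (≤ᵇ⇒≤ _ _ (T-≡true small?))
... | false with Reduction.small G k (Reduction.high G k) in high?
...   | true = accepted (Reduction.high G k) (≰ᵇ⇒> (¬T-≡false small?))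
          (≤ᵇ⇒≤ _ _ (proj₁ (T∧⁻ (T-≡true high?)))) (proj₂ (T∧⁻ (T-≡true high?)))
...   | false with every (Vec.map (λ r → not (Reduction.small G k r)) (matrix G)) in nbrs?
...     | false = accept (¬every⁻ (Vec.map (λ r → not (Reduction.small G k r)) (matrix G)) (¬T-≡false nbrs?))
  where
  accept : ∃[ v ] ¬ On (Vec.map (λ r → not (Reduction.small G k r)) (matrix G)) v → Outcome G k (K₀ , 0)
  accept (v , ¬o) rewrite lookup-map v (λ r → not (Reduction.small G k r)) (matrix G)
    with Reduction.small G k (lookup (matrix G) v) in eq
  ... | true  = accepted (lookup (matrix G) v) (≰ᵇ⇒> (¬T-≡false small?))
          (≤ᵇ⇒≤ _ _ (proj₁ (T∧⁻ (T-≡true eq)))) (proj₂ (T∧⁻ (T-≡true eq)))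
  ... | false = contradiction tt ¬o
...     | true = decide
  where
  open Reduction G k
  noSmall : NoSmall
  noSmall = ¬T-≡false high? , λ v s → aux v s
    where
    aux : ∀ v → ¬ T (small (nbrs v))
    aux v s with subst T (lookup-map v (λ r → not (small r)) (matrix G))
        (every⁻ (Vec.map (λ r → not (small r)) (matrix G)) (T-≡true nbrs?) v)
    ... | t with small (nbrs v)
    ... | true = t
  decide : Outcome G k (if (k ≤ᵇ ∣ high ∣) ∨ not (∣ kept ∣ ≤ᵇ k * k) then (K₂ , 0) else (reduced , k))
  decide with k ≤ᵇ ∣ high ∣ in many?
  ... | true  = rejected (≰ᵇ⇒> (¬T-≡false small?)) noSmall (inj₁ (≤ᵇ⇒≤ _ _ (T-≡true many?)))
  ... | false with ∣ kept ∣ ≤ᵇ k * k in fits?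
  ...   | true  = shrunk (≰ᵇ⇒> (¬T-≡false small?)) noSmall (≰ᵇ⇒> (¬T-≡false many?)) (≤ᵇ⇒≤ _ _ (T-≡true fits?))
  ...   | false = rejected (≰ᵇ⇒> (¬T-≡false small?)) noSmall (inj₂ (≰ᵇ⇒> (¬T-≡false many?) , ≰ᵇ⇒> (¬T-≡false fits?)))

Covering : (G : Graph) → List (Fin (order G)) → Set
Covering G l = ∀ v w → T (adj G v w) → v ∈ˡ l ⊎ w ∈ˡ l

ListCover : Graph → ℕ → Set
ListCover G k = ∃[ l ] length l ≤ k × Covering G l

∣mask∣≤length : ∀ {n} (p : Subset n) (l : List (Fin n)) → (∀ {v} → On p v → v ∈ˡ l) → ∣ p ∣ ≤ length l
∣mask∣≤length p l p⊆l = Fin.injective⇒≤ {f = λ i → index (p⊆l (embed-on p i))}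
  (λ {i} {j} eq → embed-injective p (trans (lookup-index (p⊆l (embed-on p i)))
    (trans (cong (List.lookup l) eq) (sym (lookup-index (p⊆l (embed-on p j)))))))

∈⇒On : ∀ {n} (p : Subset n) {v} → v ∈ p → On p v
∈⇒On p v∈p = subst T (sym ([]=⇒lookup v∈p)) tt

On⇒∈ : ∀ {n} (p : Subset n) {v} → On p v → v ∈ p
On⇒∈ p {v} o with lookup p v in eq
... | true = lookup⇒[]= v p eq

elements : ∀ {n} → Subset n → List (Fin n)
elements p = tabulate (embed p)

∈-elements : ∀ {n} (p : Subset n) {v} → On p v → v ∈ˡ elements p
∈-elements p o with embed-onto p o
... | i , refl = ∈-tabulate⁺ i

mask : ∀ {n} → List (Fin n) → Subset n
mask l = Vec.tabulate (λ v → does (v ∈? l))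
  where open DecMembership Fin._≟_ using (_∈?_)

module _ {n : ℕ} (l : List (Fin n)) {v : Fin n} where
  open DecMembership (Fin._≟_ {n}) using (_∈?_)

  mask⁺ : v ∈ˡ l → On (mask l) v
  mask⁺ v∈l rewrite lookup∘tabulate (λ v → does (v ∈? l)) v with v ∈? l
  ... | yes _   = tt
  ... | no  v∉l = v∉l v∈l

  mask⁻ : On (mask l) v → v ∈ˡ l
  mask⁻ o rewrite lookup∘tabulate (λ v → does (v ∈? l)) v with v ∈? l
  ... | yes v∈l = v∈l

isCover? : ∀ G S → Dec (IsCover G S)
isCover? G S with T? (covers (matrix G) S)
... | yes t = yes λ v w a → Sum.map (On⇒∈ S) (On⇒∈ S) (covers⁻ (matrix G) S t v w a)
... | no ¬t with ¬covers⁻ (matrix G) S ¬t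
...   | v , w , a , ¬v , ¬w = no λ c → [ ¬v ∘ ∈⇒On S , ¬w ∘ ∈⇒On S ]′ (c v w a)

minimum-cover : ∀ G S b → IsCover G S → ∣ S ∣ ≤ b → ∃[ c ] IsVC G c × c ≤ ∣ S ∣
minimum-cover G S b cov S≤b with anySubset? (λ S′ → isCover? G S′ ×-dec (∣ S′ ∣ <? ∣ S ∣))
... | no ¬smaller = ∣ S ∣ , ((S , cov , refl) , λ S′ cov′ → ≮⇒≥ λ lt → ¬smaller (S′ , cov′ , lt)) , ≤-refl
minimum-cover G S zero    cov S≤b | yes (S′ , cov′ , lt) = contradiction (<-≤-trans lt S≤b) λ ()
minimum-cover G S (suc b) cov S≤b | yes (S′ , cov′ , lt)
  with minimum-cover G S′ b cov′ (≤-pred (≤-trans lt S≤b))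
... | c , vc , c≤ = c , vc , ≤-trans c≤ (<⇒≤ lt)

positive⇒list : ∀ G {k} → Positive (G , k) → ListCover G k
positive⇒list G (c , ((S , cov , refl) , _) , c≤k) =
  elements S , ≤-trans (≤-reflexive (length-tabulate (embed S))) c≤k ,
  λ v w a → Sum.map (∈-elements S ∘ ∈⇒On S) (∈-elements S ∘ ∈⇒On S) (cov v w a)

list⇒positive : ∀ G {k} → ListCover G k → Positive (G , k)
list⇒positive G (l , l≤k , cov)
  with minimum-cover G (mask l) _ (λ v w a → Sum.map (On⇒∈ (mask l) ∘ mask⁺ l) (On⇒∈ (mask l) ∘ mask⁺ l) (cov v w a)) ≤-refl
... | c , vc , c≤ = c , vc , ≤-trans c≤ (≤-trans (∣mask∣≤length (mask l) l (mask⁻ l)) l≤k)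

negative⇒¬positive : ∀ {x} → Negative x → ¬ Positive x
negative⇒¬positive (c , (_ , c-min) , k<c) (_ , ((S , cov , refl) , _) , S≤k) =
  <⇒≱ k<c (≤-trans (c-min S cov) S≤k)

-- A certificate that no cover of size k contains all forced vertices: each
-- vertex u of a cover pays for the pigeons slot u 0, slot u 1, …, and every
-- pigeon is paid for.
record Overload (G : Graph) (k : ℕ) (Forced : Fin (order G) → Set) : Set where
  field
    slots   : ℕ
    slots≤  : slots ≤ suc k
    slot    : Fin (order G) → Fin slots → Fin (order G)
    pigeons : Subset (order G)
    crowded : k * slots < ∣ pigeons ∣
    served  : ∀ p → On pigeons p →
      (∃[ u ] Forced u × ∃[ s ] slot u s ≡ p) ⊎
      (∃[ a ] ∃[ b ] T (adj G a b) × (∃[ s ] slot a s ≡ p) × (∃[ s ] slot b s ≡ p))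

overload-sound : ∀ {G k Forced} → Overload G k Forced → ∀ l → length l ≤ k → Covering G l →
  (∀ u → Forced u → u ∈ˡ l) → ⊥
overload-sound {G} {k} O l l≤k cov forced = <⇒≱ crowded
  (≤-trans (∣mask∣≤length pigeons paid (λ {p} o → pay p (served p o)))
    (≤-trans (≤-reflexive (length-paid l)) (*-monoˡ-≤ slots l≤k)))
  where
  open Overload O
  payments : List (Fin (order G)) → List (Fin (order G))
  payments = concatMap (λ u → tabulate (slot u))

  paid : List (Fin (order G))
  paid = payments l

  length-paid : ∀ l → length (payments l) ≡ length l * slots
  length-paid []      = refl
  length-paid (u ∷ l) = trans (length-++ (tabulate (slot u))) (cong₂ _+_ (length-tabulate (slot u)) (length-paid l))

  pays : ∀ {u p} l → u ∈ˡ l → ∃[ s ] slot u s ≡ p → p ∈ˡ payments l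
  pays (u ∷ l) (here refl) (s , refl) = ∈-++⁺ˡ (∈-tabulate⁺ s)
  pays (u ∷ l) (there i)   s          = ∈-++⁺ʳ (tabulate (slot u)) (pays l i s)

  pay : ∀ p → _ → p ∈ˡ paid
  pay p (inj₁ (u , f , s)) = pays l (forced u f) s
  pay p (inj₂ (a , b , e , sa , sb)) = [ (λ i → pays l i sa) , (λ i → pays l i sb) ]′ (cov a b e)

module _ (G : Graph) (k : ℕ) where
  open Reduction G k

  crowd : ∀ {Forced} C → k ≤ ∣ C ∣ → ¬ T (small C) → (∀ v → On C v → Forced v) → Overload G k Forced
  crowd {Forced} C k≤C ¬small forced with k <? ∣ C ∣
  ... | yes k<C = record
    { slots = 1 ; slots≤ = s≤s z≤n ; slot = λ u _ → u ; pigeons = C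
    ; crowded = ≤-trans (≤-reflexive (cong suc (*-identityʳ k))) k<C
    ; served = λ p o → inj₁ (p , forced p o , zero , refl) }
  ... | no k≮C = extra (¬covers⁻ (matrix G) C ¬cov)
    where
    C≤k : ∣ C ∣ ≤ k
    C≤k = ≮⇒≥ k≮C
    ¬cov : ¬ T (covers (matrix G) C)
    ¬cov t = ¬small (aux (∣ C ∣ ≤ᵇ k) (≤⇒≤ᵇ C≤k))
      where
      aux : ∀ a → T a → T (a ∧ covers (matrix G) C)
      aux true _ = t
    extra : ∃[ v ] ∃[ w ] T (adj G v w) × ¬ On C v × ¬ On C w → Overload G k Forced
    extra (a , b , e , ¬a , ¬b) = record
      { slots = 1 ; slots≤ = s≤s z≤n ; slot = slot ; pigeons = C [ a ]≔ true
      ; crowded = ≤-reflexive (trans (cong suc (trans (*-identityʳ k) (≤-antisym k≤C C≤k))) (sym (∣insert∣ C ¬a)))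
      ; served = λ p o → serve p (insert⁻ C o) }
      where
      slot : Fin (order G) → Fin 1 → Fin (order G)
      slot u _ = if does (u Fin.≟ b) then a else u
      slot-b : slot b zero ≡ a
      slot-b with b Fin.≟ b
      ... | yes _  = refl
      ... | no b≢b = contradiction refl b≢b
      slot-≢ : ∀ {u} → u ≢ b → slot u zero ≡ u
      slot-≢ {u} u≢b with u Fin.≟ b
      ... | yes u≡b = contradiction u≡b u≢b
      ... | no _    = refl
      slot-a : slot a zero ≡ a
      slot-a with a Fin.≟ b
      ... | yes _ = refl
      ... | no _  = refl
      serve : ∀ p → p ≡ a ⊎ On C p → _
      serve p (inj₁ refl) = inj₂ (a , b , e , (zero , slot-a) , (zero , slot-b))
      serve p (inj₂ o)    = inj₁ (p , forced p o , zero , slot-≢ (λ { refl → ¬b o }))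

  high-overload : NoSmall → ∀ {v} → On high v → Overload G k (λ u → T (adj G v u))
  high-overload (_ , ¬nbrs) {v} h = crowd (nbrs v) (high-degree h) (¬nbrs v) (λ u a → a)

  module _ (h<k : ∣ high ∣ < k) (many : k * k < ∣ kept ∣) where
    private
      m : ℕ
      m = pred k

      k≡ : k ≡ suc m
      k≡ = sym (suc-pred k {{>-nonZero (≤-trans (s≤s z≤n) h<k)}})

      list : Fin (order G) → Subset (order G)
      list u = if lookup high u then fillers else nbrs u

      slot : Fin (order G) → Fin (suc m) → Fin (order G)
      slot u zero    = u
      slot u (suc j) = padded (list u) u j

      list≤ : ∀ u → ∣ list u ∣ ≤ m
      list≤ u with lookup high u in eq
      ... | true  = ≤-trans (∣first∣≤ _ low) (quota≤pred ∣ high ∣ k)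
      ... | false = ≤-pred (≤-trans (¬high-degree (¬T-≡false eq)) (≤-reflexive k≡))

      inList : ∀ u {p} → On (list u) p → ∃[ s ] slot u s ≡ p
      inList u o with padded-onto (list u) (list≤ u) o
      ... | j , eq = suc j , eq u

      inFillers : ∀ {u p} → On high u → On fillers p → ∃[ s ] slot u s ≡ p
      inFillers {u} {p} h f = inList u (subst (λ q → On q p) (sym eq) f)
        where
        eq : list u ≡ fillers
        eq with lookup high u
        ... | true = refl

      inNbrs : ∀ {u p} → ¬ On high u → T (adj G u p) → ∃[ s ] slot u s ≡ p
      inNbrs {u} {p} ¬h a = inList u (subst (λ q → On q p) (sym eq) a)
        where
        eq : list u ≡ nbrs u
        eq with lookup high u
        ... | true  = contradiction tt ¬h
        ... | false = refl

    kept-overload : Overload G k (On high)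
    kept-overload = record
      { slots = suc m ; slots≤ = ≤-trans (≤-reflexive (sym k≡)) (n≤1+n k) ; slot = slot ; pigeons = kept
      ; crowded = subst (λ x → k * x < ∣ kept ∣) k≡ many
      ; served = serve }
      where
      serve : ∀ p → On kept p → _
      serve p o with T? (lookup high p) | kept⁻ o
      ... | yes h | _ = inj₁ (p , h , zero , refl)
      ... | no ¬h | inj₁ f with filler-high f
      ...   | u , h = inj₁ (u , h , inFillers h f)
      serve p o | no ¬h | inj₂ ¬l with middle ¬h ¬l
      ...   | u , a , ¬hu , _ = inj₂ (p , u , a , (zero , refl) , inNbrs ¬hu (subst T (adj-sym G p u) a))

  rejection : NoSmall → k ≤ ∣ high ∣ ⊎ (∣ high ∣ < k × k * k < ∣ kept ∣) → Overload G k (On high)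
  rejection (¬high , _) (inj₁ k≤h) = crowd high k≤h ¬high (λ _ h → h)
  rejection _ (inj₂ (h<k , many)) = kept-overload h<k many

  high∈cover : NoSmall → ∀ l → length l ≤ k → Covering G l → ∀ v → On high v → v ∈ˡ l
  high∈cover noSmall l l≤k cov v h with v ∈? l
    where open DecMembership Fin._≟_ using (_∈?_)
  ... | yes v∈l = v∈l
  ... | no  v∉l = ⊥-elim (overload-sound (high-overload noSmall h) l l≤k cov
    λ u a → [ (λ v∈l → contradiction v∈l v∉l) , id ]′ (cov v u a))

  rejected⇒¬positive : NoSmall → k ≤ ∣ high ∣ ⊎ (∣ high ∣ < k × k * k < ∣ kept ∣) → ¬ Positive (G , k)
  rejected⇒¬positive noSmall r pos⁺ with positive⇒list G pos⁺
  ... | l , l≤k , cov = overload-sound (rejection noSmall r) l l≤k cov (high∈cover noSmall l l≤k cov)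

  fillers-full : k * k < order G → ∣ kept ∣ ≤ k * k → ∣ fillers ∣ ≡ quota ∣ high ∣ k
  fillers-full large fits with first-full (quota ∣ high ∣ k) low
  ... | inj₁ full = full
  ... | inj₂ all  = contradiction (≤-trans large (≤-trans (≤-reflexive (sym (all-on kept keep-all))) fits)) (<-irrefl refl)
    where
    keep-all : ∀ v → On kept v
    keep-all v with T? (lookup low v)
    ... | yes l = filler-kept (subst (λ p → On p v) (sym all) l)
    ... | no ¬l = ¬low-kept ¬l

  fillers-large : k * k < order G → ∣ kept ∣ ≤ k * k → ∀ {v} → On high v → ∣ fillers ∣ ≡ pred k
  fillers-large large fits h with ∣ high ∣ in eq | fillers-full large fits
  ... | zero  | _    = contradiction eq (nonempty high h)
  ... | suc _ | full = full

  module _ (large : k * k < order G) (noSmall : NoSmall) (h<k : ∣ high ∣ < k) (fits : ∣ kept ∣ ≤ k * k) where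

    reducedAdj⁻ : ∀ {i j} → T (adj reduced i j) → T (newAdj (embed kept i) (embed kept j))
    reducedAdj⁻ {i} {j} = subst T (reducedAdj i j)

    reducedAdj⁺ : ∀ {i j} → T (newAdj (embed kept i) (embed kept j)) → T (adj reduced i j)
    reducedAdj⁺ {i} {j} = subst T (sym (reducedAdj i j))

    cover⇒reduced : ListCover G k → ListCover reduced k
    cover⇒reduced (l , l≤k , cov) = l′ , ≤-trans (shorter l) l≤k , cov′
      where
      restrict : Fin (order G) → List (Fin ∣ kept ∣)
      restrict v with T? (lookup kept v)
      ... | yes o = proj₁ (embed-onto kept o) ∷ []
      ... | no _  = []

      l′ : List (Fin ∣ kept ∣)
      l′ = concatMap restrict l

      restrict≤ : ∀ v → length (restrict v) ≤ 1
      restrict≤ v with T? (lookup kept v)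
      ... | yes _ = ≤-refl
      ... | no _  = z≤n

      shorter : ∀ l → length (concatMap restrict l) ≤ length l
      shorter []      = z≤n
      shorter (v ∷ l) = ≤-trans (≤-reflexive (length-++ (restrict v))) (+-mono-≤ (restrict≤ v) (shorter l))

      restrict-embed : ∀ i → i ∈ˡ restrict (embed kept i)
      restrict-embed i with T? (lookup kept (embed kept i))
      ... | yes o = here (embed-injective kept (sym (proj₂ (embed-onto kept o))))
      ... | no ¬o = contradiction (embed-on kept i) ¬o

      back : ∀ {i} l → embed kept i ∈ˡ l → i ∈ˡ concatMap restrict l
      back (v ∷ l) (here refl) = ∈-++⁺ˡ (restrict-embed _)
      back (v ∷ l) (there e)   = ∈-++⁺ʳ (restrict v) (back l e)

      cov′ : Covering reduced l′
      cov′ i j a with newAdj⁻ {embed kept i} {embed kept j} (reducedAdj⁻ a)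
      ... | inj₁ h = inj₁ (back l (high∈cover noSmall l l≤k cov _ h))
      ... | inj₂ (inj₁ h) = inj₂ (back l (high∈cover noSmall l l≤k cov _ h))
      ... | inj₂ (inj₂ (e , _)) = Sum.map (back l) (back l) (cov _ _ e)

    -- If a cover misses a high vertex, then it contains all fillers, which
    -- may be exchanged for the high vertices since there are as many.
    reduced⇒cover : ListCover reduced k → ListCover G k
    reduced⇒cover (l , l≤k , cov) = map return l , ≤-trans (≤-reflexive (length-map return l)) l≤k , cov′
      where
      return : Fin ∣ kept ∣ → Fin (order G)
      return i with T? (lookup fillers (embed kept i))
      ... | yes f = padded high (embed kept i) {∣ fillers ∣} (proj₁ (embed-onto fillers f))
      ... | no _  = embed kept i

      return-core : ∀ {i} → ¬ On fillers (embed kept i) → return i ≡ embed kept i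
      return-core {i} ¬f with T? (lookup fillers (embed kept i))
      ... | yes f = contradiction f ¬f
      ... | no _  = refl

      return-filler : ∀ {v} → On high v → ∃[ i ] On fillers (embed kept i) × return i ≡ v
      return-filler {v} h with padded-onto high {∣ fillers ∣}
        (≤-trans (≤-pred (≤-trans h<k (≤-reflexive k≡))) (≤-reflexive (sym (fillers-large large fits h)))) h
        where
        k≡ : k ≡ suc (pred k)
        k≡ = sym (suc-pred k {{>-nonZero (≤-trans (s≤s z≤n) h<k)}})
      ... | j , eq with embed-onto kept (filler-kept (embed-on fillers j))
      ... | i , ei = i , subst (On fillers) (sym ei) (embed-on fillers j) , ret
        where
        ret : return i ≡ v
        ret with T? (lookup fillers (embed kept i))
        ... | no ¬f = contradiction (subst (On fillers) (sym ei) (embed-on fillers j)) ¬f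
        ... | yes f = trans (cong (padded high (embed kept i))
            (embed-injective fillers (trans (proj₂ (embed-onto fillers f)) ei))) (eq _)

      core : ∀ {v} → ¬ On low v → ∃[ i ] embed kept i ≡ v × return i ≡ v
      core ¬l with embed-onto kept (¬low-kept ¬l)
      ... | i , refl = i , refl , return-core (¬l ∘ filler-low)

      high∈ : ∀ v → On high v → v ∈ˡ map return l
      high∈ v h with core (λ lv → low-¬high lv h)
      ... | i , refl , ri with i ∈? l
        where open DecMembership Fin._≟_ using (_∈?_)
      ...   | yes i∈l = subst (_∈ˡ map return l) ri (∈-map⁺ return i∈l)
      ...   | no  i∉l with return-filler h
      ...     | j , f , rj with cov i j (reducedAdj⁺ (newAdj-filler′ f h))
      ...       | inj₁ i∈l = contradiction i∈l i∉l
      ...       | inj₂ j∈l = subst (_∈ˡ map return l) rj (∈-map⁺ return j∈l)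

      cov′ : Covering G (map return l)
      cov′ v w a with T? (lookup high v) | T? (lookup high w)
      ... | yes hv | _ = inj₁ (high∈ v hv)
      ... | _ | yes hw = inj₂ (high∈ w hw)
      ... | no ¬hv | no ¬hw with core (λ lv → ¬hw (low-nbrs lv a)) | core (λ lw → ¬hv (low-nbrs′ lw a))
      ...   | i , refl , ri | j , refl , rj
        with cov i j (reducedAdj⁺ (newAdj-old (λ f → ¬hw (low-nbrs (filler-low f) a)) a))
      ...     | inj₁ i∈l = inj₁ (subst (_∈ˡ map return l) ri (∈-map⁺ return i∈l))
      ...     | inj₂ j∈l = inj₂ (subst (_∈ˡ map return l) rj (∈-map⁺ return j∈l))

positive-K₀ : Positive (K₀ , 0)
positive-K₀ = list⇒positive K₀ ([] , z≤n , λ ())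

¬positive-K₂ : ¬ Positive (K₂ , 0)
¬positive-K₂ pos⁺ with positive⇒list K₂ pos⁺
... | [] , _ , cov = [ (λ ()) , (λ ()) ]′ (cov zero (suc zero) tt)

reduce-equivalent : ∀ x → Positive x ⇔ Positive (reduce x)
reduce-equivalent (G , k) = equiv (reduce (G , k)) (outcome G k)
  where
  equiv : ∀ y → Outcome G k y → Positive (G , k) ⇔ Positive y
  equiv _ (unchanged _) = mk⇔ id id
  equiv _ (accepted C _ C≤k t) = mk⇔ (λ _ → positive-K₀) λ _ → list⇒positive G
    (elements C , ≤-trans (≤-reflexive (length-tabulate (embed C))) C≤k ,
      λ v w a → Sum.map (∈-elements C) (∈-elements C) (covers⁻ (matrix G) C t v w a))
  equiv _ (rejected _ noSmall r) = mk⇔ (λ pos⁺ → contradiction pos⁺ (rejected⇒¬positive G k noSmall r))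
    (λ pos⁺ → contradiction pos⁺ ¬positive-K₂)
  equiv _ (shrunk large noSmall h<k fits) = mk⇔
    (list⇒positive (Reduction.reduced G k) ∘ cover⇒reduced G k large noSmall h<k fits ∘ positive⇒list G)
    (list⇒positive G ∘ reduced⇒cover G k large noSmall h<k fits ∘ positive⇒list (Reduction.reduced G k))

others : ∀ {n} → Fin n → List (Fin n)
others {n} v = filter (λ w → ¬? (w Fin.≟ v)) (allFin n)

module Translation (G : Graph) (k : ℕ) where

  private
    n : ℕ
    n = order G
    V : Set
    V = Var n k

  yClause : Fin n → Fin n → Clause V
  yClause v w = [ if adj G v w then pos (Y v w) else neg (Y v w) ]

  degreeClause : Fin n → Fin k → Clause V
  degreeClause v i = neg (X v i) ∷ map (λ w → pos (Y v w)) (others v)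

  filledClause : Fin k → Clause V
  filledClause i = map (λ v → pos (X v i)) (allFin n)

  exclusiveClause : Fin n → Fin n → Fin k → Clause V
  exclusiveClause v w i = neg (X v i) ∷ neg (X w i) ∷ []

  onceClause : Fin n → Fin k → Fin k → Clause V
  onceClause v i j = neg (X v i) ∷ neg (X v j) ∷ []

  coverClause : Fin n → Fin n → Clause V
  coverClause v w = neg (Y v w) ∷ map (λ i → pos (X v i)) (allFin k) ++ map (λ i → pos (X w i)) (allFin k)

  private
    Φ₁ Φ₂ Φ₃ Φ₄ Φ₅ Φ₆ : CNF V
    Φ₁ = map (λ (v , w) → yClause v w) (distinctPairs n)
    Φ₂ = map (λ (v , i) → degreeClause v i) (cartesianProduct (allFin n) (allFin k))
    Φ₃ = map filledClause (allFin k)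
    Φ₄ = map (λ ((v , w) , i) → exclusiveClause v w i) (cartesianProduct (distinctPairs n) (allFin k))
    Φ₅ = map (λ (v , i , j) → onceClause v i j) (cartesianProduct (allFin n) (increasingPairs k))
    Φ₆ = map (λ (v , w) → coverClause v w) (distinctPairs n)

  ∈-yClause : ∀ {v w} → v ≢ w → yClause v w ∈ˡ Φ (G , k)
  ∈-yClause v≢w = ∈-++⁺ˡ {ys = Φ₂ ++ Φ₃ ++ Φ₄ ++ Φ₅ ++ Φ₆} (∈-map⁺ _ (∈-distinctPairs⁺ v≢w))

  ∈-degreeClause : ∀ v i → degreeClause v i ∈ˡ Φ (G , k)
  ∈-degreeClause v i = ∈-++⁺ʳ Φ₁ (∈-++⁺ˡ {ys = Φ₃ ++ Φ₄ ++ Φ₅ ++ Φ₆}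
    (∈-map⁺ _ (∈-cartesianProduct⁺ (∈-allFin v) (∈-allFin i))))

  ∈-filledClause : ∀ i → filledClause i ∈ˡ Φ (G , k)
  ∈-filledClause i = ∈-++⁺ʳ Φ₁ (∈-++⁺ʳ Φ₂ (∈-++⁺ˡ {ys = Φ₄ ++ Φ₅ ++ Φ₆} (∈-map⁺ _ (∈-allFin i))))

  ∈-exclusiveClause : ∀ {v w} i → v ≢ w → exclusiveClause v w i ∈ˡ Φ (G , k)
  ∈-exclusiveClause i v≢w = ∈-++⁺ʳ Φ₁ (∈-++⁺ʳ Φ₂ (∈-++⁺ʳ Φ₃ (∈-++⁺ˡ {ys = Φ₅ ++ Φ₆}
    (∈-map⁺ _ (∈-cartesianProduct⁺ (∈-distinctPairs⁺ v≢w) (∈-allFin i))))))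

  ∈-onceClause : ∀ v {i j : Fin k} → toℕ i < toℕ j → onceClause v i j ∈ˡ Φ (G , k)
  ∈-onceClause v {i} {j} i<j = ∈-++⁺ʳ Φ₁ (∈-++⁺ʳ Φ₂ (∈-++⁺ʳ Φ₃ (∈-++⁺ʳ Φ₄ (∈-++⁺ˡ {ys = Φ₆}
    (∈-map⁺ _ (∈-cartesianProduct⁺ (∈-allFin v)
      (∈-filter⁺ (λ (i , j) → i Fin.<? j) (∈-cartesianProduct⁺ (∈-allFin i) (∈-allFin j)) i<j)))))))

  ∈-coverClause : ∀ {v w} → v ≢ w → coverClause v w ∈ˡ Φ (G , k)
  ∈-coverClause v≢w = ∈-++⁺ʳ Φ₁ (∈-++⁺ʳ Φ₂ (∈-++⁺ʳ Φ₃ (∈-++⁺ʳ Φ₄ (∈-++⁺ʳ Φ₅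
    (∈-map⁺ _ (∈-distinctPairs⁺ v≢w))))))

  Φ-elim : (P : Clause V → Set) →
    (∀ v w → v ≢ w → P (yClause v w)) →
    (∀ v i → P (degreeClause v i)) →
    (∀ i → P (filledClause i)) →
    (∀ v w i → v ≢ w → P (exclusiveClause v w i)) →
    (∀ v i j → toℕ i < toℕ j → P (onceClause v i j)) →
    (∀ v w → v ≢ w → P (coverClause v w)) →
    ∀ {c} → c ∈ˡ Φ (G , k) → P c
  Φ-elim P p₁ p₂ p₃ p₄ p₅ p₆ c∈ with ∈-++⁻ Φ₁ c∈
  ... | inj₁ i with ∈-map⁻ _ i
  ...   | (v , w) , j , refl = p₁ v w (∈-distinctPairs⁻ j)
  Φ-elim P p₁ p₂ p₃ p₄ p₅ p₆ c∈ | inj₂ c∈₂ with ∈-++⁻ Φ₂ c∈₂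
  ... | inj₁ i with ∈-map⁻ _ i
  ...   | (v , j) , _ , refl = p₂ v j
  Φ-elim P p₁ p₂ p₃ p₄ p₅ p₆ c∈ | inj₂ c∈₂ | inj₂ c∈₃ with ∈-++⁻ Φ₃ c∈₃
  ... | inj₁ i with ∈-map⁻ _ i
  ...   | j , _ , refl = p₃ j
  Φ-elim P p₁ p₂ p₃ p₄ p₅ p₆ c∈ | inj₂ c∈₂ | inj₂ c∈₃ | inj₂ c∈₄ with ∈-++⁻ Φ₄ c∈₄
  ... | inj₁ i with ∈-map⁻ _ i
  ...   | ((v , w) , j) , e , refl = p₄ v w j (∈-distinctPairs⁻ (proj₁ (∈-cartesianProduct⁻ (distinctPairs n) (allFin k) e)))
  Φ-elim P p₁ p₂ p₃ p₄ p₅ p₆ c∈ | inj₂ c∈₂ | inj₂ c∈₃ | inj₂ c∈₄ | inj₂ c∈₅ with ∈-++⁻ Φ₅ c∈₅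
  ... | inj₁ i with ∈-map⁻ _ i
  ...   | (v , j , l) , e , refl = p₅ v j l (proj₂ (∈-filter⁻ (λ (i , j) → i Fin.<? j)
      {xs = cartesianProduct (allFin k) (allFin k)}
            (proj₂ (∈-cartesianProduct⁻ (allFin n) (increasingPairs k) e))))
  Φ-elim P p₁ p₂ p₃ p₄ p₅ p₆ c∈ | inj₂ c∈₂ | inj₂ c∈₃ | inj₂ c∈₄ | inj₂ c∈₅ | inj₂ i with ∈-map⁻ _ i
  ...   | (v , w) , e , refl = p₆ v w (∈-distinctPairs⁻ e)

  formula : Clause V → Formula V
  formula c = ⋁ (map literal c)

  ∈-clauses : ∀ {c} → c ∈ˡ Φ (G , k) → formula c ∈ˡ clauses (Φ (G , k))
  ∈-clauses = ∈-map⁺ _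

  length-Φ : length (Φ (G , k)) ≤ (n * n + (n * k + (k + (n * n * k + (n * (k * k) + n * n)))))
  length-Φ = ≤-trans (≤-reflexive (trans (length-++ Φ₁) (cong (length Φ₁ +_)
      (trans (length-++ Φ₂) (cong (length Φ₂ +_) (trans (length-++ Φ₃) (cong (length Φ₃ +_)
      (trans (length-++ Φ₄) (cong (length Φ₄ +_) (length-++ Φ₅))))))))))
    (+-mono-≤ (pairs _) (+-mono-≤ (≤-reflexive (trans (length-map _ (cartesianProduct (allFin n) (allFin k)))
        (grid (allFin n) (allFin k) (length-allFin n) (length-allFin k))))
    (+-mono-≤ (≤-reflexive (trans (length-map _ (allFin k)) (length-allFin k)))
    (+-mono-≤ (≤-trans (≤-reflexive (trans (length-map _ (cartesianProduct (distinctPairs n) (allFin k)))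
        (grid (distinctPairs n) (allFin k) refl (length-allFin k)))) (*-monoˡ-≤ k (length-distinctPairs n)))
    (+-mono-≤ (≤-trans (≤-reflexive (trans (length-map _ (cartesianProduct (allFin n) (increasingPairs k)))
        (grid (allFin n) (increasingPairs k) (length-allFin n) refl)))
       (*-monoʳ-≤ n (≤-trans (length-filter _ (cartesianProduct (allFin k) (allFin k)))
           (≤-reflexive (grid (allFin k) (allFin k) (length-allFin k) (length-allFin k))))))
     (pairs _))))))
    where
    pairs : ∀ (f : Fin n × Fin n → Clause V) → length (map f (distinctPairs n)) ≤ n * n
    pairs f = ≤-trans (≤-reflexive (length-map f (distinctPairs n))) (length-distinctPairs n)
    grid : ∀ {A B : Set} (xs : List A) (ys : List B) {a b} → length xs ≡ a → length ys ≡ b →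
      length (cartesianProduct xs ys) ≡ a * b
    grid xs ys refl refl = length-product xs ys

  k≤Φsize : k ≤ Φsize (G , k)
  k≤Φsize = ≤-trans (≤-reflexive (sym (trans (length-map filledClause (allFin k)) (length-allFin k))))
    (≤-trans (m≤m+n (length Φ₃) _) (≤-trans (≤-reflexive (sym (length-++ Φ₃)))
      (≤-trans (m≤n+m (length (Φ₃ ++ Φ₄ ++ Φ₅ ++ Φ₆)) (length Φ₂)) (≤-trans (≤-reflexive (sym (length-++ Φ₂)))
        (≤-trans (m≤n+m (length (Φ₂ ++ Φ₃ ++ Φ₄ ++ Φ₅ ++ Φ₆)) (length Φ₁)) (≤-reflexive (sym (length-++ Φ₁))))))))

  pairs≤Φsize : length (distinctPairs n) ≤ Φsize (G , k)
  pairs≤Φsize = ≤-trans (≤-reflexive (sym (length-map (λ (v , w) → yClause v w) (distinctPairs n))))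
    (≤-trans (m≤m+n (length Φ₁) _) (≤-reflexive (sym (length-++ Φ₁))))

order≤distinctPairs : ∀ n → n ≤ suc (length (distinctPairs n))
order≤distinctPairs zero    = z≤n
order≤distinctPairs (suc n) = s≤s (Fin.injective⇒≤ {f = λ i → index (mem i)} λ {i} {j} eq →
  Fin.suc-injective (cong proj₂ (trans (lookup-index (mem i)) (trans (cong (List.lookup (distinctPairs (suc n))) eq)
    (sym (lookup-index (mem j)))))))
  where
  mem : ∀ (i : Fin n) → (zero , suc i) ∈ˡ distinctPairs (suc n)
  mem i = ∈-distinctPairs⁺ λ ()

refutation-cost : Polynomial → Polynomial
refutation-cost q = (shift q′ ⊕ shift (shift (shift q′))) ⊕ uniform 9 9
  where
  q′ : Polynomial
  q′ = q ⊕ uniform 5 9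

forced-cost : Polynomial
forced-cost = mpᶜ [ 1100 ] (scale 5 (refutation-cost (uniform 3 7)))

search-cost : ℕ → Polynomial
search-cost zero    = refutation-cost [ 1 ]
search-cost (suc f) = mpᶜ (mpᶜ (mpᶜ [ 1 ] (scale 5 (search-cost f))) (scale 5 (search-cost f))) (uniform 3 6)

module VertexCover (G : Graph) (k N : ℕ) (n≤N : order G ≤ N) (2k≤N : k + k ≤ N) (holes≤N : k * suc k < N) where

  open Translation G k
  open Reduction G k

  private
    n : ℕ
    n = order G
    V : Set
    V = Var n k

  open Frege {V} N
  open PHP {V} N

  private
    variable
      Γ Δ : List (Formula V)
      q : Polynomial
      u v w : Fin n

  k≤N : k ≤ N
  k≤N = ≤-trans (m≤m+n k k) 2k≤N

  x : Fin n → Fin k → Formula V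
  x v i = ` X v i

  InCover : Fin n → Formula V
  InCover v = ⋁ (tabulate (x v))

  record Cover (Γ : List (Formula V)) : Set where
    field
      exclusive : ∀ i → u ≢ v → Γ ⊢⟨ uniform 3 6 ⟩ x u i `⇒ x v i `⇒ `⊥
      covered   : T (adj G u v) → Γ ⊢⟨ uniform 3 6 ⟩ InCover u `∨ InCover v

  wkCover : ∀ {A} → Cover Γ → Cover (A ∷ Γ)
  wkCover c = record { exclusive = λ i u≢v → wk (exclusive i u≢v) ; covered = λ e → wk (covered e) }
    where open Cover c

  inCover-elim : ∀ {C} → (∀ i → Γ ⊢⟨ q ⟩ x v i `⇒ C) → Γ ⊢⟨ [ 1 ] ⊕ shift ([ 3 ] ⊕ q) ⟩ InCover v `⇒ C
  inCover-elim {Γ} {q} {v} {C} f = ⋁-elim (tabulate (x v)) (≤-trans (≤-reflexive (length-tabulate (x v))) k≤N)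
    λ i → each (∈-tabulate⁻ i)
    where
    each : ∀ {A} → ∃[ i ] A ≡ x v i → Γ ⊢⟨ q ⟩ A `⇒ C
    each (i , refl) = f i

  among : ∀ {P : Fin n → Set} → (∀ u → Dec (P u)) → Fin k → List (Formula V)
  among P? i = map (λ u → x u i) (filter P? (allFin n))

  among≤ : ∀ {P : Fin n → Set} (P? : ∀ u → Dec (P u)) i → length (among P? i) ≤ N
  among≤ P? i = ≤-trans (≤-reflexive (length-map _ (filter P? (allFin n)))) (≤-trans (length-filter P? (allFin n))
    (≤-trans (≤-reflexive (length-allFin n)) n≤N))

  among-intro : ∀ {P : Fin n → Set} (P? : ∀ u → Dec (P u)) i → P u → Γ ⊢⟨ 0 ∷ [ 210 ] ⟩ x u i `⇒ ⋁ (among P? i)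
  among-intro P? i p = ⋁-intro (among≤ P? i) (∈-map⁺ _ (∈-filter⁺ P? (∈-allFin _) p))

  among-elim : ∀ {P : Fin n → Set} (P? : ∀ u → Dec (P u)) i {C} →
    (∀ u → P u → Γ ⊢⟨ q ⟩ x u i `⇒ C) → Γ ⊢⟨ [ 1 ] ⊕ shift ([ 3 ] ⊕ q) ⟩ ⋁ (among P? i) `⇒ C
  among-elim {Γ} {q} {P} P? i {C} f = ⋁-elim (among P? i) (among≤ P? i) λ j → each (∈-map⁻ _ j)
    where
    each : ∀ {A} → ∃[ u ] u ∈ˡ filter P? (allFin n) × A ≡ x u i → Γ ⊢⟨ q ⟩ A `⇒ C
    each (u , u∈ , refl) = f u (proj₂ (∈-filter⁻ P? {xs = allFin n} u∈))

  module _ {Forced : Fin n → Set} (O : Overload G k Forced) where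
    open Overload O
    private
      M : ℕ
      M = k * slots

      M≤N : suc M ≤ N
      M≤N = ≤-trans (s≤s (*-monoʳ-≤ k slots≤)) holes≤N

      pigeon : Fin (suc M) → Fin n
      pigeon a = embed pigeons (inject≤ a crowded)

      pigeon-injective : ∀ {a b} → pigeon a ≡ pigeon b → a ≡ b
      pigeon-injective eq = Fin.inject≤-injective crowded crowded _ _ (embed-injective pigeons eq)

      payer? : ∀ a s u → Dec (slot u s ≡ pigeon a)
      payer? a s u = slot u s Fin.≟ pigeon a

      sits : Fin (suc M) → Fin k × Fin slots → Formula V
      sits a (i , s) = ⋁ (among (payer? a s) i)

      P : Fin (suc M) → Fin M → Formula V
      P a j = sits a (remQuot {k} slots j)

      sits-intro : ∀ a i s → Γ ⊢⟨ 0 ∷ [ 210 ] ⟩ sits a (i , s) `⇒ ⋁ (tabulate (P a))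
      sits-intro a i s = ⋁-intro
        (≤-trans (≤-reflexive (length-tabulate (P a))) (≤-trans (n≤1+n M) M≤N))
        (subst (_∈ˡ tabulate (P a)) (cong (sits a) (Fin.remQuot-combine i s)) (∈-tabulate⁺ (combine i s)))

      pays : ∀ a s → slot u s ≡ pigeon a → Γ ⊢⟨ uniform 3 3 ⟩ InCover u `⇒ ⋁ (tabulate (P a))
      pays a s eq = weaken (inCover-elim λ i → among-intro (payer? a s) i eq ⟫ sits-intro a i s)

      total-cost : ∀ q → ev (mpᶜ (uniform 3 3) q) N ≤ ev (q ⊕ uniform 5 9) N
      total-cost q = begin
        ev ([ 1 ] ⊕ (uniform 3 3 ⊕ q)) N                 ≡⟨ ⊕-eval [ 1 ] (uniform 3 3 ⊕ q) N ⟩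
        ev [ 1 ] N + ev (uniform 3 3 ⊕ q) N              ≡⟨ cong (ev [ 1 ] N +_) (⊕-eval (uniform 3 3) q N) ⟩
        ev [ 1 ] N + (ev (uniform 3 3) N + ev q N)       ≡⟨ +-assoc (ev [ 1 ] N) (ev (uniform 3 3) N) (ev q N) ⟨
        ev [ 1 ] N + ev (uniform 3 3) N + ev q N         ≡⟨ +-comm (ev [ 1 ] N + ev (uniform 3 3) N) (ev q N) ⟩
        ev q N + (ev [ 1 ] N + ev (uniform 3 3) N)       ≡⟨ cong (ev q N +_) (⊕-eval [ 1 ] (uniform 3 3) N) ⟨
        ev q N + ev ([ 1 ] ⊕ uniform 3 3) N              ≤⟨ +-monoʳ-≤ (ev q N)
            (≤ᵖ-sound ([ 1 ] ⊕ uniform 3 3) (uniform 5 9) tt N) ⟩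
        ev q N + ev (uniform 5 9) N                      ≡⟨ ⊕-eval q (uniform 5 9) N ⟨
        ev (q ⊕ uniform 5 9) N                           ∎
        where open ≤-Reasoning

    overload-refutation : Cover Γ → (∀ u → Forced u → Γ ⊢⟨ q ⟩ InCover u) → Γ ⊢⟨ refutation-cost q ⟩ `⊥
    overload-refutation {Γ} {q} cover forced =
      cut (derive-pigeonAxioms M≤N total apart) (weakenʰ ∈-++⁺ˡ (pigeonhole {P = P} (≤-trans (n≤1+n M) M≤N)))
      where
      open Cover cover
      relaxʳ : ∀ {A} → Γ ⊢⟨ uniform 5 9 ⟩ A → Γ ⊢⟨ q ⊕ uniform 5 9 ⟩ A
      relaxʳ = relax (≤-trans (m≤n+m (ev (uniform 5 9) N) (ev q N)) (≤-reflexive (sym (⊕-eval q (uniform 5 9) N))))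

      total : ∀ a → Γ ⊢⟨ q ⊕ uniform 5 9 ⟩ ⋁ (tabulate (P a))
      total a with served (pigeon a) (embed-on pigeons (inject≤ a crowded))
      ... | inj₁ (u , f , s , eq) = relax (total-cost q) (pays a s eq $ᶠ forced u f)
      ... | inj₂ (u , v , e , (s , eq) , (t , eq′)) =
        relaxʳ (weaken (∨-elim (pays a s eq) (pays a t eq′) $ᶠ covered e))

      apart : ∀ a b j → a ≢ b → Γ ⊢⟨ q ⊕ uniform 5 9 ⟩ P a j `⇒ P b j `⇒ `⊥
      apart a b j a≢b = relaxʳ (weaken (among-elim (payer? a s) i λ u u-pays →
          ded (among-elim (payer? b s) i λ v v-pays →
            wk (exclusive i λ { refl → a≢b (pigeon-injective (trans (sym u-pays) v-pays)) }) $ᶠ assume (here refl))))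
        where
        i : Fin k
        i = proj₁ (remQuot {k} slots j)
        s : Fin slots
        s = proj₂ (remQuot {k} slots j)

  high-forced : NoSmall → Cover Γ → On high v → Γ ⊢⟨ forced-cost ⟩ InCover v
  high-forced {v = v} noSmall cover h = by-contradiction $ᶠ ded
      (overload-refutation (high-overload G k noSmall h) {q = uniform 3 7} (wkCover cover)
    λ u a → weaken (∨-elim
      (ded (explode (absurd $ᶠ assume (here refl) $ᶠ assume (there (here refl)))))
      (ded (assume (here refl)))
      $ᶠ wk (Cover.covered cover a)))
    where
    explode : ∀ {Γ p A} → Γ ⊢⟨ p ⟩ `⊥ → Γ ⊢⟨ mpᶜ [ 1 ] p ⟩ A
    explode d = axiom (⊥E _) $ᶠ d

  rejection-refutation : NoSmall → k ≤ ∣ high ∣ ⊎ (∣ high ∣ < k × k * k < ∣ kept ∣) → Cover Γ →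
    Γ ⊢⟨ refutation-cost forced-cost ⟩ `⊥
  rejection-refutation noSmall r cover =
    overload-refutation (rejection G k noSmall r) cover (λ v h → high-forced noSmall cover h)

  search : ¬ ListCover G k → ∀ fuel (D : Subset n) → fuel + ∣ D ∣ ≡ suc k → Cover Γ →
    (∀ u → On D u → Γ ⊢⟨ [ 1 ] ⟩ InCover u) → Γ ⊢⟨ search-cost fuel ⟩ `⊥
  search no-cover zero D size cover inD = overload-refutation overload cover inD
    where
    overload : Overload G k (On D)
    overload = record
      { slots = 1 ; slots≤ = s≤s z≤n ; slot = λ u _ → u ; pigeons = D
      ; crowded = ≤-reflexive (trans (cong suc (*-identityʳ k)) (sym size))
      ; served = λ p o → inj₁ (p , o , zero , refl) }
  search {Γ} no-cover (suc fuel) D size cover inD = branch (¬covers⁻ (matrix G) D ¬covering)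
    where
    ¬covering : ¬ T (covers (matrix G) D)
    ¬covering t = no-cover (elements D ,
      ≤-trans (≤-reflexive (length-tabulate (embed D))) (≤-trans (m≤n+m ∣ D ∣ fuel) (≤-reflexive (suc-injective size))) ,
      λ v w a → Sum.map (∈-elements D) (∈-elements D) (covers⁻ (matrix G) D t v w a))

    branch : ∃[ a ] ∃[ b ] T (adj G a b) × ¬ On D a × ¬ On D b → Γ ⊢⟨ search-cost (suc fuel) ⟩ `⊥
    branch (a , b , e , ¬a , ¬b) = ∨-elim (ded (extend a ¬a)) (ded (extend b ¬b)) $ᶠ Cover.covered cover e
      where
      extend : ∀ c → ¬ On D c → InCover c ∷ Γ ⊢⟨ search-cost fuel ⟩ `⊥
      extend c ¬c = search no-cover fuel (D [ c ]≔ true)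
        (trans (cong (fuel +_) (∣insert∣ D ¬c)) (trans (+-suc fuel ∣ D ∣) size))
        (wkCover cover) λ u o → inD′ u (insert⁻ D o)
        where
        inD′ : ∀ u → u ≡ c ⊎ On D u → InCover c ∷ Γ ⊢⟨ [ 1 ] ⟩ InCover u
        inD′ u (inj₁ refl) = assume (here refl)
        inD′ u (inj₂ o)    = wk (inD u o)

  ΦΓ : List (Formula V)
  ΦΓ = clauses (Φ (G , k))

  adj⇒≢ : T (adj G u v) → u ≢ v
  adj⇒≢ {u} a refl = ¬T-≡false (adj-irrefl G u) a

  clause : ∀ {c} → c ∈ˡ Φ (G , k) → ΦΓ ⊢⟨ [ 1 ] ⟩ formula c
  clause = assume ∘ ∈-clauses

  not-both : ∀ {A B} → Γ ⊢⟨ [ 1 ] ⟩ `¬ A `∨ `¬ B `∨ `⊥ → Γ ⊢⟨ uniform 1 5 ⟩ A `⇒ B `⇒ `⊥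
  not-both d = weaken ((∨-to-⇒ $ᶠ d) ⟫ ∨-to-⇒)

  edge-variable : T (adj G u v) → ΦΓ ⊢⟨ uniform 1 3 ⟩ ` Y u v
  edge-variable {u} {v} a = weaken (∨-elim (ded (assume (here refl))) (axiom (⊥E _)) $ᶠ
    subst (λ b → ΦΓ ⊢⟨ [ 1 ] ⟩ formula [ if b then pos (Y u v) else neg (Y u v) ]) (eq a) (clause (∈-yClause (adj⇒≢ a))))
    where
    eq : ∀ {b} → T b → b ≡ true
    eq {true} _ = refl

  non-edge : u ≢ v → ¬ T (adj G u v) → ΦΓ ⊢⟨ uniform 1 5 ⟩ ` Y u v `⇒ `⊥
  non-edge {u} {v} u≢v ¬a = weaken (∨-to-⇒ $ᶠ
    subst (λ b → ΦΓ ⊢⟨ [ 1 ] ⟩ formula [ if b then pos (Y u v) else neg (Y u v) ]) (eq ¬a) (clause (∈-yClause u≢v)))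
    where
    eq : ∀ {b} → ¬ T b → b ≡ false
    eq {true}  ¬t = contradiction tt ¬t
    eq {false} _  = refl

  private
    xs : Fin n → List (Literal V)
    xs v = map (λ i → pos (X v i)) (allFin k)

    ∈-xs : ∀ v {A} → A ∈ˡ map literal (xs v) → ∃[ i ] A ≡ x v i
    ∈-xs v A∈ with ∈-map⁻ literal A∈
    ... | l , l∈ , refl with ∈-map⁻ (λ i → pos (X v i)) l∈
    ... | i , _ , refl = i , refl

    length-xs : ∀ v w → length (map literal (xs v ++ xs w)) ≤ N
    length-xs v w = ≤-trans (≤-reflexive (trans (length-map literal (xs v ++ xs w)) (trans (length-++ (xs v))
      (cong₂ _+_ (trans (length-map _ (allFin k)) (length-allFin k))
          (trans (length-map _ (allFin k)) (length-allFin k)))))) 2k≤N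

  inCover-intro : ∀ v i → Γ ⊢⟨ 0 ∷ [ 210 ] ⟩ x v i `⇒ InCover v
  inCover-intro v i = ⋁-intro (≤-trans (≤-reflexive (length-tabulate (x v))) k≤N) (∈-tabulate⁺ i)

  Φ-cover : Cover ΦΓ
  Φ-cover = record
    { exclusive = λ i u≢v → weaken (not-both (clause (∈-exclusiveClause i u≢v)))
    ; covered = λ {u} {v} a → weaken (⋁-elim (map literal (xs u ++ xs v)) (length-xs u v)
        (λ A∈ → side u v (∈-++⁻ (map literal (xs u)) (subst (_ ∈ˡ_) (map-++ literal (xs u) (xs v)) A∈)))
        $ᶠ (∨-to-⇒ $ᶠ clause (∈-coverClause (adj⇒≢ a)) $ᶠ edge-variable a))
    }
    where
    side : ∀ u v {A} → A ∈ˡ map literal (xs u) ⊎ A ∈ˡ map literal (xs v) → ΦΓ ⊢⟨ uniform 2 4 ⟩ A `⇒ InCover u `∨ InCover v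
    side u v (inj₁ A∈) with ∈-xs u A∈
    ... | i , refl = weaken (inCover-intro u i ⟫ axiom (∨I₁ _ _))
    side u v (inj₂ A∈) with ∈-xs v A∈
    ... | i , refl = weaken (inCover-intro v i ⟫ axiom (∨I₂ _ _))

  once : ∀ v {i j} → i ≢ j → ΦΓ ⊢⟨ uniform 1 7 ⟩ x v i `⇒ x v j `⇒ `⊥
  once v {i} {j} i≢j with Fin.<-cmp i j
  ... | tri< i<j _ _ = weaken (not-both (clause (∈-onceClause v i<j)))
  ... | tri≈ _ i≡j _ = contradiction i≡j i≢j
  ... | tri> _ _ j<i = weaken (ded (ded (wk (wk (not-both (clause (∈-onceClause v j<i)))) $ᶠ assume (here refl) $ᶠ
      assume (there (here refl)))))

  isolated : ∀ v i → (∀ w → ¬ T (adj G v w)) → ΦΓ ⊢⟨ uniform 3 6 ⟩ x v i `⇒ `⊥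
  isolated v i ¬a = weaken ((∨-to-⇒ $ᶠ clause (∈-degreeClause v i)) ⟫
    ⋁-elim (map literal (map (λ w → pos (Y v w)) (others v))) len each)
    where
    len : length (map literal (map (λ w → pos (Y v w)) (others v))) ≤ N
    len = ≤-trans (≤-reflexive (trans (length-map literal (map (λ w → pos (Y v w)) (others v)))
        (length-map (λ w → pos (Y v w)) (others v))))
      (≤-trans (length-filter _ (allFin n)) (≤-trans (≤-reflexive (length-allFin n)) n≤N))
    each : ∀ {A} → A ∈ˡ map literal (map (λ w → pos (Y v w)) (others v)) → ΦΓ ⊢⟨ uniform 1 5 ⟩ A `⇒ `⊥
    each A∈ with ∈-map⁻ literal A∈
    ... | l , l∈ , refl with ∈-map⁻ (λ w → pos (Y v w)) l∈
    ... | w , w∈ , refl = non-edge (λ v≡w → proj₂ (∈-filter⁻ (λ w → ¬? (w Fin.≟ v)) {xs = allFin n} w∈) (sym v≡w)) (¬a w)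

  filled : ∀ i {C} → (∀ v → ΦΓ ⊢⟨ q ⟩ x v i `⇒ C) → ΦΓ ⊢⟨ mpᶜ ([ 1 ] ⊕ shift ([ 3 ] ⊕ q)) [ 1 ] ⟩ C
  filled {q} i {C} f = ⋁-elim (map literal (filledClause i)) len each $ᶠ clause (∈-filledClause i)
    where
    len : length (map literal (filledClause i)) ≤ N
    len = ≤-trans (≤-reflexive (trans (length-map literal (filledClause i))
        (trans (length-map _ (allFin n)) (length-allFin n)))) n≤N
    each : ∀ {A} → A ∈ˡ map literal (filledClause i) → ΦΓ ⊢⟨ q ⟩ A `⇒ C
    each A∈ with ∈-map⁻ literal A∈
    ... | l , l∈ , refl with ∈-map⁻ (λ v → pos (X v i)) l∈
    ... | v , _ , refl = f v

substitute-⋁ : ∀ {V W : Set} (σ : V → Formula W) l → substitute σ (⋁ l) ≡ ⋁ (map (substitute σ) l)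
substitute-⋁ σ []      = refl
substitute-⋁ σ (A ∷ l) = cong (substitute σ A `∨_) (substitute-⋁ σ l)

module ShrunkStep (G : Graph) (m N : ℕ) (n<N : order G < N) (2k<N : suc m + suc m < N) (holes≤N : suc m * suc (suc m) < N)
  (large : suc m * suc m < order G) (noSmall : Reduction.NoSmall G (suc m)) (h<k : ∣ Reduction.high G (suc m) ∣ < suc m)
  (fits : ∣ Reduction.kept G (suc m) ∣ ≤ suc m * suc m) where

  private
    k n : ℕ
    k = suc m
    n = order G
    V : Set
    V = Var n k

  open Reduction G k
  open VertexCover G k N (<⇒≤ n<N) (<⇒≤ 2k<N) holes≤N
  open Frege {V} N
  open Cover Φ-cover

  private
    n′ : ℕ
    n′ = ∣ kept ∣
    module Target = Translation reduced k

    e : Fin n′ → Fin n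
    e = embed kept

    variable
      p q r : Polynomial
      A B C : Formula V
      Γ : List (Formula V)
      v w : Fin n

    n′≤n : n′ ≤ n
    n′≤n = ≤-trans fits (<⇒≤ large)

    fillers≤m : ∣ fillers ∣ ≤ m
    fillers≤m = ≤-trans (∣first∣≤ _ low) (quota≤pred ∣ high ∣ k)

    rank : On fillers v → Fin m
    rank f = inject≤ (proj₁ (embed-onto fillers f)) fillers≤m

    rank-injective : (f : On fillers v) (g : On fillers w) → rank f ≡ rank g → v ≡ w
    rank-injective f g eq = trans (sym (proj₂ (embed-onto fillers f)))
      (trans (cong (embed fillers) (Fin.inject≤-injective fillers≤m fillers≤m _ _ eq)) (proj₂ (embed-onto fillers g)))

    rank-onto : On high v → ∀ j → ∃[ w ] Σ[ f ∈ On fillers w ] rank f ≡ j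
    rank-onto h j = embed fillers i , f , Fin.toℕ-injective (trans (Fin.toℕ-inject≤ _ fillers≤m)
        (trans (cong toℕ (embed-injective fillers (proj₂ (embed-onto fillers f)))) (Fin.toℕ-inject≤ j m≤fillers)))
      where
      m≤fillers : m ≤ ∣ fillers ∣
      m≤fillers = ≤-reflexive (sym (fillers-large G k large fits h))
      i : Fin ∣ fillers ∣
      i = inject≤ j m≤fillers
      f : On fillers (embed fillers i)
      f = embed-on fillers i

    keptIndex : On kept v → ∃[ i ] e i ≡ v
    keptIndex = embed-onto kept

    high⇒¬filler : On high v → ¬ On fillers v
    high⇒¬filler h f = low-¬high (filler-low f) h

    high⇒¬low : On high v → ¬ On low v
    high⇒¬low h l = low-¬high l h

  wasted : Fin k → Formula V
  wasted i = ⋁ (among (λ v → T? (lookup low v)) i)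

  -- The stand-in for a position occupied by a low vertex: the filler of rank j
  -- serves position j + 1, and also position 0 when the vertex a is at j + 1.
  module Substitution (a : Fin n) (anchor : On high a ⊎ (∀ v → ¬ On high v)) where

    standIn : Fin m → Fin k → Formula V
    standIn j zero    = wasted zero `∧ x a (suc j)
    standIn j (suc i) with i Fin.≟ j
    ... | yes _ = wasted (suc i)
    ... | no _  = `⊥

    place : Fin n → Fin k → Formula V
    place v i with T? (lookup fillers v)
    ... | yes f = standIn (rank f) i
    ... | no _  = x v i

    σ : Var n′ k → Formula V
    σ (Y i j) = if adj reduced i j then `¬ `⊥ else `⊥
    σ (X i p) = place (e i) p

    target : Clause (Var n′ k) → Formula V
    target c = substitute σ (Target.formula c)

    place-filler : (f : On fillers v) → ∀ i → place v i ≡ standIn (rank f) i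
    place-filler {v} f i with T? (lookup fillers v)
    ... | yes f′ = cong (λ f → standIn (rank f) i) (T-irrelevant f′ f)
    ... | no ¬f  = contradiction f ¬f

    place-core : ¬ On fillers v → ∀ i → place v i ≡ x v i
    place-core {v} ¬f i with T? (lookup fillers v)
    ... | yes f = contradiction f ¬f
    ... | no _  = refl

    standIn-same : ∀ j → standIn j (suc j) ≡ wasted (suc j)
    standIn-same j with j Fin.≟ j
    ... | yes _  = refl
    ... | no j≢j = contradiction refl j≢j

    standIn-wasted : ∀ j i → Γ ⊢⟨ [ 1 ] ⊕ uniform 1 3 ⟩ standIn j i `⇒ wasted i
    standIn-wasted j zero = weaken (axiom (∧E₁ _ _))
    standIn-wasted j (suc i) with i Fin.≟ j
    ... | yes _ = weaken (ded (assume (here refl)))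
    ... | no _  = weaken (axiom (⊥E _))

    wasted-exclusive : ¬ On low v → ∀ i → ΦΓ ⊢⟨ uniform 4 7 ⟩ wasted i `⇒ x v i `⇒ `⊥
    wasted-exclusive ¬l i = weaken (among-elim _ i λ w l → exclusive i λ { refl → ¬l l })

    flip : Γ ⊢⟨ p ⟩ A `⇒ B `⇒ `⊥ → Γ ⊢⟨ mpᶜ (uniform 1 4) p ⟩ B `⇒ A `⇒ `⊥
    flip d = swap $ᶠ d
      where
      swap : Γ ⊢⟨ uniform 1 4 ⟩ (A `⇒ B `⇒ C) `⇒ B `⇒ A `⇒ C
      swap = weaken (ded (ded (ded (assume (there (there (here refl))) $ᶠ assume (here refl) $ᶠ assume
          (there (here refl))))))

    target-intro : ∀ {c ℓ} → length c ≤ N → ℓ ∈ˡ c → Γ ⊢⟨ 0 ∷ [ 210 ] ⟩ substitute σ (literal ℓ) `⇒ target c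
    target-intro {Γ} {c} {ℓ} c≤N ℓ∈ = subst (λ F → Γ ⊢⟨ 0 ∷ [ 210 ] ⟩ substitute σ (literal ℓ) `⇒ F)
        (sym (substitute-⋁ σ (map literal c)))
      (⋁-intro (≤-trans (≤-reflexive (trans (length-map (substitute σ) (map literal c)) (length-map literal c))) c≤N)
        (∈-map⁺ (substitute σ) (∈-map⁺ literal ℓ∈)))

    Derivable : Clause (Var n′ k) → Set
    Derivable c = ΦΓ ⊢⟨ uniform 30 30 ⟩ target c

    adjacent : ∀ {i j} → T (adj reduced i j) → σ (Y i j) ≡ `¬ `⊥
    adjacent {i} {j} a with adj reduced i j
    ... | true = refl

    nonadjacent : ∀ {i j} → ¬ T (adj reduced i j) → σ (Y i j) ≡ `⊥
    nonadjacent {i} {j} ¬a with adj reduced i j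
    ... | true  = contradiction tt ¬a
    ... | false = refl

    y-derivable : ∀ i j → ΦΓ ⊢⟨ uniform 1 4 ⟩ target (Target.yClause i j)
    y-derivable i j with adj reduced i j in eq
    ... | true  rewrite eq = weaken (axiom (∨I₁ _ _) $ᶠ ⊤ᶠ)
    ... | false rewrite eq = weaken (axiom (∨I₁ _ _) $ᶠ ⊤ᶠ)

    neighbour : ∀ i → ∃[ j ] T (adj reduced i j)
    neighbour i with kept⁻ (embed-on kept i)
    ... | inj₁ f with filler-high f
    ...   | w , h with keptIndex (¬low-kept (high⇒¬low h))
    ...     | j , refl = j , reducedAdj⁺ G k large noSmall h<k fits (newAdj-filler f h)
    neighbour i | inj₂ ¬l with T? (lookup high (e i))
    ... | no ¬h with middle ¬h ¬l
    ...   | w , a , _ , ¬lw with keptIndex (¬low-kept ¬lw)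
    ...     | j , refl = j , reducedAdj⁺ G k large noSmall h<k fits (newAdj-old (¬l ∘ filler-low) a)
    neighbour i | inj₂ ¬l | yes h with rank-onto h (fromℕ< 0<m)
      where
      0<m : 0 < m
      0<m = ≤-pred (≤-trans (s≤s (n≢0⇒n>0 (nonempty high h))) h<k)
    ... | w , f , _ with keptIndex (filler-kept f)
    ...   | j , refl = j , reducedAdj⁺ G k large noSmall h<k fits (newAdj-filler′ f h)

    degree-derivable : ∀ i p → ΦΓ ⊢⟨ uniform 2 4 ⟩ target (Target.degreeClause i p)
    degree-derivable i p with neighbour i
    ... | j , a = weaken (target-intro {c = Target.degreeClause i p} {ℓ = pos (Y i j)} len
        (there (∈-map⁺ _ (∈-filter⁺ (λ w → ¬? (w Fin.≟ i)) (∈-allFin j) λ { refl → ¬T-≡false (adj-irrefl reduced i) a })))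
        $ᶠ subst (λ F → ΦΓ ⊢⟨ [ 202 ] ⟩ F) (sym (adjacent a)) ⊤ᶠ)
      where
      len : length (Target.degreeClause i p) ≤ N
      len = ≤-trans (s≤s (≤-trans (≤-reflexive (length-map (λ w → pos (Y i w)) (others i)))
          (≤-trans (length-filter _ (allFin n′))
        (≤-trans (≤-reflexive (length-allFin n′)) n′≤n)))) n<N

    at : ∀ {c} → length c ≤ N → (o : On kept v) → ∀ i → pos (X (proj₁ (keptIndex o)) i) ∈ˡ c →
      Γ ⊢⟨ 0 ∷ [ 210 ] ⟩ place v i `⇒ target c
    at {Γ = Γ} {c = c} len o i ℓ∈ = subst (λ v → Γ ⊢⟨ 0 ∷ [ 210 ] ⟩ place v i `⇒ target c) (proj₂ (keptIndex o))
      (target-intro {c = c} len ℓ∈)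

    at-core : ∀ {c} → length c ≤ N → (¬l : ¬ On low v) → ∀ i → pos (X (proj₁ (keptIndex (¬low-kept ¬l))) i) ∈ˡ c →
      Γ ⊢⟨ 0 ∷ [ 210 ] ⟩ x v i `⇒ target c
    at-core {Γ = Γ} {c = c} len ¬l i ℓ∈ =
      subst (λ F → Γ ⊢⟨ 0 ∷ [ 210 ] ⟩ F `⇒ target c) (place-core (¬l ∘ filler-low) i) (at {c = c} len (¬low-kept ¬l) i ℓ∈)

    at-filler : ∀ {c} → length c ≤ N → (f : On fillers v) → ∀ i → pos (X (proj₁ (keptIndex (filler-kept f))) i) ∈ˡ c →
      Γ ⊢⟨ 0 ∷ [ 210 ] ⟩ standIn (rank f) i `⇒ target c
    at-filler {Γ = Γ} {c = c} len f i ℓ∈ =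
      subst (λ F → Γ ⊢⟨ 0 ∷ [ 210 ] ⟩ F `⇒ target c) (place-filler f i) (at {c = c} len (filler-kept f) i ℓ∈)

    module _ (i : Fin k) where
      private
        goal : Formula V
        goal = target (Target.filledClause i)

        len : length (Target.filledClause i) ≤ N
        len = ≤-trans (≤-reflexive (trans (length-map (λ v → pos (X v i)) (allFin n′)) (length-allFin n′)))
            (≤-trans n′≤n (<⇒≤ n<N))

        mem : ∀ j → pos (X j i) ∈ˡ Target.filledClause i
        mem j = ∈-map⁺ _ (∈-allFin j)

      filled-core : ¬ On low v → Γ ⊢⟨ 0 ∷ [ 210 ] ⟩ x v i `⇒ goal
      filled-core ¬l = at-core {c = Target.filledClause i} len ¬l i (mem _)

      filled-filler : (f : On fillers v) → Γ ⊢⟨ 0 ∷ [ 210 ] ⟩ standIn (rank f) i `⇒ goal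
      filled-filler f = at-filler {c = Target.filledClause i} len f i (mem _)

    refill : On high a → ∀ i → ΦΓ ⊢⟨ uniform 7 9 ⊕ scale 5 forced-cost ⟩ wasted i `⇒ target (Target.filledClause i)
    refill h (suc i) with rank-onto h i
    ... | w , f , refl = weaken (subst (λ F → ΦΓ ⊢⟨ 0 ∷ [ 210 ] ⟩ F `⇒ target (Target.filledClause (suc (rank f))))
        (standIn-same (rank f)) (filled-filler (suc (rank f)) f))
    refill h zero = weaken (ded (inCover-elim {q = uniform 5 8} locate $ᶠ wk (high-forced noSmall Φ-cover h)))
      where
      locate : ∀ j → wasted zero ∷ ΦΓ ⊢⟨ uniform 5 8 ⟩ x a j `⇒ target (Target.filledClause zero)
      locate zero    = weaken ((wk (wasted-exclusive (high⇒¬low h) zero) $ᶠ assume (here refl)) ⟫ axiom (⊥E _))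
      locate (suc j) with rank-onto h j
      ... | w , f , refl = weaken ((axiom (∧I _ _) $ᶠ assume (here refl)) ⟫ filled-filler zero f)

    filled-derivable : ∀ i → Derivable (Target.filledClause i)
    filled-derivable i = weaken (filled {q = uniform 8 10 ⊕ scale 5 forced-cost} i each)
      where
      each : ∀ v → ΦΓ ⊢⟨ uniform 8 10 ⊕ scale 5 forced-cost ⟩ x v i `⇒ target (Target.filledClause i)
      each v with T? (lookup low v)
      ... | no ¬l = weaken (filled-core i ¬l)
      ... | yes l = [ (λ h → weaken (among-intro (λ v → T? (lookup low v)) i l ⟫ refill h i))
                    , (λ ¬h → weaken (isolated v i (λ w a → ¬h w (low-nbrs l a)) ⟫ axiom (⊥E _))) ]′ anchor

    standIn-exclusive : ∀ {j j′} i → j ≢ j′ → ΦΓ ⊢⟨ uniform 1 9 ⟩ standIn j i `⇒ standIn j′ i `⇒ `⊥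
    standIn-exclusive zero j≢ = weaken (ded (ded
      (wk (wk (once a (j≢ ∘ Fin.suc-injective))) $ᶠ (axiom (∧E₂ _ _) $ᶠ assume (there (here refl))) $ᶠ
          (axiom (∧E₂ _ _) $ᶠ assume (here refl)))))
    standIn-exclusive {j} {j′} (suc i) j≢ with i Fin.≟ j | i Fin.≟ j′
    ... | yes refl | yes refl = contradiction refl j≢
    ... | yes _    | no _     = weaken (axiom (⇒K _ _) $ᶠ axiom (⊥E _))
    ... | no _     | _        = weaken (axiom (⊥E _))

    not-both⁻ : Γ ⊢⟨ p ⟩ A `⇒ B `⇒ `⊥ → Γ ⊢⟨ mpᶜ (uniform 1 8) p ⟩ `¬ A `∨ `¬ B `∨ `⊥
    not-both⁻ d = convert $ᶠ d
      where
      convert : Γ ⊢⟨ uniform 1 8 ⟩ (A `⇒ B `⇒ `⊥) `⇒ `¬ A `∨ `¬ B `∨ `⊥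
      convert = weaken (ded (⇒-to-∨ $ᶠ ded (⇒-to-∨ $ᶠ (assume (there (here refl)) $ᶠ assume (here refl)))))

    core⇒¬low : On kept v → ¬ On fillers v → ¬ On low v
    core⇒¬low kv ¬f = [ (λ f → contradiction f ¬f) , id ]′ (kept⁻ kv)

    place-exclusive : On kept v → On kept w → v ≢ w → ∀ i → ΦΓ ⊢⟨ uniform 4 10 ⟩ place v i `⇒ place w i `⇒ `⊥
    place-exclusive {v} {w} kv kw v≢w i with T? (lookup fillers v) | T? (lookup fillers w)
    ... | yes f | yes g = weaken (standIn-exclusive i λ eq → v≢w (rank-injective f g eq))
    ... | yes f | no ¬g = weaken (standIn-wasted (rank f) i ⟫ wasted-exclusive (core⇒¬low kw ¬g) i)
    ... | no ¬f | yes g = weaken (flip (standIn-wasted (rank g) i ⟫ wasted-exclusive (core⇒¬low kv ¬f) i))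
    ... | no ¬f | no ¬g = weaken (exclusive i v≢w)

    exclusive-derivable : ∀ i j p → i ≢ j → ΦΓ ⊢⟨ uniform 4 13 ⟩ target (Target.exclusiveClause i j p)
    exclusive-derivable i j p i≢j =
      weaken (not-both⁻ (place-exclusive (embed-on kept i) (embed-on kept j) (i≢j ∘ embed-injective kept) p))

    standIn-once : On high a → ∀ j i i′ → toℕ i < toℕ i′ → ΦΓ ⊢⟨ uniform 4 9 ⟩ standIn j i `⇒ standIn j i′ `⇒ `⊥
    standIn-once h j zero (suc i′) _ with i′ Fin.≟ j
    ... | yes refl = weaken (flip (wasted-exclusive (high⇒¬low h) (suc j) ⟫ (compose $ᶠ axiom (∧E₂ _ _))))
    ... | no _     = weaken (axiom (⇒K _ _) $ᶠ axiom (⊥E _))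
    standIn-once h j (suc i) (suc i′) i<i′ with i Fin.≟ j | i′ Fin.≟ j
    ... | yes refl | yes refl = contradiction i<i′ (<-irrefl refl)
    ... | yes _    | no _     = weaken (axiom (⇒K _ _) $ᶠ axiom (⊥E _))
    ... | no _     | _        = weaken (axiom (⊥E _))

    place-once : ∀ v i i′ → toℕ i < toℕ i′ → ΦΓ ⊢⟨ uniform 4 9 ⟩ place v i `⇒ place v i′ `⇒ `⊥
    place-once v i i′ i<i′ with T? (lookup fillers v)
    ... | yes f = standIn-once ([ id , (λ ¬h → contradiction (proj₂ (filler-high f)) (¬h _)) ]′ anchor) (rank f) i i′ i<i′
    ... | no _  = weaken (once v λ { refl → <-irrefl refl i<i′ })

    once-derivable : ∀ i p p′ → toℕ p < toℕ p′ → ΦΓ ⊢⟨ uniform 4 13 ⟩ target (Target.onceClause i p p′)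
    once-derivable i p p′ p<p′ = weaken (not-both⁻ (place-once (e i) p p′ p<p′))

    cover-length : ∀ i j → length (Target.coverClause i j) ≤ N
    cover-length i j = ≤-trans (≤-reflexive (cong suc (trans (length-++ (map (λ p → pos (X i p)) (allFin k)))
      (cong₂ _+_ (trans (length-map (λ p → pos (X i p)) (allFin k)) (length-allFin k))
          (trans (length-map (λ p → pos (X j p)) (allFin k)) (length-allFin k)))))) 2k<N

    core-intro : ∀ {c} i → length c ≤ N → ¬ On fillers (e i) → (∀ p → pos (X i p) ∈ˡ c) →
      ΦΓ ⊢⟨ uniform 4 4 ⟩ InCover (e i) `⇒ target c
    core-intro {c} i len ¬f mem = weaken (inCover-elim λ p →
      subst (λ F → ΦΓ ⊢⟨ 0 ∷ [ 210 ] ⟩ F `⇒ target c) (place-core ¬f p) (target-intro {c = c} {ℓ = pos (X i p)} len (mem p)))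

    leftᶜ : ∀ i j → ¬ On fillers (e i) → ΦΓ ⊢⟨ uniform 4 4 ⟩ InCover (e i) `⇒ target (Target.coverClause i j)
    leftᶜ i j ¬f = core-intro {Target.coverClause i j} i (cover-length i j) ¬f λ p → there (∈-++⁺ˡ (∈-map⁺ _ (∈-allFin p)))

    rightᶜ : ∀ i j → ¬ On fillers (e j) → ΦΓ ⊢⟨ uniform 4 4 ⟩ InCover (e j) `⇒ target (Target.coverClause i j)
    rightᶜ i j ¬f = core-intro {Target.coverClause i j} j (cover-length i j) ¬f λ p →
      there (∈-++⁺ʳ (map (λ p → pos (X i p)) (allFin k)) (∈-map⁺ _ (∈-allFin p)))

    cover-derivable : ∀ i j → Derivable (Target.coverClause i j)
    cover-derivable i j with T? (adj reduced i j)
    ... | no ¬a = weaken (target-intro {c = Target.coverClause i j} {ℓ = neg (Y i j)} (cover-length i j) (here refl)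
        $ᶠ subst (λ F → ΦΓ ⊢⟨ [ 202 ] ⟩ `¬ F) (sym (nonadjacent ¬a)) ⊤ᶠ)
    ... | yes a with newAdj⁻ {e i} {e j} (reducedAdj⁻ G k large noSmall h<k fits a)
    ...   | inj₁ h = weaken (leftᶜ i j (high⇒¬filler h) $ᶠ high-forced noSmall Φ-cover h)
    ...   | inj₂ (inj₁ h) = weaken (rightᶜ i j (high⇒¬filler h) $ᶠ high-forced noSmall Φ-cover h)
    ...   | inj₂ (inj₂ (b , ¬f)) with T? (lookup high (e i))
    ...     | yes h = weaken (leftᶜ i j ¬f $ᶠ high-forced noSmall Φ-cover h)
    ...     | no ¬h = weaken (∨-elim (leftᶜ i j ¬f) (rightᶜ i j λ g → ¬h (low-nbrs′ (filler-low g) b)) $ᶠ covered b)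

    all-derivable : ∀ {c} → c ∈ˡ Φ (reduced , k) → Derivable c
    all-derivable = Target.Φ-elim Derivable
      (λ i j _ → weaken (y-derivable i j))
      (λ i p → weaken (degree-derivable i p))
      filled-derivable
      (λ i j p i≢j → weaken (exclusive-derivable i j p i≢j))
      (λ i p p′ p<p′ → weaken (once-derivable i p p′ p<p′))
      (λ i j _ → cover-derivable i j)

module _ where

  infixr 5 _⊠_

  data Ty : Set where
    unit bool : Ty
    list      : Ty → Ty
    _⊠_       : Ty → Ty → Ty

  El : Ty → Set
  El unit     = ⊤
  El bool     = Bool
  El (list a) = List (El a)
  El (a ⊠ b)  = El a × El b

  code : ∀ a → El a → Tree
  code unit     _       = nil
  code bool             = encodeBool
  code (list a)         = encodeList (code a)
  code (a ⊠ b)  (x , y) = cons (code a x) (code b y)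

  weight : Tree → ℕ
  weight nil        = 1
  weight (cons s t) = suc (weight s + weight t)

  update-same : ∀ s x d → (s [ x ↦ d ]) x ≡ d
  update-same s x d with x ≡ᵇ x in eq
  ... | true  = refl
  ... | false = ⊥-elim (subst T eq (≡⇒≡ᵇ x x refl))

  update-other : ∀ s x d {y} → x ≢ y → (s [ x ↦ d ]) y ≡ s y
  update-other s x d {y} x≢y with x ≡ᵇ y in eq
  ... | true  = contradiction (≡ᵇ⇒≡ x y (subst T (sym eq) tt)) x≢y
  ... | false = refl

  update-above : ∀ s x d {y} → y < x → (s [ x ↦ d ]) y ≡ s y
  update-above s x d y<x = update-other s x d (λ eq → <⇒≢ y<x (sym eq))

  Halts : Command → ℕ → Store → ℕ → Tree → Set
  Halts p v s bound out = ∃[ s′ ] ∃[ t ] Run p s s′ t × t ≤ bound × s′ v ≡ out × (∀ y → y < v → s′ y ≡ s y)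

  -- A program at base v reads its input from variable v, leaves its output
  -- there, and preserves the variables below v.
  record Feasible (a b : Ty) (f : El a → El b) : Set where
    field
      program : ℕ → Command
      time    : Polynomial
      growth  : Polynomial
      runs    : ∀ v s x → s v ≡ code a x → Halts (program v) v s (ev time (weight (code a x))) (code b (f x))
      output≤   : ∀ x → weight (code b (f x)) ≤ ev growth (weight (code a x))

  open Feasible public using (output≤; growth)

  private variable
    a b c d : Ty

  feasible-cong : {f g : El a → El b} → (∀ x → f x ≡ g x) → Feasible a b f → Feasible a b g
  feasible-cong {b = b} f≗g F = record
    { program = program ; time = time ; growth = Feasible.growth F
    ; runs = λ v s x eq → let s′ , t , r , t≤ , out , below = runs v s x eq in
        s′ , t , r , t≤ , trans out (cong (code b) (f≗g x)) , below
    ; output≤ = λ x → subst (λ y → weight (code b y) ≤ _) (f≗g x) (Feasible.output≤ F x) }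
    where open Feasible F using (program; time; runs)

  expression : {f : El a → El b} (e : ℕ → Expr) (c : ℕ) → (∀ v → cost (e v) ≡ c) →
    (∀ v s x → s v ≡ code a x → evalExpr (e v) s ≡ code b (f x)) →
    (p : Polynomial) → (∀ x → weight (code b (f x)) ≤ ev p (weight (code a x))) → Feasible a b f
  expression e c e-cost e-val p output≤ = record
    { program = λ v → v ≔ e v ; time = [ suc c ] ; growth = p
    ; runs = λ v s x eq → _ , _ , assign ,
        ≤-reflexive (trans (cong suc (e-cost v)) (sym (const-eval (suc c) _))) ,
        trans (update-same s v (evalExpr (e v) s)) (e-val v s x eq) ,
        λ y y<v → update-above s v (evalExpr (e v) s) y<v
    ; output≤ = output≤ }

  linear : ℕ → Polynomial
  linear c = [ c ] ⊕ (0 ∷ [ 1 ])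

  linear-eval : ∀ c x → ev (linear c) x ≡ c + x
  linear-eval c x = trans (⊕-eval [ c ] (0 ∷ [ 1 ]) x) (cong₂ _+_ (const-eval c x)
      (trans (shift-eval [ 1 ] x) (trans (cong (x *_) (const-eval 1 x)) (*-identityʳ x))))

  identity : Feasible a a id
  identity = expression var 1 (λ _ → refl) (λ _ _ _ eq → eq) (linear 0) (λ x → ≤-reflexive (sym (linear-eval 0 _)))

  first′ : Feasible (a ⊠ b) a proj₁
  first′ {a} {b} = expression (hd ∘ var) 2 (λ _ → refl) (λ _ _ _ eq → cong head eq) (linear 0)
    λ (x , y) → ≤-trans (m≤n⇒m≤1+n (m≤m+n _ _)) (≤-reflexive (sym (linear-eval 0 _)))

  second : Feasible (a ⊠ b) b proj₂
  second {a} {b} = expression (tl ∘ var) 2 (λ _ → refl) (λ _ _ _ eq → cong tail eq) (linear 0)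
    λ (x , y) → ≤-trans (m≤n⇒m≤1+n (m≤n+m (weight (code b y)) (weight (code a x)))) (≤-reflexive (sym (linear-eval 0 _)))

  quoted : Tree → Expr
  quoted nil        = nil
  quoted (cons s t) = cons (quoted s) (quoted t)

  quoted-eval : ∀ t s → evalExpr (quoted t) s ≡ t
  quoted-eval nil        s = refl
  quoted-eval (cons t u) s = cong₂ cons (quoted-eval t s) (quoted-eval u s)

  constant : (y : El b) → Feasible a b (λ _ → y)
  constant {b} y = expression (λ _ → quoted (code b y)) _ (λ _ → refl) (λ _ s _ _ → quoted-eval (code b y) s)
    [ weight (code b y) ] (λ _ → ≤-reflexive (sym (const-eval _ _)))

  prepend : Feasible (a ⊠ list a) (list a) (λ (x , xs) → x ∷ xs)
  prepend = expression var 1 (λ _ → refl) (λ _ _ _ eq → eq) (linear 0) (λ x → ≤-reflexive (sym (linear-eval 0 _)))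

  tailˡ : ∀ {A : Set} → List A → List A
  tailˡ []       = []
  tailˡ (x ∷ xs) = xs

  headOr : ∀ {A : Set} → A → List A → A
  headOr d []       = d
  headOr d (x ∷ xs) = x

  drop-first : Feasible (list a) (list a) tailˡ
  drop-first {a} = expression (tl ∘ var) 2 (λ _ → refl) (λ { _ _ [] eq → cong tail eq ; _ _ (x ∷ xs) eq → cong tail eq
      }) (linear 0)
    λ { [] → ≤-reflexive (sym (linear-eval 0 _))
      ; (x ∷ xs) → ≤-trans (m≤n⇒m≤1+n (m≤n+m (weight (code (list a) xs)) (weight (code a x))))
          (≤-reflexive (sym (linear-eval 0 _))) }

  head-or : (d : El a) → code a d ≡ nil → Feasible (list a) a (headOr d)
  head-or {a} d d≡nil = expression (hd ∘ var) 2 (λ _ → refl)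
    (λ { _ _ [] eq → trans (cong head eq) (sym d≡nil) ; _ _ (x ∷ xs) eq → cong head eq }) (linear 0)
    λ { [] → ≤-trans (≤-reflexive (cong weight d≡nil)) (≤-reflexive (sym (linear-eval 0 _)))
      ; (x ∷ xs) → ≤-trans (m≤n⇒m≤1+n (m≤m+n _ _)) (≤-reflexive (sym (linear-eval 0 _))) }

  infixr 9 _∙_

  _∙_ : {f : El a → El b} {g : El b → El c} → Feasible b c g → Feasible a b f → Feasible a c (g ∘ f)
  _∙_ {a} {b} {c} {f} {g} G F = record
    { program = λ v → F.program v ⨟ G.program v
    ; time = F.time ⊕ G.time ⊚ F.growth ; growth = G.growth ⊚ F.growth
    ; runs = runs′
    ; output≤ = λ x → ≤-trans (G.output≤ (f x)) (≤-trans (ev-mono G.growth (F.output≤ x))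
        (≤-reflexive (sym (⊚-eval G.growth F.growth _)))) }
    where
    module F = Feasible F
    module G = Feasible G
    runs′ : ∀ v s x → s v ≡ code a x → _
    runs′ v s x eq with F.runs v s x eq
    ... | s₁ , t₁ , r₁ , t₁≤ , out₁ , below₁ with G.runs v s₁ (f x) out₁
    ... | s₂ , t₂ , r₂ , t₂≤ , out₂ , below₂ = s₂ , t₁ + t₂ , seq r₁ r₂ ,
      ≤-trans (+-mono-≤ t₁≤ (≤-trans t₂≤ (≤-trans (ev-mono G.time (F.output≤ x))
          (≤-reflexive (sym (⊚-eval G.time F.growth _))))))
        (≤-reflexive (sym (⊕-eval F.time (G.time ⊚ F.growth) _))) ,
      out₂ , λ y y<v → trans (below₂ y y<v) (below₁ y y<v)

  ⟨_,_⟩ : {f : El a → El b} {g : El a → El c} → Feasible a b f → Feasible a c g → Feasible a (b ⊠ c) (λ x → f x , g x)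
  ⟨_,_⟩ {a} {b} {c} {f} {g} F G = record
    { program = λ v → suc v ≔ var v ⨟ F.program (suc v) ⨟ suc (suc v) ≔ var v ⨟ G.program (suc (suc v)) ⨟
                      v ≔ cons (var (suc v)) (var (suc (suc v)))
    ; time = [ 8 ] ⊕ (F.time ⊕ G.time) ; growth = [ 1 ] ⊕ (F.growth ⊕ G.growth)
    ; runs = runs′
    ; output≤ = λ x → ≤-trans (s≤s (+-mono-≤ (F.output≤ x) (G.output≤ x)))
        (≤-reflexive (sym (eval₃ 1 F.growth G.growth _))) }
    where
    module F = Feasible F
    module G = Feasible G
    eval₃ : ∀ c p q x → ev ([ c ] ⊕ (p ⊕ q)) x ≡ c + (ev p x + ev q x)
    eval₃ c p q x = trans (⊕-eval [ c ] (p ⊕ q) x) (cong₂ _+_ (const-eval c x) (⊕-eval p q x))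
    runs′ : ∀ v s x → s v ≡ code a x → _
    runs′ v s x eq with F.runs (suc v) (s [ suc v ↦ s v ]) x (trans (update-same s (suc v) (s v)) eq)
    ... | s₁ , t₁ , r₁ , t₁≤ , out₁ , below₁
      with s₁v ← trans (below₁ v (n<1+n v)) (update-above s (suc v) (s v) (n<1+n v))
      with G.runs (suc (suc v)) (s₁ [ suc (suc v) ↦ s₁ v ]) x (trans (update-same s₁ (suc (suc v)) (s₁ v)) (trans s₁v eq))
    ... | s₂ , t₂ , r₂ , t₂≤ , out₂ , below₂ = s₂ [ v ↦ cons (s₂ (suc v)) (s₂ (suc (suc v))) ] , 2 + (t₁ + (2 + (t₂ + 4))) ,
      seq assign (seq r₁ (seq assign (seq r₂ assign))) ,
      ≤-trans (≤-reflexive (arith t₁ t₂)) (≤-trans (+-monoʳ-≤ 8 (+-mono-≤ t₁≤ t₂≤))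
          (≤-reflexive (sym (eval₃ 8 F.time G.time _)))) ,
      trans (update-same s₂ v (cons (s₂ (suc v)) (s₂ (suc (suc v)))))
        (cong₂ cons (trans (below₂ (suc v) (n<1+n (suc v))) (trans
            (update-above s₁ (suc (suc v)) (s₁ v) (n<1+n (suc v))) out₁)) out₂) ,
      λ y y<v → trans (update-above s₂ v (cons (s₂ (suc v)) (s₂ (suc (suc v)))) y<v)
          (trans (below₂ y (m<n⇒m<1+n (m<n⇒m<1+n y<v)))
        (trans (update-above s₁ (suc (suc v)) (s₁ v) (m<n⇒m<1+n (m<n⇒m<1+n y<v)))
          (trans (below₁ y (m<n⇒m<1+n y<v)) (update-above s (suc v) (s v) (m<n⇒m<1+n y<v)))))
      where
      arith : ∀ t₁ t₂ → 2 + (t₁ + (2 + (t₂ + 4))) ≡ 8 + (t₁ + t₂)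
      arith t₁ t₂ = solve 2 (λ t u → con 2 :+ (t :+ (con 2 :+ (u :+ con 4))) := con 8 :+ (t :+ u)) refl t₁ t₂

  choose : Feasible (bool ⊠ a ⊠ a) a (λ (c , x , y) → if c then x else y)
  choose {a} = record
    { program = λ v → suc v ≔ hd (var v) ⨟ suc (suc v) ≔ hd (tl (var v)) ⨟ v ≔ tl (tl (var v)) ⨟
        while (var (suc v)) (v ≔ var (suc (suc v)) ⨟ suc v ≔ nil)
    ; time = [ 19 ] ; growth = linear 0
    ; runs = runs′
    ; output≤ = λ { (true , x , y) → ≤-trans (≤-trans (m≤n⇒m≤1+n (m≤m+n _ _))
        (m≤n⇒m≤1+n (m≤n+m (weight (cons (code a x) (code a y))) 3))) (≤-reflexive (sym (linear-eval 0 _)))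
                ; (false , x , y) → ≤-trans (≤-trans (m≤n⇒m≤1+n (m≤n+m (weight (code a y)) (weight (code a x))))
                    (m≤n⇒m≤1+n (m≤n+m (weight (cons (code a x) (code a y))) 1))) (≤-reflexive (sym (linear-eval 0 _))) } }
    where
    runs′ : ∀ v s x → s v ≡ code (bool ⊠ a ⊠ a) x → Halts
      (suc v ≔ hd (var v) ⨟ suc (suc v) ≔ hd (tl (var v)) ⨟ v ≔ tl (tl (var v)) ⨟ while (var (suc v))
          (v ≔ var (suc (suc v)) ⨟ suc v ≔ nil))
      v s (ev [ 19 ] (weight (code (bool ⊠ a ⊠ a) x))) (code a (if proj₁ x then proj₁ (proj₂ x) else proj₂ (proj₂ x)))
    runs′ v s (c , x , y) eq = finish c eq
      where
      s₁ s₂ s₃ : Store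
      s₁ = s [ suc v ↦ head (s v) ]
      s₂ = s₁ [ suc (suc v) ↦ head (tail (s₁ v)) ]
      s₃ = s₂ [ v ↦ tail (tail (s₂ v)) ]
      s₁v : s₁ v ≡ s v
      s₁v = update-above s (suc v) (head (s v)) (n<1+n v)
      s₂v : s₂ v ≡ s v
      s₂v = trans (update-above s₁ (suc (suc v)) (head (tail (s₁ v))) (m<n⇒m<1+n (n<1+n v))) s₁v
      flag : s₃ (suc v) ≡ head (s v)
      flag = trans (update-other s₂ v (tail (tail (s₂ v))) (1+n≢n ∘ sym))
        (trans (update-above s₁ (suc (suc v)) (head (tail (s₁ v))) (n<1+n (suc v))) (update-same s (suc v) (head (s v))))
      s₃v : s₃ v ≡ tail (tail (s v))
      s₃v = trans (update-same s₂ v (tail (tail (s₂ v)))) (cong (tail ∘ tail) s₂v)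
      s₃″ : s₃ (suc (suc v)) ≡ head (tail (s v))
      s₃″ = trans (update-other s₂ v (tail (tail (s₂ v))) (<⇒≢ (m<n⇒m<1+n (n<1+n v))))
        (trans (update-same s₁ (suc (suc v)) (head (tail (s₁ v)))) (cong (head ∘ tail) s₁v))
      below : ∀ y → y < v → s₃ y ≡ s y
      below y y<v = trans (update-above s₂ v (tail (tail (s₂ v))) y<v)
        (trans (update-above s₁ (suc (suc v)) (head (tail (s₁ v))) (m<n⇒m<1+n (m<n⇒m<1+n y<v)))
            (update-above s (suc v) (head (s v)) (m<n⇒m<1+n y<v)))
      s₄ s₅ : Store
      s₄ = s₃ [ v ↦ s₃ (suc (suc v)) ]
      s₅ = s₄ [ suc v ↦ nil ]
      finish : ∀ c → s v ≡ code (bool ⊠ a ⊠ a) (c , x , y) → Halts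
        (suc v ≔ hd (var v) ⨟ suc (suc v) ≔ hd (tl (var v)) ⨟ v ≔ tl (tl (var v)) ⨟ while (var (suc v))
            (v ≔ var (suc (suc v)) ⨟ suc v ≔ nil))
        v s (ev [ 19 ] (weight (code (bool ⊠ a ⊠ a) (c , x , y)))) (code a (if c then x else y))
      finish false eq = s₃ , 13 , seq assign (seq assign (seq assign (stop (trans flag (cong head eq))))) ,
        ≤-trans (m≤m+n 13 6) (≤-reflexive (sym (const-eval 19 _))) , trans s₃v (cong (tail ∘ tail) eq) , below
      finish true eq = s₅ , 19 , seq assign (seq assign (seq assign
          (loop {s′ = s₅} (λ e → case (trans (sym e) (trans flag (cong head eq)))) (seq assign assign)
              (stop (update-same s₄ (suc v) nil))))) ,
        ≤-reflexive (sym (const-eval 19 _)) ,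
        trans (update-above s₄ (suc v) nil (n<1+n v)) (trans (update-same s₃ v (s₃ (suc (suc v))))
            (trans s₃″ (cong (head ∘ tail) eq))) ,
        λ y y<v → trans (update-above s₄ (suc v) nil (m<n⇒m<1+n y<v))
            (trans (update-above s₃ v (s₃ (suc (suc v))) y<v) (below y y<v))
        where
        case : ∀ {A : Set} → _≡_ {A = Tree} nil (cons nil nil) → A
        case ()

  iterate : {step : (El a × El b) × El c → El b} → Feasible ((a ⊠ b) ⊠ c) b step →
    (q : Polynomial) → (∀ e y x → weight (code b (step ((e , y) , x))) ≤ weight (code b y) + ev q
        (weight (code a e) + weight (code c x))) →
    Feasible ((a ⊠ b) ⊠ list c) b (λ ((e , y) , xs) → foldl (λ y x → step ((e , y) , x)) y xs)
  iterate {a} {b} {c} {step} F q grows = record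
    { program = whole
    ; time = [ 11 ] ⊕ (0 ∷ iteration) ; growth = linear 0 ⊕ (0 ∷ q)
    ; runs = runs′
    ; output≤ = output≤′ }
    where
    module F = Feasible F
    body : ℕ → Command
    body v = suc (suc v) ≔ cons (var v) (hd (var (suc v))) ⨟ F.program (suc (suc v)) ⨟
      v ≔ cons (hd (var v)) (var (suc (suc v))) ⨟ suc v ≔ tl (var (suc v))
    inner iteration : Polynomial
    inner     = linear 2 ⊕ (linear 0 ⊕ (0 ∷ q))
    iteration = [ 15 ] ⊕ F.time ⊚ inner

    fold : El a → El b → List (El c) → El b
    fold e y xs = foldl (λ y x → step ((e , y) , x)) y xs

    length≤ : ∀ xs → length xs ≤ weight (code (list c) xs)
    length≤ []       = z≤n
    length≤ (x ∷ xs) = s≤s (≤-trans (length≤ xs) (m≤n+m _ (weight (code c x))))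

    module _ (S : ℕ) where
      Q A I : ℕ
      Q = ev q S
      A = S + S * Q
      I = ev F.time (2 + (S + A))

      fold-weight : ∀ e y xs → weight (code a e) + weight (code (list c) xs) ≤ S →
        weight (code b (fold e y xs)) ≤ weight (code b y) + length xs * Q
      fold-weight e y []       _ = m≤m+n _ 0
      fold-weight e y (x ∷ xs) h = ≤-trans
        (fold-weight e (step ((e , y) , x)) xs (≤-trans (+-monoʳ-≤ (weight (code a e))
            (m≤n⇒m≤1+n (m≤n+m _ (weight (code c x))))) h))
        (≤-trans (+-monoˡ-≤ (length xs * Q) (step-weight e y x
            (≤-trans (+-monoʳ-≤ (weight (code a e)) (m≤n⇒m≤1+n (m≤m+n (weight (code c x)) _))) h)))
          (≤-reflexive (+-assoc (weight (code b y)) Q (length xs * Q))))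
        where
        step-weight : ∀ e y x → weight (code a e) + weight (code c x) ≤ S → weight (code b (step ((e , y) , x))) ≤
            weight (code b y) + Q
        step-weight e y x h = ≤-trans (grows e y x) (+-monoʳ-≤ (weight (code b y)) (ev-mono q h))

      while-runs : ∀ v s e y xs → s v ≡ cons (code a e) (code b y) → s (suc v) ≡ code (list c) xs →
        weight (code a e) + weight (code (list c) xs) ≤ S → weight (code b y) + length xs * Q ≤ A →
        Halts (while (var (suc v)) (body v)) v s (2 + length xs * (15 + I)) (cons (code a e) (code b (fold e y xs)))
      while-runs v s e y [] eq eqs _ _ = s , _ , stop eqs , ≤-refl , eq , λ _ _ → refl
      while-runs v s e y (x ∷ xs) eq eqs h hA
        with F.runs (suc (suc v)) (s [ suc (suc v) ↦ cons (s v) (head (s (suc v))) ]) ((e , y) , x)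
               (trans (update-same s (suc (suc v)) (cons (s v) (head (s (suc v))))) (cong₂ cons eq (cong head eqs)))
      ... | s₁ , t₁ , r₁ , t₁≤ , out₁ , below₁ = result
        where
        s₂ s₃ : Store
        s₂ = s₁ [ v ↦ cons (head (s₁ v)) (s₁ (suc (suc v))) ]
        s₃ = s₂ [ suc v ↦ tail (s₂ (suc v)) ]
        d₀ d₁ : Tree
        d₀ = cons (s v) (head (s (suc v)))
        d₁ = cons (head (s₁ v)) (s₁ (suc (suc v)))
        s₁v : s₁ v ≡ s v
        s₁v = trans (below₁ v (m<n⇒m<1+n (n<1+n v))) (update-above s (suc (suc v)) d₀ (m<n⇒m<1+n (n<1+n v)))
        s₁v′ : s₁ (suc v) ≡ s (suc v)
        s₁v′ = trans (below₁ (suc v) (n<1+n (suc v))) (update-above s (suc (suc v)) d₀ (n<1+n (suc v)))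
        s₃v : s₃ v ≡ cons (code a e) (code b (step ((e , y) , x)))
        s₃v = trans (update-above s₂ (suc v) (tail (s₂ (suc v))) (n<1+n v))
          (trans (update-same s₁ v d₁) (cong₂ cons (cong head (trans s₁v eq)) out₁))
        s₃v′ : s₃ (suc v) ≡ code (list c) xs
        s₃v′ = trans (update-same s₂ (suc v) (tail (s₂ (suc v))))
            (cong tail (trans (update-other s₁ v d₁ (1+n≢n ∘ sym)) (trans s₁v′ eqs)))
        below₃ : ∀ y → y < v → s₃ y ≡ s y
        below₃ y y<v = trans (update-above s₂ (suc v) (tail (s₂ (suc v))) (m<n⇒m<1+n y<v)) (trans (update-above s₁ v d₁ y<v)
          (trans (below₁ y (m<n⇒m<1+n (m<n⇒m<1+n y<v))) (update-above s (suc (suc v)) d₀ (m<n⇒m<1+n (m<n⇒m<1+n y<v)))))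
        hx : weight (code a e) + weight (code c x) ≤ S
        hx = ≤-trans (+-monoʳ-≤ (weight (code a e)) (m≤n⇒m≤1+n (m≤m+n (weight (code c x)) _))) h
        hxs : weight (code a e) + weight (code (list c) xs) ≤ S
        hxs = ≤-trans (+-monoʳ-≤ (weight (code a e)) (m≤n⇒m≤1+n (m≤n+m _ (weight (code c x))))) h
        hA′ : weight (code b (step ((e , y) , x))) + length xs * Q ≤ A
        hA′ = ≤-trans (+-monoˡ-≤ (length xs * Q) (≤-trans (grows e y x) (+-monoʳ-≤ (weight (code b y)) (ev-mono q hx))))
          (≤-trans (≤-reflexive (+-assoc (weight (code b y)) Q (length xs * Q))) hA)
        t₁≤I : t₁ ≤ I
        t₁≤I = ≤-trans t₁≤ (ev-mono F.time (s≤s (s≤s (begin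
          weight (code a e) + weight (code b y) + weight (code c x)   ≡⟨ +-assoc (weight (code a e)) _ _ ⟩
          weight (code a e) + (weight (code b y) + weight (code c x))
              ≡⟨ cong (weight (code a e) +_) (+-comm (weight (code b y)) _) ⟩
          weight (code a e) + (weight (code c x) + weight (code b y)) ≡⟨ +-assoc (weight (code a e)) _ _ ⟨
          weight (code a e) + weight (code c x) + weight (code b y)   ≤⟨ +-mono-≤ hx (≤-trans (m≤m+n _ _) hA) ⟩
          S + A ∎))))
          where
          open ≤-Reasoning
        running : s (suc v) ≢ nil
        running e with trans (sym e) eqs
        ... | ()
        result : Halts (while (var (suc v)) (body v)) v s (2 + length (x ∷ xs) * (15 + I))
            (cons (code a e) (code b (fold e y (x ∷ xs))))
        result with while-runs v s₃ e (step ((e , y) , x)) xs s₃v s₃v′ hxs hA′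
        ... | s₄ , t₄ , r₄ , t₄≤ , out₄ , below₄ = s₄ , 2 + (5 + (t₁ + 8)) + t₄ ,
          loop running (seq assign (seq r₁ (seq assign assign))) r₄ ,
          ≤-trans (+-mono-≤ (+-monoʳ-≤ 2 (+-monoʳ-≤ 5 (+-monoˡ-≤ 8 t₁≤I))) t₄≤)
            (≤-reflexive (arith I (length xs * (15 + I)))) ,
          out₄ , λ y y<v → trans (below₄ y y<v) (below₃ y y<v)
          where
          arith : ∀ i r → 2 + (5 + (i + 8)) + (2 + r) ≡ 2 + (15 + i + r)
          arith i r = solve 2 (λ i r → con 2 :+ (con 5 :+ (i :+ con 8)) :+ (con 2 :+ r) := con 2 :+
              (con 15 :+ i :+ r)) refl i r

    module _ (e : El a) (y : El b) (xs : List (El c)) where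
      S : ℕ
      S = suc (suc (weight (code a e) + weight (code b y)) + weight (code (list c) xs))

      e+xs≤S : weight (code a e) + weight (code (list c) xs) ≤ S
      e+xs≤S = m≤n⇒m≤1+n (+-monoˡ-≤ (weight (code (list c) xs)) (m≤n⇒m≤1+n (m≤m+n (weight (code a e)) _)))

      y≤S : weight (code b y) ≤ S
      y≤S = m≤n⇒m≤1+n (≤-trans (m≤n⇒m≤1+n (m≤n+m (weight (code b y)) (weight (code a e)))) (m≤m+n _ _))

      xs≤S : length xs ≤ S
      xs≤S = ≤-trans (length≤ xs) (m≤n⇒m≤1+n (m≤n+m _ _))

      output≤′′ : weight (code b (fold e y xs)) ≤ S + S * ev q S
      output≤′′ = ≤-trans (fold-weight S e y xs e+xs≤S) (+-mono-≤ y≤S (*-monoˡ-≤ (ev q S) xs≤S))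

    A-eval : ∀ S → ev (linear 0 ⊕ (0 ∷ q)) S ≡ S + S * ev q S
    A-eval S = trans (⊕-eval (linear 0) (0 ∷ q) S) (cong₂ _+_ (linear-eval 0 S) (shift-eval q S))

    iteration-eval : ∀ S → ev iteration S ≡ 15 + I S
    iteration-eval S = trans (⊕-eval [ 15 ] (F.time ⊚ inner) S) (cong₂ _+_ (const-eval 15 S)
      (trans (⊚-eval F.time inner S) (cong (ev F.time) (trans (⊕-eval (linear 2) _ S)
          (cong₂ _+_ (linear-eval 2 S) (A-eval S))))))

    output≤′ : ∀ x → weight (code b (fold (proj₁ (proj₁ x)) (proj₂ (proj₁ x)) (proj₂ x))) ≤ ev (linear 0 ⊕ (0 ∷ q))
        (weight (code ((a ⊠ b) ⊠ list c) x))
    output≤′ ((e , y) , xs) = ≤-trans (output≤′′ e y xs) (≤-reflexive (sym (A-eval (S e y xs))))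

    whole : ℕ → Command
    whole v = suc v ≔ tl (var v) ⨟ v ≔ hd (var v) ⨟ while (var (suc v)) (body v) ⨟ v ≔ tl (var v)

    runs′ : ∀ v s x → s v ≡ code ((a ⊠ b) ⊠ list c) x →
      Halts (whole v) v s (ev ([ 11 ] ⊕ (0 ∷ iteration)) (weight (code ((a ⊠ b) ⊠ list c) x)))
          (code b (fold (proj₁ (proj₁ x)) (proj₂ (proj₁ x)) (proj₂ x)))
    runs′ v s ((e , y) , xs) eq = result
      where
      s₁ s₂ : Store
      s₁ = s [ suc v ↦ tail (s v) ]
      s₂ = s₁ [ v ↦ head (s₁ v) ]
      N : ℕ
      N = S e y xs
      s₂v : s₂ v ≡ cons (code a e) (code b y)
      s₂v = trans (update-same s₁ v (head (s₁ v))) (cong head (trans (update-above s (suc v) (tail (s v)) (n<1+n v)) eq))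
      s₂v′ : s₂ (suc v) ≡ code (list c) xs
      s₂v′ = trans (update-other s₁ v (head (s₁ v)) (1+n≢n ∘ sym))
          (trans (update-same s (suc v) (tail (s v))) (cong tail eq))
      result : Halts (whole v) v s (ev ([ 11 ] ⊕ (0 ∷ iteration)) N) (code b (fold e y xs))
      result with while-runs N v s₂ e y xs s₂v s₂v′ (e+xs≤S e y xs)
          (+-mono-≤ (y≤S e y xs) (*-monoˡ-≤ (ev q N) (xs≤S e y xs)))
      ... | s₃ , t₃ , r₃ , t₃≤ , out₃ , below₃ = s₃ [ v ↦ tail (s₃ v) ] , 3 + (3 + (t₃ + 3)) , seq assign
          (seq assign (seq r₃ assign)) ,
        ≤-trans (+-monoʳ-≤ 3 (+-monoʳ-≤ 3 (+-monoˡ-≤ 3 (≤-trans t₃≤ (+-monoʳ-≤ 2 (*-monoˡ-≤ (15 + I N) (xs≤S e y xs)))))))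
          (≤-reflexive (trans (arith (N * (15 + I N))) (sym (trans (⊕-eval [ 11 ] (0 ∷ iteration) N)
            (cong₂ _+_ (const-eval 11 N) (trans (shift-eval iteration N) (cong (N *_) (iteration-eval N)))))))) ,
        trans (update-same s₃ v (tail (s₃ v))) (cong tail out₃) ,
        λ y y<v → trans (update-above s₃ v (tail (s₃ v)) y<v) (trans (below₃ y y<v)
          (trans (update-above s₁ v (head (s₁ v)) y<v) (update-above s (suc v) (tail (s v)) (m<n⇒m<1+n y<v))))
        where
        arith : ∀ r → 3 + (3 + (2 + r + 3)) ≡ 11 + r
        arith r = cong (8 +_) (+-comm r 3)

module _ where

  private variable
    a b c d e : Ty
    A B C D : Set

  if-cond : {p : El a → Bool} {f g : El a → El b} → Feasible a bool p → Feasible a b f → Feasible a b g →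
    Feasible a b (λ x → if p x then f x else g x)
  if-cond P F G = choose ∙ ⟨ P , ⟨ F , G ⟩ ⟩

  negation : {p : El a → Bool} → Feasible a bool p → Feasible a bool (not ∘ p)
  negation {p = p} P = feasible-cong eq (if-cond P (constant false) (constant true))
    where
    eq : ∀ x → (if p x then false else true) ≡ not (p x)
    eq x with p x
    ... | true  = refl
    ... | false = refl

  disjunction : {p q : El a → Bool} → Feasible a bool p → Feasible a bool q → Feasible a bool (λ x → p x ∨ q x)
  disjunction {p = p} {q} P Q = feasible-cong eq (if-cond P (constant true) Q)
    where
    eq : ∀ x → (if p x then true else q x) ≡ p x ∨ q x
    eq x with p x
    ... | true  = refl
    ... | false = refl

  conjunction : {p q : El a → Bool} → Feasible a bool p → Feasible a bool q → Feasible a bool (λ x → p x ∧ q x)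
  conjunction {p = p} {q} P Q = feasible-cong eq (if-cond P Q (constant false))
    where
    eq : ∀ x → (if p x then q x else false) ≡ p x ∧ q x
    eq x with p x
    ... | true  = refl
    ... | false = refl

  fold : {xs : El a → List (El c)} {y : El a → El b} {step : (El a × El b) × El c → El b} →
    Feasible ((a ⊠ b) ⊠ c) b step → Feasible a b y → Feasible a (list c) xs →
    (q : Polynomial) → (∀ e y x → weight (code b (step ((e , y) , x))) ≤ weight (code b y) + ev q
        (weight (code a e) + weight (code c x))) →
    Feasible a b (λ e → foldl (λ y x → step ((e , y) , x)) (y e) (xs e))
  fold F Y₀ XS q grows = iterate F q grows ∙ ⟨ ⟨ identity , Y₀ ⟩ , XS ⟩

  weight-bool : ∀ b → weight (code bool b) ≤ 3
  weight-bool true  = ≤-refl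
  weight-bool false = s≤s z≤n

  bool-grows : ∀ b {m x} → weight (code bool b) ≤ m + ev [ 3 ] x
  bool-grows b {m} {x} = ≤-trans (weight-bool b) (≤-trans (m≤n+m 3 m) (≤-reflexive (cong (m +_) (sym (const-eval 3 x)))))

  null-test : {xs : El a → List (El b)} → Feasible a (list b) xs → Feasible a bool (null ∘ xs)
  null-test {xs = xs} XS = feasible-cong (λ e → eq (xs e)) (fold (constant false) (constant true) XS [ 3 ]
      (λ _ _ _ → bool-grows false))
    where
    stays : ∀ (xs : List A) → foldl (λ _ _ → false) false xs ≡ false
    stays []       = refl
    stays (x ∷ xs) = stays xs
    eq : ∀ (xs : List A) → foldl (λ _ _ → false) true xs ≡ null xs
    eq []       = refl
    eq (x ∷ xs) = stays xs

  push-grows : ∀ (y : El a) (ys : List (El a)) m p x → weight (code a y) ≤ ev p x →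
    weight (code (list a) ys) ≤ m → weight (code (list a) (y ∷ ys)) ≤ m + ev ([ 1 ] ⊕ p) x
  push-grows {a} y ys m p x y≤ ys≤ = begin
    suc (weight (code a y) + weight (code (list a) ys)) ≤⟨ s≤s (+-mono-≤ y≤ ys≤) ⟩
    suc (ev p x + m)                                     ≡⟨ +-comm (suc (ev p x)) m ⟩
    m + suc (ev p x)                                     ≡⟨ cong (m +_)
        (trans (⊕-eval [ 1 ] p x) (cong (_+ ev p x) (const-eval 1 x))) ⟨
    m + ev ([ 1 ] ⊕ p) x                                 ∎
    where open ≤-Reasoning

  reversal : Feasible (list a) (list a) reverse
  reversal {a} = iterate (prepend ∙ ⟨ second , second ∙ first′ ⟩) ([ 1 ] ⊕ linear 0)
      (λ _ ys x → push-grows x ys _ (linear 0) _ (≤-trans (n≤1+n _) (≤-reflexive (sym (linear-eval 0 _)))) ≤-refl)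
    ∙ ⟨ ⟨ constant {b = unit} tt , constant [] ⟩ , identity ⟩

  foldl-push : ∀ (f : A → B) ys xs → foldl (λ ys x → f x ∷ ys) ys xs ≡ reverseAcc ys (map f xs)
  foldl-push f ys []       = refl
  foldl-push f ys (x ∷ xs) = foldl-push f (f x ∷ ys) xs

  mapping : {xs : El a → List (El b)} {f : El a × El b → El c} → Feasible (a ⊠ b) c f → Feasible a (list b) xs →
    Feasible a (list c) (λ e → map (λ x → f (e , x)) (xs e))
  mapping {a} {b} {c} {xs} {f} F XS = feasible-cong eq (reversal ∙
      fold (prepend ∙ ⟨ F ∙ ⟨ first′ ∙ first′ , second ⟩ , second ∙ first′ ⟩) (constant []) XS ([ 1 ] ⊕ growth F ⊚ linear 1)
        (λ e ys x → push-grows (f (e , x)) ys _ (growth F ⊚ linear 1) _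
          (≤-trans (output≤ F (e , x)) (≤-reflexive (sym (trans (⊚-eval (growth F) (linear 1) _)
              (cong (ev (growth F)) (linear-eval 1 _)))))) ≤-refl))
    where
    eq : ∀ e → reverse (foldl (λ ys x → f (e , x) ∷ ys) [] (xs e)) ≡ map (λ x → f (e , x)) (xs e)
    eq e = trans (cong reverse (foldl-push (λ x → f (e , x)) [] (xs e))) (reverse-involutive _)

  universal : {xs : El a → List (El b)} {p : El a × El b → Bool} → Feasible (a ⊠ b) bool p → Feasible a (list b) xs →
    Feasible a bool (λ e → all (λ x → p (e , x)) (xs e))
  universal {xs = xs} {p} P XS = feasible-cong (λ e → eq (λ x → p (e , x)) true (xs e))
      (fold (conjunction (second ∙ first′) (P ∙ ⟨ first′ ∙ first′ , second ⟩)) (constant true) XS [ 3 ]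
          (λ _ _ _ → bool-grows _))
    where
    eq : ∀ (p : A → Bool) c xs → foldl (λ c x → c ∧ p x) c xs ≡ c ∧ all p xs
    eq p c []       = sym (∧-identityʳ c)
    eq p c (x ∷ xs) = trans (eq p (c ∧ p x) xs) (∧-assoc c (p x) (all p xs))

  marked : List (Bool × A) → List A
  marked []               = []
  marked ((true  , x) ∷ xs) = x ∷ marked xs
  marked ((false , x) ∷ xs) = marked xs

  extraction : Feasible (list (bool ⊠ a)) (list a) marked
  extraction {a} = feasible-cong (λ xs → trans (cong reverse (eq [] xs)) (reverse-involutive (marked xs)))
      (reversal ∙ iterate step ([ 1 ] ⊕ linear 0) (λ { _ ys (f , x) → grows f x ys })
        ∙ ⟨ ⟨ constant {b = unit} tt , constant [] ⟩ , identity ⟩)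
    where
    put : Bool → El a → List (El a) → List (El a)
    put f x ys = if f then x ∷ ys else ys
    step : Feasible ((unit ⊠ list a) ⊠ bool ⊠ a) (list a) (λ ((_ , ys) , f , x) → put f x ys)
    step = if-cond (first′ ∙ second) (prepend ∙ ⟨ second ∙ second , second ∙ first′ ⟩) (second ∙ first′)
    grows : ∀ f x ys → weight (code (list a) (put f x ys)) ≤ weight (code (list a) ys) + ev ([ 1 ] ⊕ linear 0)
        (1 + weight (code (bool ⊠ a) (f , x)))
    grows true x ys = push-grows x ys _ (linear 0) _ (≤-trans (≤-trans (m≤n+m _ 3) (m≤n+m _ 2))
        (≤-reflexive (sym (linear-eval 0 _)))) ≤-refl
    grows false x ys = m≤m+n _ _
    eq : ∀ ys xs → foldl (λ ys (f , x) → put f x ys) ys xs ≡ reverseAcc ys (marked xs)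
    eq ys []               = refl
    eq ys ((true  , x) ∷ xs) = eq (x ∷ ys) xs
    eq ys ((false , x) ∷ xs) = eq ys xs

  trues : List Bool → List Bool
  trues r = marked (map (λ b → b , b) r)

  true-entries : {r : El a → List Bool} → Feasible a (list bool) r → Feasible a (list bool) (trues ∘ r)
  true-entries R = extraction ∙ mapping ⟨ second , second ⟩ R

  weight-tail : ∀ (xs : List (El a)) → weight (code (list a) (tailˡ xs)) ≤ weight (code (list a) xs)
  weight-tail []           = ≤-refl
  weight-tail {a} (x ∷ xs) = m≤n⇒m≤1+n (m≤n+m _ (weight (code a x)))

  weight-drop : ∀ m (xs : List (El a)) → weight (code (list a) (drop m xs)) ≤ weight (code (list a) xs)
  weight-drop zero    xs       = ≤-refl
  weight-drop (suc m) []       = ≤-refl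
  weight-drop {a} (suc m) (x ∷ xs) = ≤-trans (weight-drop m xs) (weight-tail {a} (x ∷ xs))

  dropping : {xs : El a → List (El b)} {ys : El a → List (El c)} → Feasible a (list b) xs → Feasible a (list c) ys →
    Feasible a (list b) (λ e → drop (length (ys e)) (xs e))
  dropping {b = b} {xs = xs} {ys} XS YS = feasible-cong (λ e → eq (xs e) (ys e))
      (fold (drop-first ∙ second ∙ first′) XS YS [] (λ _ xs _ → ≤-trans (weight-tail {b} xs) (m≤m+n _ _)))
    where
    eq : ∀ (xs : List A) (ys : List B) → foldl (λ xs _ → tailˡ xs) xs ys ≡ drop (length ys) xs
    eq xs       []       = refl
    eq []       (y ∷ ys) = trans (eq [] ys) (lemma (length ys))
      where
      lemma : ∀ m → drop m [] ≡ []
      lemma zero    = refl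
      lemma (suc m) = refl
    eq (x ∷ xs) (y ∷ ys) = eq xs ys

  null-drop : ∀ m (xs : List A) → null (drop m xs) ≡ (length xs ≤ᵇ m)
  null-drop zero    []       = refl
  null-drop zero    (x ∷ xs) = refl
  null-drop (suc m) []       = refl
  null-drop (suc m) (x ∷ xs) = trans (null-drop m xs) (step (length xs) m)
    where
    step : ∀ l m → (l ≤ᵇ m) ≡ (suc l ≤ᵇ suc m)
    step zero    m = refl
    step (suc l) m = refl

  comparison : {xs : El a → List (El b)} {ys : El a → List (El c)} → Feasible a (list b) xs → Feasible a (list c) ys →
    Feasible a bool (λ e → length (xs e) ≤ᵇ length (ys e))
  comparison {xs = xs} {ys} XS YS = feasible-cong (λ e → null-drop (length (ys e)) (xs e)) (null-test (dropping XS YS))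

  square-comparison : {xs : El a → List (El b)} {ys : El a → List (El c)} → Feasible a (list b) xs → Feasible a (list c) ys →
    Feasible a bool (λ e → length (xs e) ≤ᵇ length (ys e) * length (ys e))
  square-comparison {a} {b} {c} {xs} {ys} XS YS = feasible-cong eq
      (null-test (fold (dropping (second ∙ first′) (YS ∙ first′ ∙ first′)) XS YS []
        (λ e zs _ → ≤-trans (weight-drop {b} (length (ys e)) zs) (m≤m+n _ _))))
    where
    drops : ∀ m (xs : List A) (ys : List B) → foldl (λ xs _ → drop m xs) xs ys ≡ drop (length ys * m) xs
    drops m xs []       = refl
    drops m xs (y ∷ ys) = trans (drops m (drop m xs) ys) (drop-drop m (length ys * m) xs)
    eq : ∀ e → null (foldl (λ zs _ → drop (length (ys e)) zs) (xs e) (ys e)) ≡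
        (length (xs e) ≤ᵇ length (ys e) * length (ys e))
    eq e = trans (cong null (drops (length (ys e)) (xs e) (ys e))) (null-drop _ (xs e))

  pairUp : B → List A → List B → List (A × B)
  pairUp d []       ys = []
  pairUp d (x ∷ xs) ys = (x , headOr d ys) ∷ pairUp d xs (tailˡ ys)

  pairing : {xs : El a → List (El b)} {ys : El a → List (El c)} (d : El c) → code c d ≡ nil →
    Feasible a (list b) xs → Feasible a (list c) ys → Feasible a (list (b ⊠ c)) (λ e → pairUp d (xs e) (ys e))
  pairing {a} {b} {c} {xs} {ys} d d≡nil XS YS = feasible-cong
      (λ e → trans (cong reverse (eq (ys e) [] (xs e))) (reverse-involutive _))
      (reversal ∙ second ∙ iterate step (linear 4) (λ { _ (zs , out) x → grows zs out x })
        ∙ ⟨ ⟨ constant {b = unit} tt , ⟨ YS , constant [] ⟩ ⟩ , XS ⟩)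
    where
    put : List (El c) × List (El b × El c) → El b → List (El c) × List (El b × El c)
    put (zs , out) x = tailˡ zs , (x , headOr d zs) ∷ out
    step : Feasible ((unit ⊠ list c ⊠ list (b ⊠ c)) ⊠ b) (list c ⊠ list (b ⊠ c)) (λ ((_ , y) , x) → put y x)
    step = ⟨ drop-first ∙ first′ ∙ second ∙ first′
           , prepend ∙ ⟨ ⟨ second , head-or d d≡nil ∙ first′ ∙ second ∙ first′ ⟩ , second ∙ second ∙ first′ ⟩ ⟩
    uncons : ∀ zs → weight (code (list c) (tailˡ zs)) + weight (code c (headOr d zs)) ≤ suc (weight (code (list c) zs))
    uncons []       rewrite d≡nil = ≤-refl
    uncons (z ∷ zs) = ≤-trans (≤-reflexive (+-comm _ (weight (code c z)))) (≤-trans (n≤1+n _) (n≤1+n _))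
    grows : ∀ zs out x → weight (code (list c ⊠ list (b ⊠ c)) (put (zs , out) x)) ≤
      weight (code (list c ⊠ list (b ⊠ c)) (zs , out)) + ev (linear 4) (1 + weight (code b x))
    grows zs out x = begin
      suc (t + suc (suc (u + h) + o))  ≡⟨ solve 4 (λ t u h o → con 1 :+ (t :+ (con 1 :+ (con 1 :+ (u :+ h) :+ o))) :=
          con 3 :+ (t :+ h) :+ (o :+ u)) refl t u h o ⟩
      3 + (t + h) + (o + u)            ≤⟨ +-monoˡ-≤ (o + u) (+-monoʳ-≤ 3 (uncons zs)) ⟩
      3 + suc z + (o + u)              ≡⟨ solve 3 (λ z o u → con 3 :+ (con 1 :+ z) :+ (o :+ u) := con 1 :+ (z :+ o) :+
          (con 3 :+ u)) refl z o u ⟩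
      suc (z + o) + (3 + u)            ≤⟨ +-monoʳ-≤ (suc (z + o)) (m≤n+m (3 + u) 2) ⟩
      suc (z + o) + (4 + suc u)        ≡⟨ cong (suc (z + o) +_) (linear-eval 4 (suc u)) ⟨
      suc (z + o) + ev (linear 4) (suc u) ∎
      where
      open ≤-Reasoning
      t u h o z : ℕ
      t = weight (code (list c) (tailˡ zs))
      u = weight (code b x)
      h = weight (code c (headOr d zs))
      o = weight (code (list (b ⊠ c)) out)
      z = weight (code (list c) zs)
    eq : ∀ zs out xs → proj₂ (foldl put (zs , out) xs) ≡ reverseAcc out (pairUp d xs zs)
    eq zs out []       = refl
    eq zs out (x ∷ xs) = eq (tailˡ zs) ((x , headOr d zs) ∷ out) xs

  firstTrues : List ⊤ → List Bool → List Bool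
  firstTrues q []           = []
  firstTrues q (false ∷ bs) = false ∷ firstTrues q bs
  firstTrues q (true  ∷ bs) = not (null q) ∷ firstTrues (tailˡ q) bs

  first-trues : {q : El a → List ⊤} {bs : El a → List Bool} → Feasible a (list unit) q → Feasible a (list bool) bs →
    Feasible a (list bool) (λ e → firstTrues (q e) (bs e))
  first-trues {a} {q} {bs} Q BS = feasible-cong (λ e → trans (cong reverse (eq (q e) [] (bs e))) (reverse-involutive _))
      (reversal ∙ second ∙ iterate step [ 4 ] (λ { _ (zs , out) x → grows zs out x })
        ∙ ⟨ ⟨ constant {b = unit} tt , ⟨ Q , constant [] ⟩ ⟩ , BS ⟩)
    where
    put : List ⊤ × List Bool → Bool → List ⊤ × List Bool
    put (q , out) x = (if x then tailˡ q else q) , (x ∧ not (null q)) ∷ out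
    step : Feasible ((unit ⊠ list unit ⊠ list bool) ⊠ bool) (list unit ⊠ list bool) (λ ((_ , y) , x) → put y x)
    step = ⟨ if-cond second (drop-first ∙ first′ ∙ second ∙ first′) (first′ ∙ second ∙ first′)
           , prepend ∙ ⟨ conjunction second (negation (null-test (first′ ∙ second ∙ first′))) , second ∙ second ∙ first′ ⟩ ⟩
    tail≤ : ∀ q x → weight (code (list unit) (if x then tailˡ q else q)) ≤ weight (code (list unit) q)
    tail≤ q true  = weight-tail {unit} q
    tail≤ q false = ≤-refl
    grows : ∀ zs out x → weight (code (list unit ⊠ list bool) (put (zs , out) x)) ≤
      weight (code (list unit ⊠ list bool) (zs , out)) + ev [ 4 ] (1 + weight (code bool x))
    grows zs out x = ≤-trans
      (s≤s (+-mono-≤ (tail≤ zs x) (s≤s (+-monoˡ-≤ (weight (code (list bool) out)) (weight-bool (x ∧ not (null zs)))))))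
      (≤-reflexive (trans (arith (weight (code (list unit) zs)) (weight (code (list bool) out)))
          (cong (suc (weight (code (list unit) zs) + weight (code (list bool) out)) +_)
          (sym (const-eval 4 (1 + weight (code bool x)))))))
      where
      arith : ∀ z o → suc (z + (4 + o)) ≡ suc (z + o) + 4
      arith z o = cong suc (trans (cong (z +_) (+-comm 4 o)) (sym (+-assoc z o 4)))
    eq : ∀ q out bs → proj₂ (foldl put (q , out) bs) ≡ reverseAcc out (firstTrues q bs)
    eq q out []           = refl
    eq q out (false ∷ bs) = eq q (false ∷ out) bs
    eq q out (true  ∷ bs) = eq (tailˡ q) (not (null q) ∷ out) bs

module _ where

  -- Numbers are represented by lists of units.
  Matrix Row Input : Ty
  Row    = list bool
  Matrix = list Row
  Input  = Matrix ⊠ list unit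

  input : Instance → El Input
  input (G , k) = map toList (toList (matrix G)) , replicate k tt


  subsetOf : List Bool → List Bool → Bool
  subsetOf p q = all (λ (x , y) → not x ∨ y) (pairUp false p q)

  highs lows fills keeps : El Input → List Bool
  highs (M , k) = map (λ r → length k ≤ᵇ length (trues r)) M
  lows γ@(M , k) = map (λ (h , r) → not h ∧ subsetOf r (highs γ)) (pairUp [] (highs γ) M)
  fills γ@(M , k) = firstTrues (if null (trues (highs γ)) then [] else tailˡ k) (lows γ)
  keeps γ = map (λ (l , f) → not l ∨ f) (pairUp false (lows γ) (fills γ))

  newRowOf : El Input → (Bool × Bool) × List Bool → List Bool
  newRowOf γ ((h , f) , r) =
    if f then highs γ else (if h then map (λ (x , y) → x ∨ y) (pairUp false r (fills γ)) else r)

  newRows reducedRows : El Input → List (List Bool)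
  newRows γ@(M , k) = map (newRowOf γ) (pairUp [] (pairUp false (highs γ) (fills γ)) M)
  reducedRows γ = map (λ r → marked (pairUp false (keeps γ) r)) (marked (pairUp [] (keeps γ) (newRows γ)))

  smallCover : El Input × List Bool → Bool
  smallCover ((M , k) , C) =
    (length (trues C) ≤ᵇ length k) ∧ all (λ (c , r) → c ∨ subsetOf r C) (pairUp [] C M)

  K₂-rows : List (List Bool)
  K₂-rows = (false ∷ true ∷ []) ∷ (true ∷ false ∷ []) ∷ []

  reduceList : El Input → El Input
  reduceList γ@(M , k) =
    if length M ≤ᵇ length k * length k then γ else
    if smallCover (γ , highs γ) ∨ not (all (λ r → not (smallCover (γ , r))) M) then ([] , []) else
    if (length k ≤ᵇ length (trues (highs γ))) ∨ not (length (trues (keeps γ)) ≤ᵇ length k * length k) then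
        (K₂-rows , []) else
    (reducedRows γ , k)

  private variable
    a : Ty

  -- Opaque because the programs, which recompute shared values, are huge.
  opaque
    subset-test : {p q : El a → List Bool} → Feasible a Row p → Feasible a Row q → Feasible a bool
        (λ x → subsetOf (p x) (q x))
    subset-test P Q = universal (disjunction (negation (first′ ∙ second)) (second ∙ second)) (pairing false refl P Q)

    highs-feasible : Feasible Input Row highs
    highs-feasible = mapping (comparison (second ∙ first′) (true-entries second)) first′

    lows-feasible : Feasible Input Row lows
    lows-feasible = mapping (conjunction (negation (first′ ∙ second))
        (subset-test (second ∙ second) (highs-feasible ∙ first′)))
      (pairing [] refl highs-feasible first′)

    fills-feasible : Feasible Input Row fills
    fills-feasible = first-trues (if-cond (null-test (true-entries highs-feasible)) (constant [])
        (drop-first ∙ second)) lows-feasible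

    keeps-feasible : Feasible Input Row keeps
    keeps-feasible = mapping (disjunction (negation (first′ ∙ second)) (second ∙ second))
        (pairing false refl lows-feasible fills-feasible)

    newRowOf-feasible : Feasible (Input ⊠ ((bool ⊠ bool) ⊠ Row)) Row (λ (γ , x) → newRowOf γ x)
    newRowOf-feasible = if-cond (second ∙ first′ ∙ second) (highs-feasible ∙ first′) (if-cond (first′ ∙ first′ ∙ second)
      (mapping (disjunction (first′ ∙ second) (second ∙ second))
          (pairing false refl (second ∙ second) (fills-feasible ∙ first′)))
      (second ∙ second))

    newRows-feasible : Feasible Input Matrix newRows
    newRows-feasible = mapping newRowOf-feasible (pairing [] refl (pairing false refl highs-feasible fills-feasible) first′)

    reducedRows-feasible : Feasible Input Matrix reducedRows
    reducedRows-feasible = mapping (extraction ∙ pairing false refl (keeps-feasible ∙ first′) second)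
      (extraction ∙ pairing [] refl keeps-feasible newRows-feasible)

    smallCover-feasible : Feasible (Input ⊠ Row) bool smallCover
    smallCover-feasible = conjunction (comparison (true-entries second) (second ∙ first′))
      (universal (disjunction (first′ ∙ second) (subset-test (second ∙ second) (second ∙ first′)))
          (pairing [] refl second (first′ ∙ first′)))

    reduceList-feasible : Feasible Input Input reduceList
    reduceList-feasible =
      if-cond (square-comparison first′ second) identity (
      if-cond (disjunction (smallCover-feasible ∙ ⟨ identity , highs-feasible ⟩)
          (negation (universal (negation smallCover-feasible) first′)))
        (constant ([] , [])) (
      if-cond (disjunction (comparison second (true-entries highs-feasible))
          (negation (square-comparison (true-entries keeps-feasible) second)))
        (constant (K₂-rows , [])) ⟨ reducedRows-feasible , second ⟩))

  private variable
    n : ℕ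

  length-trues : ∀ (p : Subset n) → length (trues (toList p)) ≡ ∣ p ∣
  length-trues []          = refl
  length-trues (true  ∷ p) = cong suc (length-trues p)
  length-trues (false ∷ p) = length-trues p

  pairUp-toList : ∀ {A B C : Set} (d : B) (f : A → B → C) (xs : Vec A n) (ys : Vec B n) →
    map (uncurry f) (pairUp d (toList xs) (toList ys)) ≡ toList (Vec.zipWith f xs ys)
  pairUp-toList d f []       []       = refl
  pairUp-toList d f (x ∷ xs) (y ∷ ys) = cong (f x y ∷_) (pairUp-toList d f xs ys)

  pairUp-rows : ∀ {A C : Set} {D : Set} (f : A → Vec Bool n → C) (g : A × List Bool → D) (h : C → D) →
    (∀ x r → g (x , toList r) ≡ h (f x r)) → ∀ {m} (xs : Vec A m) (M : Vec (Vec Bool n) m) →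
    map g (pairUp [] (toList xs) (map toList (toList M))) ≡ map h (toList (Vec.zipWith f xs M))
  pairUp-rows f g h eq []       []      = refl
  pairUp-rows f g h eq (x ∷ xs) (r ∷ M) = cong₂ _∷_ (eq x r) (pairUp-rows f g h eq xs M)

  every-toList : ∀ (bs : Vec Bool n) → every bs ≡ and (toList bs)
  every-toList []       = refl
  every-toList (b ∷ bs) = cong (b ∧_) (every-toList bs)

  subsetOf-toList : ∀ (p q : Subset n) → subsetOf (toList p) (toList q) ≡ p ⊆ᵇ q
  subsetOf-toList p q = trans (cong and (pairUp-toList false (λ a b → not a ∨ b) p q))
      (sym (every-toList (Vec.zipWith (λ a b → not a ∨ b) p q)))

  firstTrues-toList : ∀ q (p : Subset n) → firstTrues q (toList p) ≡ toList (first (length q) p)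
  firstTrues-toList q        []          = refl
  firstTrues-toList q        (false ∷ p) = cong (false ∷_) (firstTrues-toList q p)
  firstTrues-toList []       (true ∷ p)  = cong (false ∷_) (firstTrues-toList [] p)
  firstTrues-toList (_ ∷ q)  (true ∷ p)  = cong (true ∷_) (firstTrues-toList q p)

  select-toList : ∀ {A : Set} (d : A) (p : Subset n) (xs : Vec A n) → marked (pairUp d (toList p) (toList xs)) ≡
      toList (select p xs)
  select-toList d []          []       = refl
  select-toList d (true  ∷ p) (x ∷ xs) = cong (x ∷_) (select-toList d p xs)
  select-toList d (false ∷ p) (x ∷ xs) = select-toList d p xs

  select-rows : ∀ {m} (p : Subset n) (M : Vec (Vec Bool m) n) →
    marked (pairUp [] (toList p) (map toList (toList M))) ≡ map toList (toList (select p M))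
  select-rows []          []      = refl
  select-rows (true  ∷ p) (r ∷ M) = cong (toList r ∷_) (select-rows p M)
  select-rows (false ∷ p) (r ∷ M) = select-rows p M

  module _ (G : Graph) (k : ℕ) where
    open Reduction G k

    private
      γ : El Input
      γ = input (G , k)

      length-k : length (replicate k tt) ≡ k
      length-k = length-replicate k

    highs-toList : highs γ ≡ toList high
    highs-toList = trans (sym (map-∘ (toList (matrix G)))) (trans
      (map-cong (λ r → cong₂ _≤ᵇ_ length-k (length-trues r)) (toList (matrix G))) (sym (toList-map _ (matrix G))))

    lows-toList : lows γ ≡ toList low
    lows-toList = trans (cong (λ h → map (λ (x , r) → not x ∧ subsetOf r h) (pairUp [] h (proj₁ γ))) highs-toList)
      (trans (pairUp-rows (λ h r → not h ∧ (r ⊆ᵇ high)) (λ (x , r) → not x ∧ subsetOf r (toList high)) id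
        (λ h r → cong (not h ∧_) (subsetOf-toList r high)) high (matrix G)) (map-id _))

    quota-length : length (if null (trues (highs γ)) then [] else tailˡ (replicate k tt)) ≡ quota ∣ high ∣ k
    quota-length = trans (cong (λ h → length (if null (trues h) then [] else tailˡ (replicate k tt))) highs-toList)
      (aux (trues (toList high)) (length-trues high) k)
      where
      aux : ∀ {A : Set} (xs : List A) {h} → length xs ≡ h → ∀ k → length
          (if null xs then [] else tailˡ (replicate k tt)) ≡ quota h k
      aux []       refl k       = refl
      aux (x ∷ xs) refl zero    = refl
      aux (x ∷ xs) refl (suc k) = length-replicate k

    fills-toList : fills γ ≡ toList fillers
    fills-toList = trans (cong (firstTrues _) lows-toList) (trans (firstTrues-toList _ low)
        (cong (λ m → toList (first m low)) quota-length))

    keeps-toList : keeps γ ≡ toList kept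
    keeps-toList = trans (cong₂ (λ l f → map (λ (x , y) → not x ∨ y) (pairUp false l f)) lows-toList fills-toList)
      (pairUp-toList false (λ l f → not l ∨ f) low fillers)

    zip-toList : ∀ {m} (p q : Vec Bool m) → pairUp false (toList p) (toList q) ≡ toList (Vec.zip p q)
    zip-toList []      []      = refl
    zip-toList (x ∷ p) (y ∷ q) = cong ((x , y) ∷_) (zip-toList p q)

    newRowOf-toList : ∀ x (r : Subset (order G)) → newRowOf γ (x , toList r) ≡ toList (newRow x r)
    newRowOf-toList (h , true)      r = highs-toList
    newRowOf-toList (true , false)  r = trans (cong (λ f → map (λ (x , y) → x ∨ y) (pairUp false (toList r) f)) fills-toList)
      (pairUp-toList false _∨_ r fillers)
    newRowOf-toList (false , false) r = refl

    newRows-toList : newRows γ ≡ map toList (toList newMatrix)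
    newRows-toList = trans (cong₂ (λ h f → map (newRowOf γ) (pairUp [] (pairUp false h f) (proj₁ γ))) highs-toList
        fills-toList)
      (trans (cong (λ z → map (newRowOf γ) (pairUp [] z (proj₁ γ))) (zip-toList high fillers))
        (pairUp-rows newRow (newRowOf γ) toList newRowOf-toList (Vec.zip high fillers) (matrix G)))

    reducedRows-toList : reducedRows γ ≡ map toList (toList reducedMatrix)
    reducedRows-toList = trans (cong₂ (λ p M → map (λ r → marked (pairUp false p r)) (marked (pairUp [] p M)))
        keeps-toList newRows-toList)
      (trans (cong (map (λ r → marked (pairUp false (toList kept) r))) (select-rows kept newMatrix))
        (trans (sym (map-∘ (toList (select kept newMatrix))))
          (trans (map-cong (λ r → select-toList false kept r) (toList (select kept newMatrix)))
            (trans (map-∘ (toList (select kept newMatrix))) (cong (map toList)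
                (sym (toList-map (select kept) (select kept newMatrix))))))))

    smallCover-toList : ∀ (C : Subset (order G)) → smallCover (γ , toList C) ≡ small C
    smallCover-toList C = cong₂ _∧_ (cong₂ _≤ᵇ_ (length-trues C) length-k)
      (trans (cong and (trans (pairUp-rows (λ c r → c ∨ (r ⊆ᵇ C)) (λ (c , r) → c ∨ subsetOf r (toList C)) id
        (λ c r → cong (c ∨_) (subsetOf-toList r C)) C (matrix G)) (map-id _)))
            (sym (every-toList (Vec.zipWith (λ c r → c ∨ (r ⊆ᵇ C)) C (matrix G)))))

    someNbrs-toList : not (all (λ r → not (smallCover (γ , r))) (proj₁ γ)) ≡ someNbrs
    someNbrs-toList = cong not (trans (cong and (trans (sym (map-∘ (toList (matrix G))))
      (trans (map-cong (λ r → cong not (smallCover-toList r)) (toList (matrix G))) (sym (toList-map _ (matrix G))))))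
          (sym (every-toList (Vec.map (λ r → not (small r)) (matrix G)))))

    private
      if-cong : ∀ {A : Set} {b b′ : Bool} {x x′ y y′ : A} → b ≡ b′ → x ≡ x′ → y ≡ y′ → (if b then x else y) ≡
          (if b′ then x′ else y′)
      if-cong refl refl refl = refl

    reduceList-input : reduceList γ ≡ input (reduce (G , k))
    reduceList-input = trans
      (if-cong (cong₂ _≤ᵇ_ (trans (length-map toList (toList (matrix G))) (length-toList (matrix G)))
          (cong₂ _*_ length-k length-k)) refl
        (trans (if-cong (cong₂ _∨_ (trans (cong (λ h → smallCover (γ , h)) highs-toList) (smallCover-toList high))
            someNbrs-toList) refl
          (trans (if-cong (cong₂ _∨_ (cong₂ _≤ᵇ_ length-k (trans (cong (length ∘ trues) highs-toList) (length-trues high)))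
              (cong not (cong₂ _≤ᵇ_ (trans (cong (length ∘ trues) keeps-toList) (length-trues kept))
                  (cong₂ _*_ length-k length-k)))) refl
              (cong (_, replicate k tt) reducedRows-toList))
            (sym (if-float input ((k ≤ᵇ ∣ high ∣) ∨ not (∣ kept ∣ ≤ᵇ k * k)) {K₂ , 0} {reduced , k}))))
          (sym (if-float input (small high ∨ someNbrs) {K₀ , 0}))))
      (sym (if-float input (order G ≤ᵇ k * k) {G , k}))

  encode-input : ∀ x → encode x ≡ code Input (input x)
  encode-input (G , k) = cong₂ cons (rows (toList (matrix G))) (units k)
    where
    rows : ∀ (rs : List (Vec Bool (order G))) → encodeList (encodeList encodeBool ∘ toList) rs ≡ code Matrix (map toList rs)
    rows []       = refl
    rows (r ∷ rs) = cong (cons _) (rows rs)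
    units : ∀ k → unary k ≡ code (list unit) (replicate k tt)
    units zero    = refl
    units (suc k) = cong (cons nil) (units k)

  weight-input : ∀ x → weight (encode x) ≤ 3 + 6 * (size x + proj₂ x)
  weight-input (G , k) = begin
    suc (weight (encodeList (encodeList encodeBool ∘ toList) (toList (matrix G))) + weight (unary k))
      ≤⟨ s≤s (+-mono-≤ (rows (matrix G)) (≤-reflexive (units k))) ⟩
    suc (suc (N * (2 + N * 4)) + (1 + k * 2))
      ≡⟨ solve 2 (λ n k → con 1 :+ (con 1 :+ n :* (con 2 :+ n :* con 4) :+ (con 1 :+ k :* con 2)) := con 3 :+
          (n :* con 2 :+ n :* n :* con 4 :+ k :* con 2)) refl N k ⟩
    3 + (N * 2 + N * N * 4 + k * 2)
      ≤⟨ +-monoʳ-≤ 3 (+-mono-≤ (+-monoˡ-≤ (N * N * 4) (*-monoˡ-≤ 2 (n≤n² N))) (*-monoʳ-≤ k {2} {6} (m≤m+n 2 4))) ⟩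
    3 + (N * N * 2 + N * N * 4 + k * 6)
      ≡⟨ solve 2 (λ n k → con 3 :+ (n :* n :* con 2 :+ n :* n :* con 4 :+ k :* con 6) := con 3 :+ con 6 :*
          (n :* n :+ k)) refl N k ⟩
    3 + 6 * (N * N + k) ∎
    where
    open ≤-Reasoning
    N : ℕ
    N = order G
    n≤n² : ∀ n → n ≤ n * n
    n≤n² zero    = z≤n
    n≤n² (suc n) = m≤m+n (suc n) _
    units : ∀ k → weight (unary k) ≡ 1 + k * 2
    units zero    = refl
    units (suc k) = cong (2 +_) (units k)
    row : ∀ {m} (r : Vec Bool m) → weight (encodeList encodeBool (toList r)) ≤ 1 + m * 4
    row []      = ≤-refl
    row (b ∷ r) = s≤s (+-mono-≤ (weight-bool b) (row r))
    rows : ∀ {m l} (M : Vec (Vec Bool m) l) → weight (encodeList (encodeList encodeBool ∘ toList) (toList M)) ≤ 1 + l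
        * (2 + m * 4)
    rows []      = ≤-refl
    rows {m} {suc l} (r ∷ M) = s≤s (≤-trans (+-mono-≤ (row r) (rows M)) (≤-reflexive (+-suc (1 + m * 4) (l * (2 + m * 4)))))

  reduce-polyTime : PolyTime reduce
  reduce-polyTime = F.program 0 , bound , λ x →
    let s , t , r , t≤ , out , _ = F.runs 0 ((λ _ → nil) [ 0 ↦ encode x ]) (input x) (encode-input x)
    in t , ≤-trans t≤ (≤-trans (ev-mono F.time (≤-trans (≤-reflexive (cong weight (sym (encode-input x)))) (weight-input x)))
         (≤-reflexive (eval (size x + proj₂ x)))) ,
       s , r , trans out (trans (cong (code Input) (uncurry reduceList-input x)) (sym (encode-input (reduce x))))
    where
    module F = Feasible reduceList-feasible
    line : Polynomial
    line = [ 3 ] ⊕ [ 6 ] ⊗ (0 ∷ [ 1 ])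
    bound : Polynomial
    bound = F.time ⊚ line
    eval : ∀ y → ev F.time (3 + 6 * y) ≡ evalPoly bound y
    eval y = sym (trans (sym (ev-evalPoly bound y)) (trans (⊚-eval F.time line y) (cong (ev F.time)
      (trans (⊕-eval [ 3 ] ([ 6 ] ⊗ (0 ∷ [ 1 ])) y) (cong₂ _+_ (const-eval 3 y) (trans (⊗-eval [ 6 ] (0 ∷ [ 1 ]) y)
        (cong₂ _*_ (const-eval 6 y) (trans (shift-eval [ 1 ] y)
            (trans (cong (y *_) (const-eval 1 y)) (*-identityʳ y))))))))))

module _ where

  private variable
    a : Ty

  plus times : List ⊤ → List ⊤ → List ⊤
  plus xs ys  = foldl (λ ys x → x ∷ ys) ys xs
  times xs ys = foldl (λ zs _ → plus ys zs) [] xs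

  length-plus : ∀ xs ys → length (plus xs ys) ≡ length xs + length ys
  length-plus []       ys = refl
  length-plus (x ∷ xs) ys = trans (length-plus xs (x ∷ ys)) (+-suc (length xs) (length ys))

  length-times : ∀ xs ys → length (times xs ys) ≡ length xs * length ys
  length-times xs ys = trans (go [] xs) (+-identityʳ _)
    where
    go : ∀ zs (xs : List ⊤) → length (foldl (λ zs _ → plus ys zs) zs xs) ≡ length xs * length ys + length zs
    go zs []       = refl
    go zs (x ∷ xs) = trans (go (plus ys zs) xs) (trans (cong (length xs * length ys +_) (length-plus ys zs))
      (trans (sym (+-assoc (length xs * length ys) (length ys) (length zs)))
          (cong (_+ length zs) (+-comm (length xs * length ys) (length ys)))))

  plus-feasible : {xs ys : El a → List ⊤} → Feasible a (list unit) xs → Feasible a (list unit) ys → Feasible a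
      (list unit) (λ e → plus (xs e) (ys e))
  plus-feasible {a} {xs} {ys} XS YS = fold (prepend ∙ ⟨ second , second ∙ first′ ⟩) YS XS [ 2 ] λ e zs x →
    ≤-reflexive (trans (+-comm 2 (weight (code (list unit) zs)))
        (cong (weight (code (list unit) zs) +_) (sym (const-eval 2 (weight (code a e) + 1)))))

  weight-plus : ∀ xs ys → weight (code (list unit) (plus xs ys)) ≤ weight (code (list unit) ys) + weight
      (code (list unit) xs)
  weight-plus []       ys = m≤m+n _ 1
  weight-plus (x ∷ xs) ys = ≤-trans (weight-plus xs (x ∷ ys))
      (≤-reflexive (trans (cong (_+ w) (+-comm 2 (weight (code (list unit) ys))))
      (+-assoc (weight (code (list unit) ys)) 2 w)))
    where
    w : ℕ
    w = weight (code (list unit) xs)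

  times-feasible : {xs ys : El a → List ⊤} → Feasible a (list unit) xs → Feasible a (list unit) ys → Feasible a
      (list unit) (λ e → times (xs e) (ys e))
  times-feasible {a} {xs} {ys} XS YS = fold (plus-feasible (YS ∙ first′ ∙ first′) (second ∙ first′)) (constant []) XS
      (growth YS) λ e zs x →
    ≤-trans (weight-plus (ys e) zs) (+-monoʳ-≤ (weight (code (list unit) zs))
        (≤-trans (output≤ YS e) (ev-mono (growth YS) (m≤m+n (weight (code a e)) 1))))

  kernelBound : ℕ → ℕ
  kernelBound k = k * k * (k * k) + (k + 4)

  square : List ⊤ → List ⊤
  square xs = times xs xs

  opaque
    kernelBound-feasible : Feasible (list unit) (list unit) (λ xs → plus (times (square xs) (square xs))
        (plus xs (replicate 4 tt)))
    kernelBound-feasible = plus-feasible (times-feasible (times-feasible identity identity)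
        (times-feasible identity identity))
      (plus-feasible identity (constant (replicate 4 tt)))

  kernelBound-computable : Computable kernelBound
  kernelBound-computable = F.program 0 , λ k →
    let s , t , r , _ , out , _ = F.runs 0 ((λ _ → nil) [ 0 ↦ unary k ]) (replicate k tt) (units k)
    in t , s , r , trans out (trans (canonical (plus (times (square (replicate k tt)) (square (replicate k tt)))
        (plus (replicate k tt) (replicate 4 tt)))) (cong unary (len k)))
    where
    module F = Feasible kernelBound-feasible
    units : ∀ k → unary k ≡ code (list unit) (replicate k tt)
    units zero    = refl
    units (suc k) = cong (cons nil) (units k)
    canonical : ∀ xs → code (list unit) xs ≡ unary (length xs)
    canonical []       = refl
    canonical (x ∷ xs) = cong (cons nil) (canonical xs)
    len : ∀ k → length (plus (times (square (replicate k tt)) (square (replicate k tt)))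
        (plus (replicate k tt) (replicate 4 tt))) ≡ kernelBound k
    len k = trans (length-plus (times (square ks) (square ks)) (plus ks (replicate 4 tt))) (cong₂ _+_
        (trans (length-times (square ks) (square ks)) (cong₂ _*_ sq sq))
        (trans (length-plus ks (replicate 4 tt)) (cong (_+ 4) (length-replicate k))))
      where
      ks : List ⊤
      ks = replicate k tt
      sq : length (square ks) ≡ k * k
      sq = trans (length-times ks ks) (cong₂ _*_ (length-replicate k) (length-replicate k))

  small-fixed : ∀ G k → order G ≤ k * k → reduce (G , k) ≡ (G , k)
  small-fixed G k n≤k² with order G ≤ᵇ k * k in eq
  ... | true  = refl
  ... | false = contradiction (≤⇒≤ᵇ n≤k²) (¬T-≡false eq)

  outcome-fixed : ∀ {G k y} → Outcome G k y → reduce y ≡ y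
  outcome-fixed {G} {k} (unchanged n≤k²)      = small-fixed G k n≤k²
  outcome-fixed (accepted _ _ _ _)            = refl
  outcome-fixed (rejected _ _ _)              = refl
  outcome-fixed {G} {k} (shrunk _ _ _ fits) = small-fixed (Reduction.reduced G k) k fits

  reduce-idempotent : ∀ x → reduce (reduce x) ≡ reduce x
  reduce-idempotent (G , k) = outcome-fixed (outcome G k)

  -- A graph on at most one vertex is edgeless.
  tiny-positive : ∀ G k → order G ≤ 1 → Positive (G , k)
  tiny-positive G k n≤1 = list⇒positive G ([] , z≤n , λ v w a → contradiction a (¬T-≡false (no-edge v w)))
    where
    no-edge : ∀ v w → adj G v w ≡ false
    no-edge v w = subst (λ w → adj G v w ≡ false) (Fin.toℕ-injective (trans (zero-only v) (sym (zero-only w))))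
        (adj-irrefl G v)
      where
      zero-only : ∀ (v : Fin (order G)) → toℕ v ≡ 0
      zero-only v = n≤0⇒n≡0 (≤-pred (≤-trans (Fin.toℕ<n v) n≤1))

  reduce-shrinks : ∀ x → size (reduce x) ≤ size x
  reduce-shrinks (G , k) = shrinks (outcome G k)
    where
    shrinks : ∀ {y} → Outcome G k y → size y ≤ size (G , k)
    shrinks (unchanged _)      = ≤-refl
    shrinks (accepted _ _ _ _) = z≤n
    shrinks (rejected _ noSmall r) = *-mono-≤ 2≤n 2≤n
      where
      2≤n : 2 ≤ order G
      2≤n = ≰⇒> λ n≤1 → rejected⇒¬positive G k noSmall r (tiny-positive G k n≤1)
    shrinks (shrunk large _ _ fits) = *-mono-≤ kept≤ kept≤
      where
      kept≤ : ∣ Reduction.kept G k ∣ ≤ order G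
      kept≤ = ≤-trans fits (<⇒≤ large)

  reduce-bounded : ∀ x → size (reduce x) + proj₂ (reduce x) ≤ kernelBound (proj₂ x)
  reduce-bounded (G , k) = bounded (outcome G k)
    where
    bounded : ∀ {y} → Outcome G k y → size y + proj₂ y ≤ kernelBound k
    bounded (unchanged n≤)     = +-mono-≤ (*-mono-≤ n≤ n≤) (m≤m+n k 4)
    bounded (accepted _ _ _ _) = z≤n
    bounded (rejected _ _ _)   = ≤-trans (m≤n+m 4 k) (m≤n+m (k + 4) (k * k * (k * k)))
    bounded (shrunk _ _ _ fits) = +-mono-≤ (*-mono-≤ fits fits) (m≤m+n k 4)

  reductionRule : Rule
  reductionRule = record
    { apply = reduce ; polyTime = reduce-polyTime ; equivalent = reduce-equivalent ; shrinking = reduce-shrinks }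

  _≟ᴳ_ : (x y : Instance) → Dec (x ≡ y)
  (G , k) ≟ᴳ (H , l) with order G ≟ order H
  ... | no n≢ = no λ { refl → n≢ refl }
  (G@(record { matrix = M }) , k) ≟ᴳ (H@(record { matrix = M′ }) , l) | yes refl
    with Vec.≡-dec (Vec.≡-dec Data.Bool.Properties._≟_) M M′ | k ≟ l
    where import Data.Bool.Properties
  ... | yes refl | yes refl = yes refl
  ... | no M≢    | _        = no λ { refl → M≢ refl }
  ... | _        | no k≢    = no λ { refl → k≢ refl }

  reductionChain : ∀ x → Σ[ c ∈ Chain [ reductionRule ] x (reduce x) ] chainLength c ≤ 1
  reductionChain x with x ≟ᴳ reduce x
  ... | no x≢  = here refl x≢ ◅ ε , ≤-refl
  ... | yes eq = stay eq
    where
    stay : ∀ {y} → x ≡ y → Σ[ c ∈ Chain [ reductionRule ] x y ] chainLength c ≤ 1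
    stay refl = ε , z≤n

  kernelization : Kernelization
  kernelization = record
    { rules           = [ reductionRule ]
    ; kernel          = reduce
    ; chain           = proj₁ ∘ reductionChain
    ; exhausted       = λ x → reduce-idempotent x ∷ []
    ; polyTime        = reduce-polyTime
    ; equivalent      = reduce-equivalent
    ; bound           = kernelBound
    ; boundComputable = kernelBound-computable
    ; bounded         = reduce-bounded
    }

  linear-chains : LinearChains kernelization
  linear-chains = 1 , λ G k → ≤-trans (proj₂ (reductionChain (G , k))) (m≤m+n 1 _)

  quadratic-kernel : QuadraticKernel kernelization
  quadratic-kernel G k h = subst (order (proj₁ (reduce (G , k))) ≤_) (cong (k *_) (sym (*-identityʳ k)))
      (quadratic h (outcome G k))
    where
    quadratic : ∀ {y} → 2 ≤ k ⊎ Positive (G , k) → Outcome G k y → order (proj₁ y) ≤ k * k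
    quadratic _ (unchanged n≤)        = n≤
    quadratic _ (accepted _ _ _ _)    = z≤n
    quadratic (inj₁ 2≤k) (rejected _ _ _) = ≤-trans 2≤k (≤-trans (≤-reflexive (sym (*-identityʳ k)))
        (*-monoʳ-≤ k (≤-trans (n≤1+n 1) 2≤k)))
    quadratic (inj₂ p) (rejected _ noSmall r) = contradiction p (rejected⇒¬positive G k noSmall r)
    quadratic _ (shrunk _ _ _ fits)   = fits

-- The parameter N of the cost bounds, as a function of |Φ(G,k)|.
scalePolynomial : Polynomial
scalePolynomial = [ 6 ] ⊗ (linear 2 ⊗ (linear 2 ⊗ linear 2))

scale-value : ∀ s → ev scalePolynomial s ≡ 6 * ((2 + s) * ((2 + s) * (2 + s)))
scale-value s = trans (⊗-eval [ 6 ] (linear 2 ⊗ (linear 2 ⊗ linear 2)) s) (cong₂ _*_ (const-eval 6 s)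
  (trans (⊗-eval (linear 2) (linear 2 ⊗ linear 2) s)
    (cong₂ _*_ (linear-eval 2 s) (trans (⊗-eval (linear 2) (linear 2) s) (cong₂ _*_ (linear-eval 2 s) (linear-eval 2 s))))))

module Scale {M N n k : ℕ} (n<M : n < M) (k<M : suc k < M) (N≡ : N ≡ 6 * (M * (M * M))) where

  private
    c : ℕ
    c = M * (M * M)

    k≤M : k ≤ M
    k≤M = ≤-trans (n≤1+n k) (<⇒≤ k<M)

    nz : NonZero M
    nz = >-nonZero (≤-trans (s≤s z≤n) n<M)

    M≤M² : M ≤ M * M
    M≤M² = m≤m*n M M {{nz}}

    M²≤c : M * M ≤ c
    M²≤c = *-monoʳ-≤ M M≤M²

    M≤c : M ≤ c
    M≤c = ≤-trans M≤M² M²≤c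

    2c≤N : c + c ≤ N
    2c≤N = ≤-trans (+-monoʳ-≤ c (m≤m+n c _)) (≤-reflexive (sym N≡))

    c≤N : c ≤ N
    c≤N = ≤-trans (m≤m+n c c) 2c≤N

  4≤N : 4 ≤ N
  4≤N = ≤-trans (≤-trans (m≤m+n 4 2) (≤-trans (≤-reflexive (sym (*-identityʳ 6)))
      (*-monoʳ-≤ 6 (≤-trans (≤-trans (s≤s z≤n) n<M) M≤c)))) (≤-reflexive (sym N≡))

  n<N : n < N
  n<N = ≤-trans n<M (≤-trans M≤c c≤N)

  2k<N : k + k < N
  2k<N = ≤-trans (+-mono-≤ (≤-trans (<⇒≤ k<M) M≤c) (≤-trans k≤M M≤c)) 2c≤N

  holes<N : k * suc k < N
  holes<N = ≤-trans (s≤s (m≤n+m (k * suc k) k)) (≤-trans (*-mono-≤ (<⇒≤ k<M) (<⇒≤ k<M)) (≤-trans M²≤c c≤N))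

  Φ≤N : ∀ H → order H ≤ n → length (Φ (H , k)) ≤ N
  Φ≤N H h≤n = ≤-trans (Translation.length-Φ H k) (bound (order H) (≤-trans h≤n (<⇒≤ n<M)))
    where
    s2 : ∀ {x y} → x ≤ M → y ≤ M → x * y ≤ c
    s2 x y = ≤-trans (*-mono-≤ x y) M²≤c
    s3 : ∀ {x y z} → x ≤ M → y ≤ M → z ≤ M → x * (y * z) ≤ c
    s3 x y z = *-mono-≤ x (*-mono-≤ y z)
    bound : ∀ h → h ≤ M → h * h + (h * k + (k + (h * h * k + (h * (k * k) + h * h)))) ≤ N
    bound h h≤ = ≤-trans (+-mono-≤ (s2 h≤ h≤) (+-mono-≤ (s2 h≤ k≤M) (+-mono-≤ (≤-trans k≤M M≤c)
      (+-mono-≤ (≤-trans (≤-reflexive (*-assoc h h k)) (s3 h≤ h≤ k≤M)) (+-mono-≤ (s3 h≤ k≤M k≤M) (s2 h≤ h≤))))))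
      (≤-trans (≤-reflexive (cong (λ z → c + (c + (c + (c + (c + z))))) (sym (+-identityʳ c)))) (≤-reflexive (sym N≡)))

module ScaleOf (G : Graph) (k : ℕ) = Scale
  {2 + Φsize (G , k)} {ev scalePolynomial (Φsize (G , k))} {order G} {k}
  (s≤s (≤-trans (order≤distinctPairs (order G)) (s≤s (Translation.pairs≤Φsize G k))))
  (s≤s (s≤s (Translation.k≤Φsize G k)))
  (scale-value (Φsize (G , k)))

module _ {V : Set} where

  ⊩⇒⊢ : ∀ N {Γ p Δ} → Frege._⊩⟨_⟩_ {V} N Γ p Δ → ∃[ s ] s ≤ ev p N × Γ ⊢[ s ] Δ
  ⊩⇒⊢ N d = _ , short , _ , derivation , conclusions , refl
    where open Frege._⊩⟨_⟩_ d

rename-id : ∀ {V : Set} (F : CNF V) → rename id F ≡ F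
rename-id F = trans (map-cong clause-id F) (map-id F)
  where
  literal-id : ∀ {V : Set} (ℓ : Literal V) → renameLiteral id ℓ ≡ ℓ
  literal-id (pos x) = refl
  literal-id (neg x) = refl
  clause-id : ∀ {V : Set} (c : Clause V) → map (renameLiteral id) c ≡ c
  clause-id c = trans (map-cong literal-id c) (map-id c)

witness-cost : Polynomial
witness-cost = [ 1000 ] ⊕ shift (uniform 30 30)

-- A single case suffices: Ξ is a constant true formula.
stepWitness : ∀ x y N (σ : VarOf y → Formula (VarOf x)) → length (Φ y) ≤ N →
  (∀ {c} → c ∈ˡ Φ y → Frege._⊢⟨_⟩_ N (clauses (Φ x)) (uniform 30 30) (substitute σ (⋁ (map literal c)))) →
  StepWitness 1 (ev witness-cost N) x y
stepWitness x y N σ Φ≤N derive = record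
  { r = 1 ; r≤R = ≤-refl ; Ξ = λ _ → `¬ `⊥ ; tautology = λ _ → refl
  ; s₀ = proj₁ true-proof ; proof = proj₂ (proj₂ true-proof)
  ; W = λ _ → VarOf y ; η = λ _ → Φ y ; η-iso = λ _ → ↔-id _ , rename-id (Φ y)
  ; s = λ _ → proj₁ step-proof ; implications = λ _ → σ , proj₂ (proj₂ step-proof)
  ; total = ≤-trans (+-mono-≤ (proj₁ (proj₂ true-proof)) (≤-trans (≤-reflexive (+-identityʳ _)) (proj₁ (proj₂ step-proof))))
      (≤-reflexive (sym (⊕-eval [ 1000 ] (shift (uniform 30 30)) N))) }
  where
  open Frege {VarOf x} N
  true-proof : ∃[ s ] s ≤ ev [ 1000 ] N × [] ⊢[ s ] [ ⋁ (tabulate {n = 1} (λ _ → `¬ `⊥)) ]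
  true-proof = ⊩⇒⊢ N (weaken {q = [ 1000 ]} (axiom (∨I₁ _ _) $ᶠ ⊤ᶠ))
  each : ∀ {A} → A ∈ˡ map (substitute σ) (clauses (Φ y)) → clauses (Φ x) ⊢⟨ uniform 30 30 ⟩ A
  each A∈ with ∈-map⁻ (substitute σ) A∈
  ... | F , F∈ , refl with ∈-map⁻ (⋁ ∘ map literal) F∈
  ... | c , c∈ , refl = derive c∈
  step-proof : ∃[ s ] s ≤ ev (shift (uniform 30 30)) N × ((`¬ `⊥ ∷ clauses (Φ x)) ⊢[ s ] map (substitute σ) (clauses (Φ y)))
  step-proof = ⊩⇒⊢ N (wk (collect-≤ (map (substitute σ) (clauses (Φ y)))
    (≤-trans (≤-reflexive (trans (length-map (substitute σ) (clauses (Φ y))) (length-map (⋁ ∘ map literal) (Φ y))))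
        Φ≤N) each))

module _ (G : Graph) (k : ℕ) where
  open ScaleOf G k

  private
    N : ℕ
    N = ev scalePolynomial (Φsize (G , k))

  outcome-witness : Negative (G , k) → ∀ {y} → Outcome G k y → (G , k) ≢ y → StepWitness 1 (ev witness-cost N) (G , k) y
  outcome-witness _ (unchanged _) x≢x = contradiction refl x≢x
  outcome-witness negative (accepted C _ C≤k t) _ = contradiction
    (list⇒positive G (elements C , ≤-trans (≤-reflexive (length-tabulate (embed C))) C≤k ,
      λ v w a → Sum.map (∈-elements C) (∈-elements C) (covers⁻ (matrix G) C t v w a)))
    (negative⇒¬positive {G , k} negative)
  outcome-witness _ (rejected large noSmall r) _ = stepWitness (G , k) (K₂ , 0) N (λ _ → `⊥) 4≤N
    λ _ → weaken (axiom (⊥E _) $ᶠ rejection-refutation noSmall r Φ-cover)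
    where
    open VertexCover G k N (<⇒≤ n<N) (<⇒≤ 2k<N) holes<N
    open Frege {VarOf (G , k)} N
  outcome-witness _ (shrunk large noSmall h<k fits) _ = shrunk-witness G k N n<N 2k<N holes<N large noSmall h<k fits
      (Φ≤N (Reduction.reduced G k) (≤-trans fits (<⇒≤ large)))
    where
    shrunk-witness : ∀ G k N → order G < N → k + k < N → k * suc k < N → k * k < order G →
      Reduction.NoSmall G k → ∣ Reduction.high G k ∣ < k → ∣ Reduction.kept G k ∣ ≤ k * k →
      length (Φ (Reduction.reduced G k , k)) ≤ N → StepWitness 1 (ev witness-cost N) (G , k) (Reduction.reduced G k , k)
    shrunk-witness G (suc m) N n<N 2k<N holes<N large noSmall h<k fits Φ≤N = choose-anchor
        (Fin.any? λ v → T? (lookup (Reduction.high G (suc m)) v))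
      where
      open ShrunkStep G m N n<N 2k<N holes<N large noSmall h<k fits
      finish : ∀ a → On (Reduction.high G (suc m)) a ⊎ (∀ v → ¬ On (Reduction.high G (suc m)) v) → _
      finish a anchor = stepWitness (G , suc m) (Reduction.reduced G (suc m) , suc m) N (Substitution.σ a anchor) Φ≤N
        (Substitution.all-derivable a anchor)
      choose-anchor : Dec (∃[ v ] On (Reduction.high G (suc m)) v) → _
      choose-anchor (yes (a , h)) = finish a (inj₁ h)
      choose-anchor (no ¬h) = finish (fromℕ< (≤-trans (s≤s z≤n) large)) (inj₂ λ v h → ¬h (v , h))

chain-end : ∀ {x y} → Chain [ reductionRule ] x y → y ≡ x ⊎ y ≡ reduce x
chain-end ε = inj₁ refl
chain-end {x} (here eq _ ◅ c) = inj₂ (one-step eq (chain-end c))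
  where
  one-step : ∀ {y z} → reduce x ≡ y → z ≡ y ⊎ z ≡ reduce y → z ≡ reduce x
  one-step refl (inj₁ eq) = eq
  one-step refl (inj₂ eq) = trans eq (reduce-idempotent x)
chain-end (there _ () ◅ c)

frege-sound : FregeSound kernelization
frege-sound = 1 , bound , ≤-refl , λ x negative c s → sound x negative (chain-end c) s
  where
  bound : Polynomial
  bound = witness-cost ⊚ scalePolynomial
  bound-eval : ∀ z → ev witness-cost (ev scalePolynomial z) ≡ evalPoly bound z
  bound-eval z = trans (sym (⊚-eval witness-cost scalePolynomial z)) (ev-evalPoly bound z)
  sound : ∀ x → Negative x → ∀ {y z} → y ≡ x ⊎ y ≡ reduce x → Step [ reductionRule ] y z →
    StepWitness 1 (evalPoly bound (Φsize x)) y z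
  sound (G , k) negative (inj₁ refl) (here refl x≢) = subst (λ m → StepWitness 1 m (G , k) (reduce (G , k)))
      (bound-eval (Φsize (G , k)))
    (outcome-witness G k negative (outcome G k) x≢)
  sound x negative (inj₂ refl) (here refl x≢) = contradiction (sym (reduce-idempotent x)) x≢
  sound _ _ _ (there _ ())

poly-refutable : ∀ k → PolyRefutable k
poly-refutable k = bound , refute
  where
  bound : Polynomial
  bound = search-cost (suc k) ⊚ scalePolynomial
  bound-eval : ∀ z → ev (search-cost (suc k)) (ev scalePolynomial z) ≡ evalPoly bound z
  bound-eval z = trans (sym (⊚-eval (search-cost (suc k)) scalePolynomial z)) (ev-evalPoly bound z)
  refute : ∀ G → Negative (G , k) → ∃[ s ] s ≤ evalPoly bound (Φsize (G , k)) × clauses (Φ (G , k)) ⊢[ s ] [ `⊥ ]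
  refute G negative = bounded result
    where
    open ScaleOf G k
    N : ℕ
    N = ev scalePolynomial (Φsize (G , k))
    open VertexCover G k N (<⇒≤ n<N) (<⇒≤ 2k<N) holes<N
    open Frege {VarOf (G , k)} N
    empty : ∀ u → On ∅ u → clauses (Φ (G , k)) ⊢⟨ [ 1 ] ⟩ InCover u
    empty u o = ⊥-elim (¬T-≡false (Vec.lookup-replicate u false) o)
    bounded : ∃[ s ] s ≤ ev (search-cost (suc k)) N × clauses (Φ (G , k)) ⊢[ s ] [ `⊥ ] →
      ∃[ s ] s ≤ evalPoly bound (Φsize (G , k)) × clauses (Φ (G , k)) ⊢[ s ] [ `⊥ ]
    bounded (s , s≤ , proof) = s , ≤-trans s≤ (≤-reflexive (bound-eval (Φsize (G , k)))) , proof
    result : ∃[ s ] s ≤ ev (search-cost (suc k)) N × clauses (Φ (G , k)) ⊢[ s ] [ `⊥ ]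
    result = ⊩⇒⊢ N (search (negative⇒¬positive {G , k} negative ∘ list⇒positive G) (suc k) ∅
      (trans (cong (suc k +_) (∣⊥∣≡0 (order G))) (+-identityʳ (suc k))) Φ-cover empty)

theorem3 : (Σ[ K ∈ Kernelization ] LinearChains K × QuadraticKernel K × FregeSound K)
    × (∀ (k : ℕ) → PolyRefutable k)
theorem3 = (kernelization , linear-chains , quadratic-kernel , frege-sound) , poly-refutable
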